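{- Let $n$ and $\Delta$ be positive integers such that $\Delta\ge \frac{3(n-1)}{4}$, and let $G$ be an $n$-vertex $\Delta$-critical graph (so $\Delta=\Delta(G)$). If $G$ has a full-deficiency pair, then $G$ is overfull. Consequently, $G$ is obtained from an $(n-1)$-vertex $\Delta$-regular Class 1 multigraph by a vertex-splitting.
   Context: All graphs $G$ are finite and simple unless called multigraphs. $\chi'(G)$ denotes the chromatic index (least number of colors in a proper edge coloring); a (multi)graph is Class 1 if $\chi'=\Delta$ (its maximum degree). $G$ is $\Delta$-critical if $\chi'(G)=\Delta(G)+1$ and $\chi'(H)<\Delta(G)+1$ for every proper subgraph $H$. $G$ is overfull if $|E(G)|>\Delta(G)\lfloor |V(G)|/2\rfloor$. A full-deficiency pair of $G$ is a pair $(u,v)$ of adjacent vertices with $d_G(u)+d_G(v)=\Delta(G)+2$. Vertex-splitting: for a vertex $v$ with $d(v)=t\ge 2$ and neighbors (with multiplicity) $u_1,\dots,u_t$, replace $v$ by two new adjacent vertices $v_1,v_2$, joining $v_1$ to $u_1,\dots,u_s$ and $v_2$ to $u_{s+1},\dots,u_t$ for some $s\in[1,t-1]$, and keeping all other edges. -}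

module Defs where

open import Data.Nat using (ℕ; zero; suc; _+_; _*_; _<_; _⊔_)
open import Data.Nat.DivMod using (_/_)
open import Data.Fin using (Fin; zero; suc; _≟_)
open import Data.Bool using (Bool; true; false; _∨_; if_then_else_)
open import Data.Product using (Σ; ∃; _×_; _,_; proj₁; proj₂)
open import Data.Sum using (_⊎_)
open import Relation.Nullary using (¬_)
open import Relation.Nullary.Decidable using (⌊_⌋)
open import Relation.Binary.PropositionalEquality using (_≡_; _≢_)
open import Function.Bundles using (_↔_; Inverse)

record Multigraph (n : ℕ) : Set where
  field
    m        : ℕ
    ends     : Fin m → Fin n × Fin n
    loopless : ∀ a → proj₁ (ends a) ≢ proj₂ (ends a)
open Multigraph public

SameEnds : ∀ {n} → Fin n × Fin n → Fin n × Fin n → Set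
SameEnds (x , y) (x' , y') = (x ≡ x' × y ≡ y') ⊎ (x ≡ y' × y ≡ x')

IsSimple : ∀ {n} → Multigraph n → Set
IsSimple G = ∀ a b → a ≢ b → ¬ SameEnds (ends G a) (ends G b)

count : ∀ {k} → (Fin k → Bool) → ℕ
count {zero}  f = 0
count {suc k} f = (if f zero then 1 else 0) + count (λ i → f (suc i))

maxF : ∀ {k} → (Fin k → ℕ) → ℕ
maxF {zero}  f = 0
maxF {suc k} f = f zero ⊔ maxF (λ i → f (suc i))

Incident : ∀ {n} (G : Multigraph n) → Fin n → Fin (m G) → Set
Incident G v a = proj₁ (ends G a) ≡ v ⊎ proj₂ (ends G a) ≡ v

incB : ∀ {n} (G : Multigraph n) → Fin n → Fin (m G) → Bool
incB G v a = ⌊ proj₁ (ends G a) ≟ v ⌋ ∨ ⌊ proj₂ (ends G a) ≟ v ⌋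

deg : ∀ {n} (G : Multigraph n) → Fin n → ℕ
deg G v = count (incB G v)

maxDeg : ∀ {n} → Multigraph n → ℕ
maxDeg G = maxF (deg G)

Adjacent : ∀ {n} (G : Multigraph n) → Fin n → Fin n → Set
Adjacent G u v = ∃ λ a → SameEnds (ends G a) (u , v)

ProperColouringOn : ∀ {n} (G : Multigraph n) (S : Fin (m G) → Bool) (k : ℕ)
                    → (Fin (m G) → Fin k) → Set
ProperColouringOn G S k c =
  ∀ a b → a ≢ b → S a ≡ true → S b ≡ true →
  ∀ v → Incident G v a → Incident G v b → c a ≢ c b

ColourableOn : ∀ {n} (G : Multigraph n) (S : Fin (m G) → Bool) (k : ℕ) → Set
ColourableOn G S k = Σ (Fin (m G) → Fin k) (ProperColouringOn G S k)

IsChromaticIndexOn : ∀ {n} (G : Multigraph n) (S : Fin (m G) → Bool) (k : ℕ) → Set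
IsChromaticIndexOn G S k = ColourableOn G S k × (∀ j → j < k → ¬ ColourableOn G S j)

allEdges : ∀ {n} (G : Multigraph n) → Fin (m G) → Bool
allEdges G _ = true

IsChromaticIndex : ∀ {n} (G : Multigraph n) (k : ℕ) → Set
IsChromaticIndex G k = IsChromaticIndexOn G (allEdges G) k

record Subgraph {n} (G : Multigraph n) : Set where
  field
    vertsH : Fin n → Bool
    edgesH : Fin (m G) → Bool
    closed : ∀ a → edgesH a ≡ true →
             vertsH (proj₁ (ends G a)) ≡ true × vertsH (proj₂ (ends G a)) ≡ true
open Subgraph public

IsProperSubgraph : ∀ {n} {G : Multigraph n} → Subgraph G → Set
IsProperSubgraph {n} {G} H = (∃ λ a → edgesH H a ≡ false) ⊎ (∃ λ v → vertsH H v ≡ false)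

IsCritical : ∀ {n} → Multigraph n → Set
IsCritical G =
  IsChromaticIndex G (suc (maxDeg G)) ×
  (∀ (H : Subgraph G) → IsProperSubgraph H →
     ∃ λ k → IsChromaticIndexOn G (edgesH H) k × k < suc (maxDeg G))

Overfull : ∀ {n} → Multigraph n → Set
Overfull {n} G = maxDeg G * (n / 2) < m G

HasFullDeficiencyPair : ∀ {n} → Multigraph n → Set
HasFullDeficiencyPair G =
  ∃ λ u → ∃ λ v → Adjacent G u v × deg G u + deg G v ≡ maxDeg G + 2

Regular : ∀ {n} → Multigraph n → ℕ → Set
Regular G d = ∀ v → deg G v ≡ d

Class1 : ∀ {n} → Multigraph n → Set
Class1 G = IsChromaticIndex G (maxDeg G)

-- vertex splitting of v in M.  New vertex set Fin (suc k): old vertex x is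
-- suc x, v₁ := suc v, v₂ := zero.  side a = true sends the v-end of edge a
-- to v₂, otherwise to v₁.  New edge set: zero is the new edge v₁v₂, old edge
-- a is suc a.
splitEnds : ∀ {k} (M : Multigraph k) → Fin k → (Fin (m M) → Bool)
            → Fin (suc (m M)) → Fin (suc k) × Fin (suc k)
splitEnds M v side zero    = (suc v , zero)
splitEnds M v side (suc a) = (repl (proj₁ (ends M a)) , repl (proj₂ (ends M a)))
  where
  repl : _ → _
  repl x = if ⌊ x ≟ v ⌋ then (if side a then zero else suc v) else suc x

IsoEnds : ∀ {n n' e e'} → (Fin e → Fin n × Fin n) → (Fin e' → Fin n' × Fin n') → Set
IsoEnds {n} {n'} {e} {e'} E E' =
  Σ (Fin n ↔ Fin n') λ σ → Σ (Fin e ↔ Fin e') λ τ →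
    ∀ a → SameEnds (Inverse.to σ (proj₁ (E a)) , Inverse.to σ (proj₂ (E a)))
                   (E' (Inverse.to τ a))

ObtainedBySplitting : ∀ {n k} → Multigraph n → Multigraph k → Set
ObtainedBySplitting G M =
  ∃ λ v → ∃ λ side →
    (∃ λ a → Incident M v a × side a ≡ true) ×
    (∃ λ a → Incident M v a × side a ≡ false) ×
    IsoEnds (ends G) (splitEnds M v side)

{-# OPTIONS --safe #-}

-- Let ab be the full-deficiency pair.  In a Δ-colouring of G − ab every colour is missing at exactly one of
-- a and b, and exchanging a colour missing at a with one missing at b along a Kempe chain starting at another
-- vertex does not touch the edges at a and b.  So a vertex x of degree less than Δ can be made to miss
-- prescribed colours.  Small configurations around ab and x are then contradictory by a reducibility argument
-- as for the four colour theorem: uncolour the edges of the configuration, record which of its vertices miss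
-- which colours, and exchange colours along chains whose other ends are unknown until, for every possible
-- answer, the configuration can be coloured.
--
-- Suppose some vertex other than a and b has degree less than Δ, and let d(a) ≤ d(b).  If d(a) > 2, then
-- neighbours and second neighbours of b have degree Δ, any vertex at distance at least three has small degree
-- because 4Δ ≥ 3(n − 1), and by connectedness one of them ends a path of length three from b, which is
-- reducible.  If d(a) = 2, let c be the other neighbour of a.  Vertices near b miss at most one colour; two such
-- vertices and a common neighbour of them, b and c form a reducible kite, and a single one is excluded by
-- the parity of colour classes.  A vertex x far from b has two neighbours y, z of degree Δ, and again x, y, z
-- and a common neighbour of b, c, y, z are reducible.  The common neighbours exist since 4Δ ≥ 3(n − 1).
--
-- So every other vertex has degree Δ.  Each colour class then covers all vertices but one, hence n is odd
-- and |E| = Δ(n − 1)/2 + 1, and contracting ab turns the colouring into one of a Δ-regular multigraph.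

module Submission where

open import Defs hiding (closed)
open import Data.Bool using (Bool; true; false; _∨_; _∧_; not; if_then_else_; _xor_)
open import Data.Bool.Properties using (∨-zeroʳ) renaming (_≟_ to _≟ᵇ_)
open import Data.Empty using (⊥; ⊥-elim)
open import Data.Fin using (Fin; zero; suc; _≟_; #_; punchIn; punchOut; inject≤)
open import Data.Fin.Properties using (any?; suc-injective; punchOut-cong; punchOut-injective; punchInᵢ≢i; punchIn-punchOut; punchOut-punchIn; inject≤-injective; punchIn-injective)
open import Data.List using (List; []; _∷_; _++_; map; concatMap; allFin; length)
import Data.List.Properties as List
open import Data.List.Membership.Propositional using (_∈_; lose)
open import Data.List.Membership.Propositional.Properties using (∈-allFin; ∈-map⁺; ∈-map⁻; ∈-++⁺ˡ; ∈-++⁺ʳ; ∈-concatMap⁺)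
open import Data.List.Relation.Binary.Permutation.Propositional using (_↭_; ↭-refl; ↭-trans; prep; swap; ↭⇒↭ₛ)
open import Data.List.Relation.Binary.Permutation.Propositional.Properties using (↭-map-inv; ∈-resp-↭)
import Data.List.Relation.Binary.Permutation.Setoid.Properties as Permₛ
open import Data.List.Relation.Unary.All using (All; []; _∷_)
import Data.List.Relation.Unary.All as All
open import Data.List.Relation.Unary.AllPairs using ([]; _∷_)
open import Data.List.Relation.Unary.Any using (here; there)
import Data.List.Relation.Unary.Any as Any
open import Data.List.Relation.Unary.Unique.Propositional using (Unique)
open import Data.Maybe using (Maybe; just; nothing)
open import Data.Nat using (ℕ; zero; suc; _+_; _*_; _∸_; _≤_; _<_; z≤n; s≤s; _/_; _%_; _≡ᵇ_)
import Data.Nat as ℕ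
open import Data.Nat.DivMod using (+-distrib-/-∣ˡ)
open import Data.Nat.Divisibility using (divides)
open import Data.Nat.Properties hiding (_≟_; suc-injective)
open import Data.Nat.Solver using (module +-*-Solver)
open import Data.Product using (Σ; ∃; ∃₂; _×_; _,_; proj₁; proj₂)
open import Data.Sum using (_⊎_; inj₁; inj₂; [_,_]′)
import Data.Sum as Sum
open import Data.Vec using (Vec; []; _∷_; lookup; tabulate)
import Data.Vec as Vec
import Data.Vec.Properties as Vec
open import Data.Vec.Relation.Binary.Pointwise.Inductive using ([]; _∷_; Pointwise-≡⇒≡)
open import Data.Vec.Relation.Unary.All using ([]; _∷_)
open import Data.Vec.Relation.Unary.AllPairs using ([]; _∷_)
open import Data.Vec.Relation.Unary.Unique.Propositional using () renaming (Unique to Distinct)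
open import Data.Vec.Relation.Unary.Unique.Propositional.Properties using (lookup-injective)
open import Function using (_∘_; id)
open import Function.Bundles using (_↔_; mk↔ₛ′; Inverse)
open import Relation.Binary.PropositionalEquality
open import Relation.Nullary using (¬_; Dec; yes; no)
open import Relation.Nullary.Decidable using (⌊_⌋; does; _×-dec_; _⊎-dec_; ¬?)
open import Algebra.Properties.CommutativeMonoid.Sum +-0-commutativeMonoid
  using (sum; ∑-distrib-+; ∑-comm; sum-cong-≗; sum-replicate-zero)

-- Kempe chains

-- The constant 3/4 is the threshold at which four neighbourhoods of size about Δ among n vertices
-- must have a common member. The hypothesis barely reaches it, so the counts also exploit that some
-- vertices, such as b and c, lie in few of the four neighbourhoods. The number of colours missing
-- at b is d(a) - 1, and this dictates the case distinction. Two such colours suffice to force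
-- degree Δ on the second neighbours of b. With only one, a deficit of one remains possible there,
-- and the kite and the parity argument have to remove it. In return b has degree Δ, ac is a
-- full-deficiency pair as well, and all colours but one are missing at a. A reduction is a strategy
-- against an adversary who decides where chains end. Only the signatures of the few colours that
-- occur on the configuration matter for it, so a table and a checker proved sound replace a long
-- case analysis.

count-mono : ∀ {k} (f g : Fin k → Bool) → (∀ x → f x ≡ true → g x ≡ true) → count f ≤ count g
count-mono {zero}  f g f⇒g = z≤n
count-mono {suc k} f g f⇒g with f zero in f0
... | false = ≤-trans (count-mono (f ∘ suc) (g ∘ suc) (f⇒g ∘ suc)) (m≤n+m _ (if g zero then 1 else 0))
... | true rewrite f⇒g zero f0 = s≤s (count-mono (f ∘ suc) (g ∘ suc) (f⇒g ∘ suc))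

count-strict : ∀ {k} (f g : Fin k → Bool) → (∀ x → f x ≡ true → g x ≡ true) →
               ∀ y → f y ≡ false → g y ≡ true → count f < count g
count-strict {suc k} f g f⇒g zero fy gy rewrite fy | gy = s≤s (count-mono (f ∘ suc) (g ∘ suc) (f⇒g ∘ suc))
count-strict {suc k} f g f⇒g (suc y) fy gy with f zero in f0
... | false = ≤-trans (count-strict (f ∘ suc) (g ∘ suc) (f⇒g ∘ suc) y fy gy) (m≤n+m _ (if g zero then 1 else 0))
... | true rewrite f⇒g zero f0 = s≤s (count-strict (f ∘ suc) (g ∘ suc) (f⇒g ∘ suc) y fy gy)

count-cong : ∀ {k} (f g : Fin k → Bool) → (∀ x → f x ≡ g x) → count f ≡ count g
count-cong {zero}  f g f≗g = refl
count-cong {suc k} f g f≗g rewrite f≗g zero = cong (_ +_) (count-cong (f ∘ suc) (g ∘ suc) (f≗g ∘ suc))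

⌊≟⌋-refl : ∀ {k} (x : Fin k) → ⌊ x ≟ x ⌋ ≡ true
⌊≟⌋-refl x with x ≟ x
... | yes _ = refl
... | no x≢x = ⊥-elim (x≢x refl)

module _ {n} (G : Multigraph n) where

  incident? : ∀ v a → Dec (Incident G v a)
  incident? v a = (proj₁ (ends G a) ≟ v) ⊎-dec (proj₂ (ends G a) ≟ v)

  otherEnd : ∀ {v a} → Incident G v a →
             ∃ λ w → Incident G w a × w ≢ v × (∀ s → Incident G s a → s ≡ v ⊎ s ≡ w)
  otherEnd {v} {a} (inj₁ refl) =
    _ , inj₂ refl , (λ e → loopless G a (sym e)) , λ { s (inj₁ e) → inj₁ (sym e) ; s (inj₂ e) → inj₂ (sym e) }
  otherEnd {v} {a} (inj₂ refl) =
    _ , inj₁ refl , loopless G a , λ { s (inj₁ e) → inj₂ (sym e) ; s (inj₂ e) → inj₁ (sym e) }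

  Sees : ∀ {D} → (Fin (m G) → Bool) → (Fin (m G) → Fin D) → Fin n → Fin D → Set
  Sees S φ v i = ∃ λ a → S a ≡ true × Incident G v a × φ a ≡ i

  sees? : ∀ {D} S (φ : Fin (m G) → Fin D) v i → Dec (Sees S φ v i)
  sees? S φ v i = any? λ a → (S a ≟ᵇ true) ×-dec (incident? v a ×-dec (φ a ≟ i))

exchange : ∀ {k} → Fin k → Fin k → Fin k → Fin k
exchange i j x = if ⌊ x ≟ i ⌋ then j else if ⌊ x ≟ j ⌋ then i else x

module _ {k} (i j : Fin k) where

  exchange-ˡ : exchange i j i ≡ j
  exchange-ˡ rewrite ⌊≟⌋-refl i = refl

  exchange-ʳ : exchange i j j ≡ i
  exchange-ʳ with j ≟ i
  ... | yes j≡i = j≡i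
  ... | no _ rewrite ⌊≟⌋-refl j = refl

  exchange-other : ∀ {x} → x ≢ i → x ≢ j → exchange i j x ≡ x
  exchange-other {x} x≢i x≢j with x ≟ i | x ≟ j
  ... | yes e | _ = ⊥-elim (x≢i e)
  ... | no _ | yes e = ⊥-elim (x≢j e)
  ... | no _ | no _ = refl

  exchange-involutive : ∀ x → exchange i j (exchange i j x) ≡ x
  exchange-involutive x with x ≟ i | x ≟ j
  ... | yes refl | _ = exchange-ʳ
  ... | no _ | yes refl = exchange-ˡ
  ... | no p | no q = exchange-other p q

module Kempe {n} (G : Multigraph n) {D} (S : Fin (m G) → Bool) (φ : Fin (m G) → Fin D)
             (proper : ProperColouringOn G S D φ) where

  Closed : Fin D → Fin D → (Fin n → Bool) → Set
  Closed i j T = ∀ a → S a ≡ true → φ a ≡ i ⊎ φ a ≡ j → T (proj₁ (ends G a)) ≡ T (proj₂ (ends G a))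

  -- Being a path is not among the fields. An exchange only relies on two facts: no edge of the two
  -- colours leaves `verts`, and at most `v` and `end` miss one of the colours. A chain from a
  -- vertex that misses both has `end` equal to `v`.
  record Chain (i j : Fin D) (v : Fin n) : Set where
    field
      verts  : Fin n → Bool
      end    : Fin n
      closed : Closed i j verts
      start  : verts v ≡ true
      stop   : verts end ≡ true
      inner  : ∀ z → verts z ≡ true → z ≢ v → z ≢ end → Sees G S φ z i × Sees G S φ z j

  unique : ∀ {v a b} → S a ≡ true → S b ≡ true → Incident G v a → Incident G v b → φ a ≡ φ b → a ≡ b
  unique {v} {a} {b} Sa Sb va vb e with a ≟ b
  ... | yes p = p
  ... | no a≢b = ⊥-elim (proper a b a≢b Sa Sb v va vb e)

  chain-sym : ∀ {i j v} → Chain i j v → Chain j i v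
  chain-sym c = record
    { verts = verts ; end = end ; closed = λ a Sa e → closed a Sa (Sum.swap e) ; start = start ; stop = stop
    ; inner = λ z Tz p q → proj₂ (inner z Tz p q) , proj₁ (inner z Tz p q) }
    where open Chain c

  -- The chain walked so far occupies T; it is at z, about to leave along the edge of colour i, and
  -- that edge is the only one of its two colours leading out of T.
  walk : ∀ fuel (i j : Fin D) → i ≢ j → ∀ v (T : Fin n → Bool) z → T v ≡ true → T z ≡ true →
    (∀ s a → T s ≡ true → S a ≡ true → Incident G s a → φ a ≡ i ⊎ φ a ≡ j →
      (∀ w → Incident G w a → T w ≡ true) ⊎ (s ≡ z × φ a ≡ i)) →
    (∀ a w → S a ≡ true → Incident G z a → φ a ≡ i → Incident G w a → w ≢ z → T w ≡ false) →
    (∀ s → T s ≡ true → s ≢ v → s ≢ z → Sees G S φ s i × Sees G S φ s j) →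
    (z ≢ v → Sees G S φ z j) →
    count (not ∘ T) < fuel → Chain i j v
  walk (suc fuel) i j i≢j v T z Tv Tz inside fresh inner zj fu with sees? G S φ z i
  ... | no ¬zi = record { verts = T ; end = z ; closed = cl ; start = Tv ; stop = Tz ; inner = inner }
    where
    cl : Closed i j T
    cl a Sa e with T (proj₁ (ends G a)) in T1 | T (proj₂ (ends G a)) in T2
    ... | true | true = refl
    ... | false | false = refl
    ... | true | false with inside _ a T1 Sa (inj₁ refl) e
    ...   | inj₁ w = trans (sym (w _ (inj₂ refl))) T2
    ...   | inj₂ (refl , f) = ⊥-elim (¬zi (a , Sa , inj₁ refl , f))
    cl a Sa e | false | true with inside _ a T2 Sa (inj₂ refl) e
    ...   | inj₁ w = trans (sym T1) (w _ (inj₁ refl))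
    ...   | inj₂ (refl , f) = ⊥-elim (¬zi (a , Sa , inj₂ refl , f))
  ... | yes (a , Sa , za , refl) with otherEnd G za
  ...   | z′ , z′a , z′≢z , only =
    -- The vertex `z′` is entered along colour `i` and hence left along `j`, so the colours change
    -- roles at every step and `chain-sym` restores them. By `fresh`, `z′` is new, so the complement
    -- of `T` shrinks and the fuel suffices.
    chain-sym (walk fuel j i (i≢j ∘ sym) v T′ z′ (old Tv) new inside′ fresh′ inner′ (λ _ → a , Sa , z′a , refl)
      (≤-trans (count-strict _ _ sub z′ (cong not new) (cong not z′∉T)) (≤-pred fu)))
    where
    T′ : Fin n → Bool
    T′ s = T s ∨ ⌊ s ≟ z′ ⌋
    z′∉T : T z′ ≡ false
    z′∉T = fresh a z′ Sa za refl z′a z′≢z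
    old : ∀ {s} → T s ≡ true → T′ s ≡ true
    old Ts rewrite Ts = refl
    new : T′ z′ ≡ true
    new rewrite z′∉T = ⌊≟⌋-refl z′
    inv : ∀ {s} → T′ s ≡ true → T s ≡ true ⊎ s ≡ z′
    inv {s} e with T s | s ≟ z′
    ... | true | _ = inj₁ refl
    ... | false | yes p = inj₂ p
    sub : ∀ s → not (T′ s) ≡ true → not (T s) ≡ true
    sub s e with T s
    ... | false = refl
    z∈ : ∀ w → Incident G w a → T′ w ≡ true
    z∈ w wa with only w wa
    ... | inj₁ refl = old Tz
    ... | inj₂ refl = new
    inside′ : ∀ s b → T′ s ≡ true → S b ≡ true → Incident G s b → φ b ≡ j ⊎ φ b ≡ φ a →
      (∀ w → Incident G w b → T′ w ≡ true) ⊎ (s ≡ z′ × φ b ≡ j)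
    inside′ s b T′s Sb sb e with inv T′s
    inside′ s b T′s Sb sb e | inj₁ Ts with inside s b Ts Sb sb (Sum.swap e)
    ... | inj₁ w = inj₁ λ s′ s′b → old (w s′ s′b)
    ... | inj₂ (refl , f) rewrite unique Sb Sa sb za f = inj₁ z∈
    inside′ s b T′s Sb sb (inj₁ f) | inj₂ refl = inj₂ (refl , f)
    inside′ s b T′s Sb sb (inj₂ f) | inj₂ refl rewrite unique Sb Sa sb z′a f = inj₁ z∈
    -- The walk cannot run back into itself: by `inside` an edge from `T` to `z′` would either lie
    -- within `T`, which does not contain `z′`, or be the exit edge, whose colour is not `j`.
    fresh′ : ∀ b w → S b ≡ true → Incident G z′ b → φ b ≡ j → Incident G w b → w ≢ z′ → T′ w ≡ false
    fresh′ b w Sb z′b f wb w≢z′ with T′ w in T′w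
    ... | false = refl
    ... | true with inv T′w
    ...   | inj₂ w≡z′ = ⊥-elim (w≢z′ w≡z′)
    ...   | inj₁ Tw with inside w b Tw Sb wb (inj₂ f)
    ...     | inj₁ all∈T = trans (sym (all∈T z′ z′b)) z′∉T
    ...     | inj₂ (_ , g) = ⊥-elim (i≢j (trans (sym g) f))
    inner′ : ∀ s → T′ s ≡ true → s ≢ v → s ≢ z′ → Sees G S φ s j × Sees G S φ s (φ a)
    inner′ s T′s s≢v s≢z′ with inv T′s
    ... | inj₂ e = ⊥-elim (s≢z′ e)
    ... | inj₁ Ts with s ≟ z
    ...   | yes refl = zj s≢v , (a , Sa , za , refl)
    ...   | no s≢z = let p , q = inner s Ts s≢v s≢z in q , p

  chain : ∀ i j → i ≢ j → ∀ v → ¬ Sees G S φ v j → Chain i j v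
  chain i j i≢j v ¬vj = walk _ i j i≢j v T v (⌊≟⌋-refl v) (⌊≟⌋-refl v)
      (λ { s a Ts Sa sa (inj₁ e) → inj₂ (only Ts , e)
         ; s a Ts Sa sa (inj₂ e) → ⊥-elim (¬vj (a , Sa , subst (λ t → Incident G t a) (only Ts) sa , e)) })
      (λ a w Sa va e wa w≢v → not-only w≢v)
      (λ s Ts s≢v _ → ⊥-elim (s≢v (only Ts)))
      (λ v≢v → ⊥-elim (v≢v refl)) ≤-refl
    where
    T : Fin n → Bool
    T s = ⌊ s ≟ v ⌋
    only : ∀ {s} → T s ≡ true → s ≡ v
    only {s} e with s ≟ v
    ... | yes p = p
    not-only : ∀ {s} → s ≢ v → T s ≡ false
    not-only {s} p with s ≟ v
    ... | yes q = ⊥-elim (p q)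
    ... | no _ = refl

  chainFrom : ∀ i j → i ≢ j → ∀ v → ¬ Sees G S φ v i ⊎ ¬ Sees G S φ v j → Chain i j v
  chainFrom i j i≢j v (inj₁ ¬vi) = chain-sym (chain j i (i≢j ∘ sym) v ¬vi)
  chainFrom i j i≢j v (inj₂ ¬vj) = chain i j i≢j v ¬vj

  module Swap (i j : Fin D) (T : Fin n → Bool) (closed : Closed i j T) where

    at : Fin n → Fin D → Fin D
    at v x = if T v then exchange i j x else x

    at-involutive : ∀ v x → at v (at v x) ≡ x
    at-involutive v x with T v
    ... | true = exchange-involutive i j x
    ... | false = refl

    -- The colour is read off at the first end; closedness of `T` gives the same result at the other
    -- one, which is `swapped-at`.
    swapped : Fin (m G) → Fin D
    swapped a = at (proj₁ (ends G a)) (φ a)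

    swapped-at : ∀ {v a} → S a ≡ true → Incident G v a → swapped a ≡ at v (φ a)
    swapped-at Sa (inj₁ refl) = refl
    swapped-at {v} {a} Sa (inj₂ refl) with φ a ≟ i | φ a ≟ j
    ... | yes e | _ rewrite closed a Sa (inj₁ e) = refl
    ... | no _ | yes e rewrite closed a Sa (inj₂ e) = refl
    ... | no p | no q with T (proj₁ (ends G a)) | T (proj₂ (ends G a))
    ...   | true | true = refl
    ...   | true | false = refl
    ...   | false | true = refl
    ...   | false | false = refl

    swapped-proper : ProperColouringOn G S D swapped
    swapped-proper a b a≢b Sa Sb v va vb e = proper a b a≢b Sa Sb v va vb
      (trans (sym (at-involutive v _))
        (trans (cong (at v) (trans (sym (swapped-at Sa va)) (trans e (swapped-at Sb vb)))) (at-involutive v _)))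

    sees⁺ : ∀ {v x} → Sees G S φ v (at v x) → Sees G S swapped v x
    sees⁺ {v} (a , Sa , va , e) = a , Sa , va , trans (swapped-at Sa va) (trans (cong (at v) e) (at-involutive v _))

    sees⁻ : ∀ {v x} → Sees G S swapped v x → Sees G S φ v (at v x)
    sees⁻ {v} (a , Sa , va , e) = a , Sa , va , trans (sym (at-involutive v _)) (cong (at v) (trans (sym (swapped-at Sa va)) e))

-- Reducible configurations

∧-true : ∀ {x y} → x ∧ y ≡ true → x ≡ true × y ≡ true
∧-true {true} {true} _ = refl , refl

∨-true : ∀ {x y} → x ∨ y ≡ true → x ≡ true ⊎ y ≡ true
∨-true {true} _ = inj₁ refl
∨-true {false} e = inj₂ e

not-true : ∀ {x} → not x ≡ true → x ≡ false
not-true {false} _ = refl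

someOf everyOf : ∀ {A : Set} → (A → Bool) → List A → Bool
someOf p [] = false
someOf p (x ∷ xs) = p x ∨ someOf p xs
everyOf p [] = true
everyOf p (x ∷ xs) = p x ∧ everyOf p xs

someOf-true : ∀ {A : Set} (p : A → Bool) xs → someOf p xs ≡ true → ∃ λ x → x ∈ xs × p x ≡ true
someOf-true p (x ∷ xs) e with ∨-true {p x} e
... | inj₁ px = x , here refl , px
... | inj₂ r with someOf-true p xs r
...   | y , y∈ , py = y , there y∈ , py

everyOf-true : ∀ {A : Set} (p : A → Bool) xs → everyOf p xs ≡ true → ∀ {x} → x ∈ xs → p x ≡ true
everyOf-true p (x ∷ xs) e (here refl) = proj₁ (∧-true e)
everyOf-true p (x ∷ xs) e (there i) = everyOf-true p xs (proj₂ (∧-true {p x} e)) i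

whenJust : ∀ {A : Set} → Maybe A → (A → Bool) → Bool
whenJust nothing p = false
whenJust (just x) p = p x

whenJust-true : ∀ {A : Set} {x : Maybe A} {p} → whenJust x p ≡ true → ∃ λ y → x ≡ just y × p y ≡ true
whenJust-true {x = just y} e = y , refl , e

-- A configuration is a list of vertices of G with some edges among them.  With these edges uncoloured,
-- the signature of a colour tells which of the vertices miss it, and a state lists the signatures of
-- some distinct colours.
Sig : ℕ → Set
Sig = Vec Bool

State : ℕ → Set
State L = List (Sig L)

picks : ∀ {A : Set} → List A → List (A × List A)
picks [] = []
picks (x ∷ xs) = (x , xs) ∷ map (λ (y , ys) → y , x ∷ ys) (picks xs)

picks-↭ : ∀ {A : Set} (xs : List A) {y ys} → (y , ys) ∈ picks xs → xs ↭ y ∷ ys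
picks-↭ (x ∷ xs) (here refl) = ↭-refl
picks-↭ (x ∷ xs) (there i) with ∈-map⁻ _ i
... | (z , zs) , j , refl = ↭-trans (prep x (picks-↭ xs j)) (swap x z ↭-refl)

picks-∈ : ∀ {A : Set} {xs : List A} {y} → y ∈ xs → ∃ λ ys → (y , ys) ∈ picks xs
picks-∈ (here refl) = _ , here refl
picks-∈ (there i) with picks-∈ i
... | ys , j = _ , there (∈-map⁺ _ j)

module _ {L : ℕ} where

  _≡ˢ_ : Sig L → Sig L → Bool
  s ≡ˢ t = does (Vec.≡-dec _≟ᵇ_ s t)

  ≡ˢ-true : ∀ {s t} → (s ≡ˢ t) ≡ true → s ≡ t
  ≡ˢ-true {s} {t} e with Vec.≡-dec _≟ᵇ_ s t
  ... | yes p = p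

  remove : Sig L → State L → Maybe (State L)
  remove s [] = nothing
  remove s (t ∷ st) with s ≡ˢ t
  ... | true = just st
  ... | false with remove s st
  ...   | just r = just (t ∷ r)
  ...   | nothing = nothing

  remove-↭ : ∀ s st {r} → remove s st ≡ just r → st ↭ s ∷ r
  remove-↭ s (t ∷ st) e with s ≡ˢ t in q
  remove-↭ s (t ∷ st) refl | true rewrite ≡ˢ-true {s} {t} q = ↭-refl
  ... | false with remove s st in q′
  remove-↭ s (t ∷ st) refl | false | just r = ↭-trans (prep t (remove-↭ s st q′)) (swap t s ↭-refl)

  removeAll : State L → State L → Maybe (State L)
  removeAll [] st = just st
  removeAll (s ∷ ss) st with remove s st
  ... | nothing = nothing
  ... | just r = removeAll ss r

  removeAll-↭ : ∀ ss st {r} → removeAll ss st ≡ just r → st ↭ ss ++ r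
  removeAll-↭ [] st refl = ↭-refl
  removeAll-↭ (s ∷ ss) st e with remove s st in q
  ... | just r′ = ↭-trans (remove-↭ s st q) (prep s (removeAll-↭ ss r′ e))

  _≤ˢ_ : ∀ {l} → Vec Bool l → Vec Bool l → Bool
  [] ≤ˢ [] = true
  (true ∷ s) ≤ˢ (false ∷ t) = true
  (false ∷ s) ≤ˢ (true ∷ t) = false
  (_ ∷ s) ≤ˢ (_ ∷ t) = s ≤ˢ t

  insert : Sig L → State L → State L
  insert s [] = s ∷ []
  insert s (t ∷ st) = if s ≤ˢ t then s ∷ t ∷ st else t ∷ insert s st

  insert-↭ : ∀ s st → s ∷ st ↭ insert s st
  insert-↭ s [] = ↭-refl
  insert-↭ s (t ∷ st) with s ≤ˢ t
  ... | true = ↭-refl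
  ... | false = ↭-trans (swap s t ↭-refl) (prep t (insert-↭ s st))

  -- A state stands for a multiset. Sorting selects the representative that the tables list, so that
  -- a known state is found by plain equality; soundness rests on `sort-↭`.
  sort : State L → State L
  sort [] = []
  sort (s ∷ st) = insert s (sort st)

  sort-↭ : ∀ st → st ↭ sort st
  sort-↭ [] = ↭-refl
  sort-↭ (s ∷ st) = ↭-trans (prep s (sort-↭ st)) (insert-↭ s (sort st))

  _≡ˡ_ : State L → State L → Bool
  s ≡ˡ t = does (List.≡-dec (Vec.≡-dec _≟ᵇ_) s t)

  ≡ˡ-true : ∀ {s t} → (s ≡ˡ t) ≡ true → s ≡ t
  ≡ˡ-true {s} {t} e with List.≡-dec (Vec.≡-dec _≟ᵇ_) s t
  ... | yes p = p

  -- The signature of a colour after an exchange along a chain from `v` to `e`, where `t` belongs to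
  -- its partner. Inner vertices of the chain see both colours, so only the two ends change. A chain
  -- that ends outside the configuration is covered by `e` equal to `v`.
  trade : Fin L → Fin L → Sig L → Sig L → Sig L
  trade v e s t = tabulate λ r → if does (r ≟ v) ∨ does (r ≟ e) then lookup t r else lookup s r

  assign : Bool → Fin L → Fin L → Sig L → Sig L
  assign b p q s = tabulate λ r → if does (r ≟ p) ∨ does (r ≟ q) then b else lookup s r

  colourable : List (Fin L × Fin L) → State L → Bool
  colourable [] st = true
  colourable ((p , q) ∷ es) st =
    someOf (λ (s , rest) → lookup s p ∧ lookup s q ∧ colourable es (assign false p q s ∷ rest)) (picks st)

  -- A chain of two colours with signatures s and t is followed from v to its other end, which is unknown;
  -- a double move follows two chains with disjoint colour pairs and may then exchange along either or both.
  data Move : Set where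
    single : (s t : Sig L) (v : Fin L) → Move
    double : (s t : Sig L) (v : Fin L) (s′ t′ : Sig L) (v′ : Fin L) → Move

  module Check (es : List (Fin L × Fin L)) where

    good : List (State L) → State L → Bool
    good known st = colourable es st ∨ (let st′ = sort st in someOf (st′ ≡ˡ_) known)

    everyVertex : (Fin L → Bool) → Bool
    everyVertex p = everyOf p (allFin L)

    move : List (State L) → State L → Move → Bool
    move known st (single s t v) = whenJust (removeAll (s ∷ t ∷ []) st) λ r →
      (lookup s v xor lookup t v) ∧ everyVertex (λ e → good known (trade v e s t ∷ trade v e t s ∷ r))
    move known st (double s t v s′ t′ v′) = whenJust (removeAll (s ∷ t ∷ s′ ∷ t′ ∷ []) st) λ r →
      (lookup s v xor lookup t v) ∧ (lookup s′ v′ xor lookup t′ v′) ∧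
      -- The choice among the three exchanges may depend on both unknown ends.
      everyVertex (λ e → everyVertex (λ e′ →
        good known (trade v e s t ∷ trade v e t s ∷ s′ ∷ t′ ∷ r) ∨
        good known (s ∷ t ∷ trade v′ e′ s′ t′ ∷ trade v′ e′ t′ s′ ∷ r) ∨
        good known (trade v e s t ∷ trade v e t s ∷ trade v′ e′ s′ t′ ∷ trade v′ e′ t′ s′ ∷ r)))

    -- An entry may appeal only to entries before it, which excludes circular reductions.
    verify : List (State L) → List (State L × Move) → Bool
    verify known [] = true
    verify known ((st , mv) ∷ tab) = move known st mv ∧ verify (st ∷ known) tab

    learnt : List (State L) → List (State L × Move) → List (State L)
    learnt known [] = known
    learnt known ((st , mv) ∷ tab) = learnt (st ∷ known) tab

  -- An edge of the configuration that is still coloured.  Its colour is new and has one of the signatures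
  -- fresh, or it is among the known colours and has one of the signatures fresh or old; signatures here are
  -- those with only ab uncoloured.
  record Label : Set where
    constructor label
    field
      from to : Fin L
      fresh old : List (Sig L)

  elem : Sig L → List (Sig L) → Bool
  elem s = someOf (s ≡ˢ_)

  -- An entry pairs the signature with only ab uncoloured and the current one.
  uncolour : Label → List (Sig L × Sig L) → List (List (Sig L × Sig L))
  uncolour (label p q fresh old) st =
    map (λ o → (o , assign true p q o) ∷ st) fresh ++
    concatMap (λ ((s₀ , s) , rest) →
      -- The edge to be uncoloured shows its colour to both of its ends, so a tracked colour that
      -- `p` or `q` currently misses cannot be its colour.
      if elem s₀ (fresh ++ old) ∧ not (lookup s p) ∧ not (lookup s q)
      then ((s₀ , assign true p q s) ∷ rest) ∷ [] else [])
      (picks st)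

-- Signatures in actual colourings and soundness of the check

vec-ext : ∀ {A : Set} {l} {s t : Vec A l} → (∀ r → lookup s r ≡ lookup t r) → s ≡ t
vec-ext {s = s} {t} e = trans (sym (Vec.tabulate∘lookup s)) (trans (Vec.tabulate-cong e) (Vec.tabulate∘lookup t))

unique-resp-↭ : ∀ {A : Set} {xs ys : List A} → xs ↭ ys → Unique xs → Unique ys
unique-resp-↭ p = Permₛ.Unique-resp-↭ (setoid _) (↭⇒↭ₛ p)

module Signatures {n} (G : Multigraph n) {D : ℕ} where

  Edges : Set
  Edges = Fin (m G) → Bool

  Colouring : Set
  Colouring = Fin (m G) → Fin D

  misses : Edges → Colouring → Fin n → Fin D → Bool
  misses S φ w i = not ⌊ sees? G S φ w i ⌋

  misses-cong : ∀ {S φ S′ φ′ w i j} → (Sees G S φ w i → Sees G S′ φ′ w j) → (Sees G S′ φ′ w j → Sees G S φ w i) →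
                misses S φ w i ≡ misses S′ φ′ w j
  misses-cong {S} {φ} {S′} {φ′} {w} {i} {j} f g with sees? G S φ w i | sees? G S′ φ′ w j
  ... | yes _ | yes _ = refl
  ... | no _  | no _  = refl
  ... | yes p | no q  = ⊥-elim (q (f p))
  ... | no p  | yes q = ⊥-elim (p (g q))

  misses-true : ∀ {S φ w i} → misses S φ w i ≡ true → ¬ Sees G S φ w i
  misses-true {S} {φ} {w} {i} e with sees? G S φ w i
  ... | no p = p

  misses-yes : ∀ {S φ w i} → ¬ Sees G S φ w i → misses S φ w i ≡ true
  misses-yes {S} {φ} {w} {i} p with sees? G S φ w i
  ... | no _ = refl
  ... | yes q = ⊥-elim (p q)

  misses-no : ∀ {S φ w i} → Sees G S φ w i → misses S φ w i ≡ false
  misses-no {S} {φ} {w} {i} p with sees? G S φ w i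
  ... | yes _ = refl
  ... | no q = ⊥-elim (q p)

  module At {L} (loc : Vec (Fin n) L) where

    sig : Edges → Colouring → Fin D → Sig L
    sig S φ i = Vec.map (λ w → misses S φ w i) loc

    lookup-sig : ∀ S φ i r → lookup (sig S φ i) r ≡ misses S φ (lookup loc r) i
    lookup-sig S φ i r = Vec.lookup-map r _ loc

    Ends : Fin (m G) → Fin L × Fin L → Set
    Ends a (p , q) = SameEnds (ends G a) (lookup loc p , lookup loc q)

    Labelled : Edges → Colouring → List (Fin D) → Label {L} → Set
    Labelled S₀ φ cols₀ (label p q fresh old) = ∃ λ a → Ends a (p , q) ×
      (sig S₀ φ (φ a) ∈ fresh ⊎ (φ a ∈ cols₀ × sig S₀ φ (φ a) ∈ old))

xor-true : ∀ {x y} → x xor y ≡ true → x ≡ true ⊎ y ≡ true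
xor-true {true} _ = inj₁ refl
xor-true {false} e = inj₂ e

someOf-intro : ∀ {A : Set} (p : A → Bool) {xs x} → x ∈ xs → p x ≡ true → someOf p xs ≡ true
someOf-intro p (here refl) e rewrite e = refl
someOf-intro p {y ∷ xs} (there i) e with p y
... | true = refl
... | false = someOf-intro p i e

picks-map : ∀ {A B : Set} (f : A → B) xs {y ys} → (y , ys) ∈ picks xs → (f y , map f ys) ∈ picks (map f xs)
picks-map f (x ∷ xs) (here refl) = here refl
picks-map f (x ∷ xs) (there i) with map-pick xs i
  where
  map-pick : ∀ xs {y ys} → (y , ys) ∈ map (λ (y , ys) → y , x ∷ ys) (picks xs) →
             ∃ λ zs → ys ≡ x ∷ zs × (y , zs) ∈ picks xs
  map-pick xs i with ∈-map⁻ _ i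
  ... | (z , zs) , j , refl = zs , refl , j
... | zs , refl , j = there (∈-map⁺ _ (picks-map f xs j))

module _ {L : ℕ} where

  run : List (Label {L}) → List (Sig L × Sig L) → List (List (Sig L × Sig L))
  run [] st = st ∷ []
  run (l ∷ ls) st = concatMap (run ls) (uncolour l st)

  removed : List (Label {L}) → List (Fin L × Fin L) → List (Fin L × Fin L)
  removed [] es = es
  removed (l ∷ ls) es = removed ls ((Label.from l , Label.to l) ∷ es)

  newEdge : Fin L × Fin L → List (Fin L × Fin L) → Bool
  newEdge (p , q) = everyOf λ (r , s) →
    not ((does (p ≟ r) ∧ does (q ≟ s)) ∨ (does (p ≟ s) ∧ does (q ≟ r)))

  newEdges : List (Label {L}) → List (Fin L × Fin L) → Bool
  newEdges [] es = true
  newEdges (l ∷ ls) es = newEdge (Label.from l , Label.to l) es ∧ newEdges ls ((Label.from l , Label.to l) ∷ es)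

  -- A finite test that the type checker evaluates. Which labelled edges share a colour with each
  -- other or with the start is unknown, so `run` lists every state that may arise and each of them
  -- has to be good.
  certified : Fin L × Fin L → List (Label {L}) → State L → List (State L × Move) → Bool
  certified e ls start tab =
    newEdges ls (e ∷ []) ∧ Check.verify es [] tab ∧
    everyOf (λ st → Check.good es (Check.learnt es [] tab) (map proj₂ st)) (run ls (map (λ s → s , s) start))
    where es = removed ls (e ∷ [])

module Sound {n} (G : Multigraph n) (D : ℕ) (uncolourable : ¬ ColourableOn G (allEdges G) D)
             {L} (loc : Vec (Fin n) L) (distinct : ∀ r r′ → lookup loc r ≡ lookup loc r′ → r ≡ r′) where
  open Signatures G {D}
  open At loc

  ends-incident : ∀ {a p q} → Ends a (p , q) → Incident G (lookup loc p) a × Incident G (lookup loc q) a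
  ends-incident (inj₁ (e , f)) = inj₁ e , inj₂ f
  ends-incident (inj₂ (e , f)) = inj₂ f , inj₁ e

  ends-cases : ∀ {a p q w} → Ends a (p , q) → Incident G w a → w ≡ lookup loc p ⊎ w ≡ lookup loc q
  ends-cases (inj₁ (e , f)) (inj₁ g) = inj₁ (trans (sym g) e)
  ends-cases (inj₁ (e , f)) (inj₂ g) = inj₂ (trans (sym g) f)
  ends-cases (inj₂ (e , f)) (inj₁ g) = inj₂ (trans (sym g) e)
  ends-cases (inj₂ (e , f)) (inj₂ g) = inj₁ (trans (sym g) f)

  ends-only : ∀ {a p q r} → Ends a (p , q) → Incident G (lookup loc r) a → r ≡ p ⊎ r ≡ q
  ends-only pq ra = Sum.map (distinct _ _) (distinct _ _) (ends-cases pq ra)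

  -- The head of the list is the edge uncoloured last: uncolouring adds at the head and `colourable`
  -- restores from it.
  data Uncoloured : List (Fin L × Fin L) → Edges → Set where
    none : ∀ {S} → (∀ a → S a ≡ true) → Uncoloured [] S
    cut  : ∀ {S S′ e es} a → S a ≡ false → S′ a ≡ true → (∀ b → b ≢ a → S b ≡ S′ b) →
           Ends a e → Uncoloured es S′ → Uncoloured (e ∷ es) S

  Realizes : Edges → Colouring → State L → Set
  Realizes S φ st = ∃ λ cols → Unique cols × map (sig S φ) cols ≡ st

  Refuted : List (Fin L × Fin L) → State L → Set
  Refuted es st = ∀ S φ → Uncoloured es S → ProperColouringOn G S D φ → ¬ Realizes S φ st

  realizes-↭ : ∀ {S φ st st′} → st ↭ st′ → Realizes S φ st → Realizes S φ st′
  realizes-↭ p (cols , u , refl) with ↭-map-inv _ p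
  ... | cols′ , refl , q = cols′ , unique-resp-↭ q u , refl

  refuted-↭ : ∀ {es st st′} → st ↭ st′ → Refuted es st′ → Refuted es st
  refuted-↭ p r S φ u pr re = r S φ u pr (realizes-↭ p re)

  map-sig-cong : ∀ {S φ S′ φ′ ks} → All (λ k → sig S φ k ≡ sig S′ φ′ k) ks → map (sig S φ) ks ≡ map (sig S′ φ′) ks
  map-sig-cong [] = refl
  map-sig-cong (e ∷ es) = cong₂ _∷_ e (map-sig-cong es)

  lookup-assign : ∀ b (p q : Fin L) s r → (r ≡ p ⊎ r ≡ q → lookup (assign b p q s) r ≡ b) ×
                                (r ≢ p → r ≢ q → lookup (assign b p q s) r ≡ lookup s r)
  lookup-assign b p q s r rewrite Vec.lookup∘tabulate (λ r → if does (r ≟ p) ∨ does (r ≟ q) then b else lookup s r) r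
    with r ≟ p | r ≟ q
  ... | yes e | _ = (λ _ → refl) , λ f _ → ⊥-elim (f e)
  ... | no _ | yes e = (λ _ → refl) , λ _ f → ⊥-elim (f e)
  ... | no e | no f = [ ⊥-elim ∘ e , ⊥-elim ∘ f ]′ , λ _ _ → refl

  module Uncolour {S S′ : Edges} {φ : Colouring} (proper : ProperColouringOn G S′ D φ)
                  {a p q} (Sa : S a ≡ false) (S′a : S′ a ≡ true) (same : ∀ b → b ≢ a → S b ≡ S′ b) (pq : Ends a (p , q)) where

    S⇒≢a : ∀ {b} → S b ≡ true → b ≢ a
    S⇒≢a Sb refl with trans (sym Sb) Sa
    ... | ()

    S⇒S′ : ∀ {b} → S b ≡ true → S′ b ≡ true
    S⇒S′ Sb = trans (sym (same _ (S⇒≢a Sb))) Sb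

    proper-S : ProperColouringOn G S D φ
    proper-S b c b≢c Sb Sc = proper b c b≢c (S⇒S′ Sb) (S⇒S′ Sc)

    weaken : ∀ {w i} → Sees G S φ w i → Sees G S′ φ w i
    weaken (b , Sb , wb , e) = b , S⇒S′ Sb , wb , e

    -- By properness the edge was the only one of its colour at either end, so both ends begin to
    -- miss that colour.
    sig-at : sig S φ (φ a) ≡ assign true p q (sig S′ φ (φ a))
    sig-at = vec-ext go
      where
      go : ∀ r → lookup (sig S φ (φ a)) r ≡ lookup (assign true p q (sig S′ φ (φ a))) r
      go r with r ≟ p | r ≟ q | lookup-assign true p q (sig S′ φ (φ a)) r
      ... | yes refl | _ | e , _ = trans (lookup-sig S φ (φ a) r) (trans (misses-yes λ (b , Sb , wb , c) →
        proper b a (S⇒≢a Sb) (S⇒S′ Sb) S′a _ wb (proj₁ (ends-incident pq)) c) (sym (e (inj₁ refl))))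
      ... | no _ | yes refl | e , _ = trans (lookup-sig S φ (φ a) r) (trans (misses-yes λ (b , Sb , wb , c) →
        proper b a (S⇒≢a Sb) (S⇒S′ Sb) S′a _ wb (proj₂ (ends-incident pq)) c) (sym (e (inj₂ refl))))
      ... | no f | no g | _ , e = trans (lookup-sig S φ (φ a) r) (trans (misses-cong weaken
        λ (b , S′b , wb , c) → b , trans (same b λ { refl → [ f , g ]′ (ends-only pq wb) }) S′b , wb , c)
        (trans (sym (lookup-sig S′ φ (φ a) r)) (sym (e f g))))

    sig-other : ∀ {i} → i ≢ φ a → sig S φ i ≡ sig S′ φ i
    sig-other {i} i≢ = vec-ext λ r → trans (lookup-sig S φ i r) (trans (misses-cong weaken
      λ (b , S′b , wb , c) → b , trans (same b λ { refl → i≢ (sym c) }) S′b , wb , c) (sym (lookup-sig S′ φ i r)))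

  -- Inverts `sig-at`: the signature is known while the edge is uncoloured and wanted after it has
  -- received the colour, which both ends then see.
  assign-false-true : ∀ {p q} {s : Sig L} → lookup s p ≡ true → lookup s q ≡ true →
                      ∀ t → s ≡ assign true p q t → (∀ r → r ≡ p ⊎ r ≡ q → lookup t r ≡ false) → t ≡ assign false p q s
  assign-false-true {p} {q} {s} sp sq t refl tpq = vec-ext go
    where
    go : ∀ r → lookup t r ≡ lookup (assign false p q s) r
    go r with r ≟ p | r ≟ q | lookup-assign false p q s r | lookup-assign true p q t r
    ... | yes e | _ | f , _ | _ = trans (tpq r (inj₁ e)) (sym (f (inj₁ e)))
    ... | no _ | yes e | f , _ | _ = trans (tpq r (inj₂ e)) (sym (f (inj₂ e)))
    ... | no e | no f | _ , g | _ , h = sym (trans (g e f) (h e f))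

  colourable-refuted : ∀ es st → colourable es st ≡ true → Refuted es st
  colourable-refuted [] st _ S φ (none all) proper _ =
    uncolourable (φ , λ a b a≢b _ _ → proper a b a≢b (all a) (all b))
  colourable-refuted ((p , q) ∷ es) st ok S φ (cut {S′ = S′} a Sa S′a same pq un) proper re
    with someOf-true _ (picks st) ok
  ... | (s , rest) , i∈ , ok′ with realizes-↭ (picks-↭ st i∈) re | ∧-true {lookup s p} ok′
  ...   | i ∷ cols , i∉ ∷ u , refl | sp , ok″ with ∧-true {lookup s q} ok″
  ...     | sq , ok‴ = colourable-refuted es _ ok‴ S′ φ′ un proper′ (i ∷ cols , i∉ ∷ u , cong₂ _∷_ eqᵢ eqs)
    where
    φ′ : Colouring
    φ′ b = if ⌊ b ≟ a ⌋ then i else φ b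
    φ′a : φ′ a ≡ i
    φ′a rewrite ⌊≟⌋-refl a = refl
    φ′b : ∀ {b} → b ≢ a → φ′ b ≡ φ b
    φ′b {b} b≢a with b ≟ a
    ... | yes e = ⊥-elim (b≢a e)
    ... | no _ = refl
    missing : ∀ {w} → Incident G w a → ¬ Sees G S φ w i
    missing wa with ends-cases pq wa
    ... | inj₁ refl = misses-true (trans (sym (lookup-sig S φ i p)) sp)
    ... | inj₂ refl = misses-true (trans (sym (lookup-sig S φ i q)) sq)
    S′⇒S : ∀ {b} → b ≢ a → S′ b ≡ true → S b ≡ true
    S′⇒S b≢a S′b = trans (same _ b≢a) S′b
    proper′ : ProperColouringOn G S′ D φ′
    proper′ b c b≢c S′b S′c v vb vc e with b ≟ a | c ≟ a
    ... | yes refl | yes refl = b≢c refl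
    ... | yes refl | no c≢a = missing vb (c , S′⇒S c≢a S′c , vc , sym e)
    ... | no b≢a | yes refl = missing vc (b , S′⇒S b≢a S′b , vb , e)
    ... | no b≢a | no c≢a = proper b c b≢c (S′⇒S b≢a S′b) (S′⇒S c≢a S′c) v vb vc e
    module U = Uncolour {S} {S′} {φ′} proper′ Sa S′a same pq
    sees≡ : ∀ w k → misses S φ′ w k ≡ misses S φ w k
    sees≡ w k = misses-cong (λ (b , Sb , wb , e) → b , Sb , wb , trans (sym (φ′b (U.S⇒≢a Sb))) e)
                            (λ (b , Sb , wb , e) → b , Sb , wb , trans (φ′b (U.S⇒≢a Sb)) e)
    sig≡ : ∀ k → sig S φ′ k ≡ sig S φ k
    sig≡ k = Vec.map-cong (λ w → sees≡ w k) loc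
    eqᵢ : sig S′ φ′ i ≡ assign false p q (sig S φ i)
    eqᵢ = assign-false-true sp sq _ (trans (sym (sig≡ i)) (subst (λ k → sig S φ′ k ≡ assign true p q (sig S′ φ′ k)) φ′a U.sig-at))
      λ r r∈ → trans (lookup-sig S′ φ′ i r) (misses-no (a , S′a , [ (λ { refl → proj₁ (ends-incident pq) }) , (λ { refl → proj₂ (ends-incident pq) }) ]′ r∈ , φ′a))
    eqs : map (sig S′ φ′) cols ≡ map (sig S φ) cols
    eqs = map-sig-cong (All.map (λ {k} i≢k → trans (sym (U.sig-other λ e → i≢k (sym (trans e φ′a)))) (sig≡ k)) i∉)

  module _ {S : Edges} {φ : Colouring} (proper : ProperColouringOn G S D φ) where
    open Kempe G S φ proper

    -- What a trade uses of a chain, reduced to the vertices of the configuration. The index `e` is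
    -- the other end, or `v` again if the chain ends elsewhere.
    record Tradable (i j : Fin D) (v e : Fin L) : Set where
      field
        verts  : Fin n → Bool
        closed : Closed i j verts
        inside : ∀ r → r ≡ v ⊎ r ≡ e → verts (lookup loc r) ≡ true
        other  : ∀ r → verts (lookup loc r) ≡ true → r ≢ v → r ≢ e → lookup (sig S φ i) r ≡ lookup (sig S φ j) r

    chain-tradable : ∀ {i j} → i ≢ j → ∀ v → lookup (sig S φ i) v ≡ true ⊎ lookup (sig S φ j) v ≡ true →
                     ∃ (Tradable i j v)
    chain-tradable {i} {j} i≢j v m = case-end (any? λ r → lookup loc r ≟ end)
      where
      c : Chain i j (lookup loc v)
      c = chainFrom i j i≢j (lookup loc v) (Sum.map (λ e → misses-true (trans (sym (lookup-sig S φ i v)) e))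
                                                    (λ e → misses-true (trans (sym (lookup-sig S φ j v)) e)) m)
      open Chain c
      both : ∀ r → verts (lookup loc r) ≡ true → lookup loc r ≢ lookup loc v → lookup loc r ≢ end →
             lookup (sig S φ i) r ≡ lookup (sig S φ j) r
      both r t p q = let x , y = inner _ t p q in
        trans (lookup-sig S φ i r) (trans (misses-no x) (sym (trans (lookup-sig S φ j r) (misses-no y))))
      case-end : Dec (∃ λ r → lookup loc r ≡ end) → ∃ (Tradable i j v)
      case-end (yes (e , p)) = e , record
        { verts = verts ; closed = closed
        ; inside = λ { r (inj₁ refl) → start ; r (inj₂ refl) → trans (cong verts p) stop }
        ; other = λ r t r≢v r≢e → both r t (r≢v ∘ distinct _ _) (λ q → r≢e (distinct _ _ (trans q (sym p)))) }
      case-end (no p) = v , record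
        { verts = verts ; closed = closed
        ; inside = λ { r (inj₁ refl) → start ; r (inj₂ refl) → start }
        ; other = λ r t r≢v _ → both r t (r≢v ∘ distinct _ _) (λ q → p (r , q)) }

  lookup-trade : ∀ v e (s t : Sig L) r → (r ≡ v ⊎ r ≡ e → lookup (trade v e s t) r ≡ lookup t r) ×
                                         (r ≢ v → r ≢ e → lookup (trade v e s t) r ≡ lookup s r)
  lookup-trade v e s t r
    rewrite Vec.lookup∘tabulate (λ r → if does (r ≟ v) ∨ does (r ≟ e) then lookup t r else lookup s r) r
    with r ≟ v | r ≟ e
  ... | yes p | _ = (λ _ → refl) , λ f _ → ⊥-elim (f p)
  ... | no _ | yes p = (λ _ → refl) , λ _ f → ⊥-elim (f p)
  ... | no p | no q = [ ⊥-elim ∘ p , ⊥-elim ∘ q ]′ , λ _ _ → refl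

  module Trade {S : Edges} {φ : Colouring} (proper : ProperColouringOn G S D φ) {i j : Fin D} {v e}
               (tr : Tradable proper i j v e) where
    open Tradable tr
    open Kempe G S φ proper
    open Swap i j verts closed public

    private
      at-sig : ∀ k r → lookup (sig S swapped k) r ≡ lookup (sig S φ (at (lookup loc r) k)) r
      at-sig k r = trans (lookup-sig S swapped k r) (trans (misses-cong sees⁻ sees⁺) (sym (lookup-sig S φ _ r)))

      pick : ∀ k l → (∀ w → verts w ≡ true → at w k ≡ l) → (∀ w → verts w ≡ false → at w k ≡ k) →
             (∀ r → verts (lookup loc r) ≡ true → r ≢ v → r ≢ e → lookup (sig S φ k) r ≡ lookup (sig S φ l) r) →
             ∀ r → lookup (sig S swapped k) r ≡ lookup (trade v e (sig S φ k) (sig S φ l)) r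
      pick k l at-t at-f oth r with verts (lookup loc r) in t | r ≟ v | r ≟ e | lookup-trade v e (sig S φ k) (sig S φ l) r
      ... | true | yes p | _ | x , _ = trans (at-sig k r) (trans (cong (λ z → lookup (sig S φ z) r) (at-t _ t)) (sym (x (inj₁ p))))
      ... | true | no _ | yes p | x , _ = trans (at-sig k r) (trans (cong (λ z → lookup (sig S φ z) r) (at-t _ t)) (sym (x (inj₂ p))))
      ... | true | no p | no q | _ , y = trans (at-sig k r) (trans (cong (λ z → lookup (sig S φ z) r) (at-t _ t))
                                                 (trans (sym (oth r t p q)) (sym (y p q))))
      ... | false | no p | no q | _ , y = trans (at-sig k r) (trans (cong (λ z → lookup (sig S φ z) r) (at-f _ t)) (sym (y p q)))
      ... | false | yes p | _ | _ with trans (sym t) (inside r (inj₁ p))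
      ...   | ()
      pick k l at-t at-f oth r | false | no _ | yes p | _ with trans (sym t) (inside r (inj₂ p))
      ...   | ()

      at-on : ∀ {w} k → verts w ≡ true → at w k ≡ exchange i j k
      at-on k t rewrite t = refl

      at-off : ∀ {w} k → verts w ≡ false → at w k ≡ k
      at-off k t rewrite t = refl

    sig-i : sig S swapped i ≡ trade v e (sig S φ i) (sig S φ j)
    sig-i = vec-ext (pick i j (λ w t → trans (at-on i t) (exchange-ˡ i j)) (λ w → at-off i) other)

    sig-j : sig S swapped j ≡ trade v e (sig S φ j) (sig S φ i)
    sig-j = vec-ext (pick j i (λ w t → trans (at-on j t) (exchange-ʳ i j)) (λ w → at-off j)
              (λ r t p q → sym (other r t p q)))

    at-other : ∀ {w k} → k ≢ i → k ≢ j → at w k ≡ k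
    at-other {w} {k} p q with verts w
    ... | true = exchange-other i j p q
    ... | false = refl

    sig-other : ∀ {k} → k ≢ i → k ≢ j → sig S swapped k ≡ sig S φ k
    sig-other {k} p q = vec-ext λ r → trans (at-sig k r) (cong (λ z → lookup (sig S φ z) r) (at-other p q))

    others : ∀ {ks} → All (i ≢_) ks → All (j ≢_) ks → map (sig S swapped) ks ≡ map (sig S φ) ks
    others i∉ j∉ = map-sig-cong (All.map (λ (p , q) → sig-other (p ∘ sym) (q ∘ sym)) (All.zip (i∉ , j∉)))

    -- Exchanging `i` and `j` moves no edge of colour `k` or `l`, so a chain of this disjoint pair
    -- survives. This allows a double move to perform both exchanges.
    keep : ∀ {k l v′ e′} → k ≢ i → k ≢ j → l ≢ i → l ≢ j →
           Tradable proper k l v′ e′ → Tradable swapped-proper k l v′ e′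
    keep {k} {l} ki kj li lj tr′ = record
      { verts = T.verts
      ; closed = λ { a Sa (inj₁ f) → T.closed a Sa (inj₁ (back ki kj f)) ; a Sa (inj₂ f) → T.closed a Sa (inj₂ (back li lj f)) }
      ; inside = T.inside
      ; other = λ r t p q → trans (cong (λ s → lookup s r) (sig-other ki kj))
                  (trans (T.other r t p q) (cong (λ s → lookup s r) (sym (sig-other li lj)))) }
      where
      module T = Tradable tr′
      back : ∀ {a k} → k ≢ i → k ≢ j → swapped a ≡ k → φ a ≡ k
      back p q f = trans (sym (at-involutive _ _)) (trans (cong (at _) f) (at-other p q))

  module _ (es : List (Fin L × Fin L)) where
    open Check {L} es

    good-refuted : ∀ known st → All (Refuted es) known → good known st ≡ true → Refuted es st
    good-refuted known st all ok with ∨-true {colourable es st} ok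
    ... | inj₁ c = colourable-refuted es st c
    ... | inj₂ k with someOf-true _ known k
    ...   | st′ , st′∈ , e = refuted-↭ (subst (st ↭_) (≡ˡ-true {s = sort st} e) (sort-↭ st)) (All.lookup all st′∈)

    every : ∀ p → everyVertex p ≡ true → ∀ v → p v ≡ true
    every p e v = everyOf-true p (allFin L) e (∈-allFin v)

    single-refuted : ∀ known s t v r → All (Refuted es) known → (lookup s v xor lookup t v) ≡ true →
      (∀ e → good known (trade v e s t ∷ trade v e t s ∷ r) ≡ true) → Refuted es (s ∷ t ∷ r)
    single-refuted known s t v r all differ ok S φ un proper (i ∷ j ∷ ks , (i≢j ∷ i∉) ∷ j∉ ∷ u , refl) =
      traded (chain-tradable proper i≢j v (xor-true differ))
      where
      traded : ∃ (Tradable proper i j v) → ⊥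
      traded (e , tr) = good-refuted known _ all (ok e) S swapped un swapped-proper
        (i ∷ j ∷ ks , (i≢j ∷ i∉) ∷ j∉ ∷ u , cong₂ _∷_ sig-i (cong₂ _∷_ sig-j (others i∉ j∉)))
        where open Trade proper tr

    double-refuted : ∀ known s t v s′ t′ v′ r → All (Refuted es) known →
      (lookup s v xor lookup t v) ≡ true → (lookup s′ v′ xor lookup t′ v′) ≡ true →
      (∀ e e′ → good known (trade v e s t ∷ trade v e t s ∷ s′ ∷ t′ ∷ r) ≡ true ⊎
                good known (s ∷ t ∷ trade v′ e′ s′ t′ ∷ trade v′ e′ t′ s′ ∷ r) ≡ true ⊎
                good known (trade v e s t ∷ trade v e t s ∷ trade v′ e′ s′ t′ ∷ trade v′ e′ t′ s′ ∷ r) ≡ true) →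
      Refuted es (s ∷ t ∷ s′ ∷ t′ ∷ r)
    double-refuted known s t v s′ t′ v′ r all differ differ′ ok S φ un proper
      (i ∷ j ∷ k ∷ l ∷ ks , u@((ij ∷ ik ∷ il ∷ i∉) ∷ (jk ∷ jl ∷ j∉) ∷ (kl ∷ k∉) ∷ l∉ ∷ _) , refl) =
      traded (chain-tradable proper ij v (xor-true differ)) (chain-tradable proper kl v′ (xor-true differ′))
      where
      traded : ∃ (Tradable proper i j v) → ∃ (Tradable proper k l v′) → ⊥
      traded (e , tr) (e′ , tr′) = outcome (ok e e′)
        where
        module T = Trade proper tr
        module T′ = Trade proper tr′
        module T″ = Trade T.swapped-proper (T.keep (ik ∘ sym) (jk ∘ sym) (il ∘ sym) (jl ∘ sym) tr′)
        T-k : sig S T.swapped k ≡ sig S φ k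
        T-k = T.sig-other (ik ∘ sym) (jk ∘ sym)
        T-l : sig S T.swapped l ≡ sig S φ l
        T-l = T.sig-other (il ∘ sym) (jl ∘ sym)
        outcome : _ → ⊥
        outcome (inj₁ g) = good-refuted known _ all g S T.swapped un T.swapped-proper
          (_ , u , cong₂ _∷_ T.sig-i (cong₂ _∷_ T.sig-j (T.others (ik ∷ il ∷ i∉) (jk ∷ jl ∷ j∉))))
        outcome (inj₂ (inj₁ g)) = good-refuted known _ all g S T′.swapped un T′.swapped-proper
          (_ , u , cong₂ _∷_ (T′.sig-other ik il) (cong₂ _∷_ (T′.sig-other jk jl)
            (cong₂ _∷_ T′.sig-i (cong₂ _∷_ T′.sig-j (T′.others k∉ l∉)))))
        outcome (inj₂ (inj₂ g)) = good-refuted known _ all g S T″.swapped un T″.swapped-proper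
          (_ , u , cong₂ _∷_ (trans (T″.sig-other ik il) T.sig-i) (cong₂ _∷_ (trans (T″.sig-other jk jl) T.sig-j)
            (cong₂ _∷_ (trans T″.sig-i (cong₂ (trade v′ e′) T-k T-l))
            (cong₂ _∷_ (trans T″.sig-j (cong₂ (trade v′ e′) T-l T-k))
              (trans (T″.others k∉ l∉) (T.others i∉ j∉))))))

    move-refuted : ∀ known st mv → All (Refuted es) known → move known st mv ≡ true → Refuted es st
    move-refuted known st (single s t v) all ok =
      let r , e , ok′ = whenJust-true ok
          x , y = ∧-true ok′
      in refuted-↭ (removeAll-↭ (s ∷ t ∷ []) st e) (single-refuted known s t v r all x (every _ y))
    move-refuted known st (double s t v s′ t′ v′) all ok =
      let r , e , ok′ = whenJust-true ok
          x , y = ∧-true ok′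
          x′ , z = ∧-true {lookup s′ v′ xor lookup t′ v′} y
      in refuted-↭ (removeAll-↭ (s ∷ t ∷ s′ ∷ t′ ∷ []) st e) (double-refuted known s t v s′ t′ v′ r all x x′
           λ e e′ → Sum.map₂ ∨-true (∨-true (every _ (every _ z e) e′)))

    learnt-refuted : ∀ known tab → All (Refuted es) known → verify known tab ≡ true → All (Refuted es) (learnt known tab)
    learnt-refuted known [] all ok = all
    learnt-refuted known ((st , mv) ∷ tab) all ok with ∧-true {move known st mv} ok
    ... | x , y = learnt-refuted (st ∷ known) tab (move-refuted known st mv all x ∷ all) y

  uncoloured-ends : ∀ {es S a} → Uncoloured es S → S a ≡ false → ∃ λ e → e ∈ es × Ends a e
  uncoloured-ends {a = a} (none all) f with trans (sym (all a)) f
  ... | ()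
  uncoloured-ends {a = a} (cut {e = e} a₀ _ _ same en u) f with a ≟ a₀
  ... | yes refl = e , here refl , en
  ... | no p = let e′ , i , en′ = uncoloured-ends u (trans (sym (same a p)) f) in e′ , there i , en′

  same-pair : ∀ {a p q r s} → Ends a (p , q) → Ends a (r , s) → (p ≡ r × q ≡ s) ⊎ (p ≡ s × q ≡ r)
  same-pair (inj₁ (e , f)) (inj₁ (g , h)) = inj₁ (distinct _ _ (trans (sym e) g) , distinct _ _ (trans (sym f) h))
  same-pair (inj₁ (e , f)) (inj₂ (g , h)) = inj₂ (distinct _ _ (trans (sym e) g) , distinct _ _ (trans (sym f) h))
  same-pair (inj₂ (e , f)) (inj₁ (g , h)) = inj₂ (distinct _ _ (trans (sym f) h) , distinct _ _ (trans (sym e) g))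
  same-pair (inj₂ (e , f)) (inj₂ (g , h)) = inj₁ (distinct _ _ (trans (sym f) h) , distinct _ _ (trans (sym e) g))

  newEdge-sound : ∀ {p q : Fin L} {es e} → newEdge (p , q) es ≡ true → e ∈ es →
                  ¬ ((p ≡ proj₁ e × q ≡ proj₂ e) ⊎ (p ≡ proj₂ e × q ≡ proj₁ e))
  newEdge-sound {p} {q} {es} {r , s} ok i c with p ≟ r | q ≟ s | p ≟ s | q ≟ r | everyOf-true _ es ok i
  newEdge-sound ok i (inj₁ (e , f)) | no x | _ | _ | _ | _ = x e
  newEdge-sound ok i (inj₁ (e , f)) | yes _ | no x | _ | _ | _ = x f
  newEdge-sound ok i (inj₂ (e , f)) | _ | _ | no x | _ | _ = x e
  newEdge-sound ok i (inj₂ (e , f)) | _ | _ | yes _ | no x | _ = x f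
  newEdge-sound ok i (inj₁ (e , f)) | yes _ | yes _ | _ | _ | ()
  newEdge-sound ok i (inj₂ (e , f)) | no _ | _ | yes _ | yes _ | ()
  newEdge-sound ok i (inj₂ (e , f)) | yes _ | no _ | yes _ | yes _ | ()

  module _ (S₀ : Edges) (φ : Colouring) (cols₀ : List (Fin D)) where

    pairSig : Edges → Fin D → Sig L × Sig L
    pairSig S i = sig S₀ φ i , sig S φ i

    -- The invariant of uncolouring. A colour outside the list has its original signature, so its
    -- current signature is known as soon as it turns up on an edge. Containing `cols₀` ensures that
    -- such a newcomer is not one of the start colours.
    Tracks : Edges → List (Sig L × Sig L) → Set
    Tracks S st = ∃ λ cols → Unique cols × map (pairSig S) cols ≡ st ×
      (∀ i → ¬ i ∈ cols → sig S φ i ≡ sig S₀ φ i) × (∀ {i} → i ∈ cols₀ → i ∈ cols)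

    map-pairs : ∀ {S S′ ks} → All (λ k → sig S φ k ≡ sig S′ φ k) ks → map (pairSig S) ks ≡ map (pairSig S′) ks
    map-pairs [] = refl
    map-pairs (e ∷ es) = cong₂ _∷_ (cong (_ ,_) e) (map-pairs es)

    elem-intro : ∀ {s} {xs : List (Sig L)} → s ∈ xs → elem s xs ≡ true
    elem-intro {s} i = someOf-intro (s ≡ˢ_) i (≡ˢ-refl s)
      where
      ≡ˢ-refl : ∀ s → (s ≡ˢ s) ≡ true
      ≡ˢ-refl s with Vec.≡-dec _≟ᵇ_ s s
      ... | yes _ = refl
      ... | no p = ⊥-elim (p refl)

    -- The colour of the edge is either untracked, and then has a fresh signature, or tracked, and
    -- then seen at both ends. These are the two halves of `uncolour`.
    step : ∀ {es S′ st} l → Uncoloured es S′ → ProperColouringOn G S′ D φ → Tracks S′ st → Labelled S₀ φ cols₀ l →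
           newEdge (Label.from l , Label.to l) es ≡ true →
           ∃₂ λ S st′ → Uncoloured ((Label.from l , Label.to l) ∷ es) S × ProperColouringOn G S D φ ×
                        Tracks S st′ × st′ ∈ uncolour l st
    step {es} {S′} (label p q fresh old) un proper (cols , u , refl , outside , cols₀⊆) (a , pq , col) new =
      S , proj₁ result , cut a Sa S′a same pq un , U.proper-S , proj₂ result
      where
      S : Edges
      S b = S′ b ∧ not ⌊ b ≟ a ⌋
      S′a : S′ a ≡ true
      S′a with S′ a in e
      ... | true = refl
      ... | false with uncoloured-ends un e
      ...   | e′ , i , en = ⊥-elim (newEdge-sound {es = es} new i (same-pair pq en))
      Sa : S a ≡ false
      Sa rewrite ⌊≟⌋-refl a | S′a = refl
      same : ∀ b → b ≢ a → S b ≡ S′ b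
      same b b≢a with b ≟ a | S′ b
      ... | yes e | _ = ⊥-elim (b≢a e)
      ... | no _ | true = refl
      ... | no _ | false = refl
      module U = Uncolour {S} {S′} {φ} proper Sa S′a same pq
      seen : ∀ r → Incident G (lookup loc r) a → lookup (sig S′ φ (φ a)) r ≡ false
      seen r ra = trans (lookup-sig S′ φ (φ a) r) (misses-no (a , S′a , ra , refl))
      result : ∃ λ st′ → Tracks S st′ × st′ ∈ uncolour (label p q fresh old) (map (pairSig S′) cols)
      result with Any.any? (φ a ≟_) cols
      ... | no i∉ = (o , assign true p q o) ∷ map (pairSig S′) cols ,
          (φ a ∷ cols , All.tabulate (λ j e → i∉ (subst (_∈ cols) (sym e) j)) ∷ u ,
            cong₂ _∷_ (cong (o ,_) (trans U.sig-at (cong (assign true p q) (outside _ i∉))))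
                      (map-pairs (All.tabulate λ j → U.sig-other λ e → i∉ (subst (_∈ cols) e j))) ,
            (λ i i∉′ → trans (U.sig-other (λ e → i∉′ (here e))) (outside i (i∉′ ∘ there))) , there ∘ cols₀⊆) ,
          ∈-++⁺ˡ (∈-map⁺ _ (isFresh col))
        where
        o = sig S₀ φ (φ a)
        isFresh : sig S₀ φ (φ a) ∈ fresh ⊎ (φ a ∈ cols₀ × sig S₀ φ (φ a) ∈ old) → sig S₀ φ (φ a) ∈ fresh
        isFresh (inj₁ f) = f
        isFresh (inj₂ (c , _)) = ⊥-elim (i∉ (cols₀⊆ c))
      ... | yes i∈ with picks-∈ i∈
      ...   | rest , j with unique-resp-↭ (picks-↭ cols j) u
      ...     | i∉rest ∷ u′ = _ ,
          (φ a ∷ rest , i∉rest ∷ u′ ,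
            cong₂ _∷_ (cong (_ ,_) U.sig-at) (map-pairs (All.map (λ p → U.sig-other (p ∘ sym)) i∉rest)) ,
            (λ i i∉ → trans (U.sig-other (λ e → i∉ (here e))) (outside i (i∉ ∘ ∈-resp-↭ (picks-↭ cols j)))) ,
            ∈-resp-↭ (picks-↭ cols j) ∘ cols₀⊆) ,
          ∈-++⁺ʳ (map (λ o → (o , assign true p q o) ∷ map (pairSig S′) cols) fresh)
            (∈-concatMap⁺ _ (lose (picks-map (pairSig S′) cols j) merged))
        where
        known : elem (sig S₀ φ (φ a)) (fresh ++ old) ≡ true
        known = [ elem-intro ∘ ∈-++⁺ˡ , elem-intro ∘ ∈-++⁺ʳ fresh ∘ proj₂ ]′ col
        merged : ((sig S₀ φ (φ a) , assign true p q (sig S′ φ (φ a))) ∷ map (pairSig S′) rest) ∈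
          (if elem (sig S₀ φ (φ a)) (fresh ++ old) ∧ not (lookup (sig S′ φ (φ a)) p) ∧ not (lookup (sig S′ φ (φ a)) q)
           then ((sig S₀ φ (φ a) , assign true p q (sig S′ φ (φ a))) ∷ map (pairSig S′) rest) ∷ [] else [])
        merged rewrite known | seen p (proj₁ (ends-incident pq)) | seen q (proj₂ (ends-incident pq)) = here refl

    steps : ∀ {es S′ st} ls → Uncoloured es S′ → ProperColouringOn G S′ D φ → Tracks S′ st → All (Labelled S₀ φ cols₀) ls →
            newEdges ls es ≡ true →
            ∃₂ λ S st′ → Uncoloured (removed ls es) S × ProperColouringOn G S D φ × Tracks S st′ × st′ ∈ run ls st
    steps [] un pr tr [] new = _ , _ , un , pr , tr , here refl
    steps {es} (l ∷ ls) un pr tr (lb ∷ lbs) new with ∧-true {newEdge (Label.from l , Label.to l) es} new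
    ... | x , y with step l un pr tr lb x
    ...   | S₁ , st₁ , un₁ , pr₁ , tr₁ , i with steps ls un₁ pr₁ tr₁ lbs y
    ...     | S , st′ , un′ , pr′ , tr′ , j = S , st′ , un′ , pr′ , tr′ , ∈-concatMap⁺ (run ls) (lose i j)

    refute : ∀ e ls start tab → certified e ls start tab ≡ true → Uncoloured (e ∷ []) S₀ → ProperColouringOn G S₀ D φ →
             Unique cols₀ → map (sig S₀ φ) cols₀ ≡ start → All (Labelled S₀ φ cols₀) ls → ⊥
    refute e ls start tab ok un proper u refl lbs with ∧-true {newEdges ls (e ∷ [])} ok
    ... | new , ok′ with ∧-true {Check.verify (removed ls (e ∷ [])) [] tab} ok′
    ...   | ver , final with steps ls un proper (cols₀ , u , List.map-∘ cols₀ , (λ _ _ → refl) , id) lbs new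
    ...     | S , st , un′ , proper′ , (cols , u′ , refl , _) , i =
      good-refuted _ _ _ (learnt-refuted _ [] tab [] ver) (everyOf-true _ _ final i) S φ un′ proper′
        (cols , u′ , List.map-∘ cols)

-- Signatures are written as bit masks, vertex 0 being the least significant bit.  The vertices are numbered
-- in the order a b u (Neighbour), a b u x (Distance2), a b u y x (Distance3), a b c u x y (Kite) and
-- a b c u y z x (Far).  A table lists states together with a move all of whose outcomes are colourable or
-- occur earlier; it comes from a fixed-point search over all states.
bits : ∀ {L} → ℕ → Sig L
bits {zero}  k = []
bits {suc L} k = (k % 2 ≡ᵇ 1) ∷ bits (k / 2)

single′ : ∀ {L} → List ℕ → ℕ → ℕ → Fin L → State L × Move
single′ st s t v = map bits st , single (bits s) (bits t) v

double′ : ∀ {L} → List ℕ → ℕ → ℕ → Fin L → ℕ → ℕ → Fin L → State L × Move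
double′ st s t v s′ t′ v′ = map bits st , double (bits s) (bits t) v (bits s′) (bits t′) v′

label′ : ∀ {L} → Fin L → Fin L → List ℕ → List ℕ → Label {L}
label′ p q fresh old = label p q (map bits fresh) (map bits old)

-- Certificates of the reducible configurations

module Neighbour where
  labels : List (Label {3})
  labels =
    label′ (# 1) (# 2) ([]) (1 ∷ []) ∷
    []

  table : List (State 3 × Move {3})
  table =
    []

  checked : certified (# 0 , # 1) labels (map bits (1 ∷ 6 ∷ [])) table ≡ true
  checked = refl

-- Signature 9 is that of the colour of bu, missed by a and x. Two colours missing at b have
-- signature 2 or 10 according to whether x sees or misses them; up to order this leaves three start
-- states.
module Distance2 where
  labels : List (Label {4})
  labels =
    label′ (# 1) (# 2) ([]) (9 ∷ []) ∷
    label′ (# 2) (# 3) (1 ∷ 2 ∷ []) ([]) ∷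
    []

  table : List (State 4 × Move {4})
  table =
    single′ (15 ∷ 13 ∷ 10 ∷ 10 ∷ []) 10 13 (# 0) ∷
    single′ (15 ∷ 13 ∷ 10 ∷ 2 ∷ []) 10 13 (# 0) ∷
    single′ (11 ∷ 3 ∷ 14 ∷ 4 ∷ []) 4 11 (# 1) ∷
    single′ (11 ∷ 5 ∷ 14 ∷ 2 ∷ []) 2 5 (# 0) ∷
    single′ (15 ∷ 11 ∷ 2 ∷ 4 ∷ []) 4 15 (# 0) ∷
    single′ (15 ∷ 13 ∷ 2 ∷ 2 ∷ []) 2 13 (# 0) ∷
    []

  checked₀ : certified (# 0 , # 1) labels (map bits (9 ∷ 2 ∷ 2 ∷ [])) table ≡ true
  checked₀ = refl

  checked₁ : certified (# 0 , # 1) labels (map bits (9 ∷ 2 ∷ 10 ∷ [])) table ≡ true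
  checked₁ = refl

  checked₂ : certified (# 0 , # 1) labels (map bits (9 ∷ 10 ∷ 10 ∷ [])) table ≡ true
  checked₂ = refl

module Distance2′ where
  labels : List (Label {4})
  labels =
    label′ (# 1) (# 2) ([]) (9 ∷ []) ∷
    label′ (# 2) (# 3) (1 ∷ []) ([]) ∷
    []

  table : List (State 4 × Move {4})
  table =
    single′ (15 ∷ 13 ∷ 10 ∷ []) 10 13 (# 0) ∷
    []

  checked : certified (# 0 , # 1) labels (map bits (9 ∷ 10 ∷ [])) table ≡ true
  checked = refl

module Distance3 where
  labels : List (Label {5})
  labels =
    label′ (# 1) (# 2) ([]) (17 ∷ []) ∷
    label′ (# 2) (# 3) (1 ∷ 2 ∷ 17 ∷ 18 ∷ []) (18 ∷ []) ∷
    label′ (# 3) (# 4) (1 ∷ 2 ∷ []) ([]) ∷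
    []

  table : List (State 5 × Move {5})
  table =
    single′ (23 ∷ 30 ∷ 26 ∷ 18 ∷ []) 23 26 (# 0) ∷
    single′ (23 ∷ 30 ∷ 26 ∷ 18 ∷ 18 ∷ []) 23 26 (# 0) ∷
    single′ (23 ∷ 17 ∷ 30 ∷ 26 ∷ 18 ∷ []) 23 26 (# 0) ∷
    single′ (23 ∷ 25 ∷ 30 ∷ 18 ∷ 18 ∷ []) 18 25 (# 0) ∷
    single′ (23 ∷ 17 ∷ 30 ∷ 26 ∷ []) 23 26 (# 0) ∷
    single′ (23 ∷ 25 ∷ 30 ∷ 18 ∷ []) 18 25 (# 0) ∷
    single′ (23 ∷ 29 ∷ 26 ∷ 18 ∷ 18 ∷ []) 26 29 (# 0) ∷
    single′ (23 ∷ 30 ∷ 26 ∷ 18 ∷ 2 ∷ []) 23 26 (# 0) ∷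
    single′ (7 ∷ 30 ∷ 26 ∷ 18 ∷ 18 ∷ []) 7 18 (# 0) ∷
    single′ (23 ∷ 14 ∷ 26 ∷ 18 ∷ 18 ∷ []) 14 23 (# 0) ∷
    single′ (23 ∷ 17 ∷ 30 ∷ 26 ∷ 2 ∷ []) 23 26 (# 0) ∷
    single′ (23 ∷ 25 ∷ 30 ∷ 18 ∷ 2 ∷ []) 18 25 (# 0) ∷
    single′ (7 ∷ 25 ∷ 30 ∷ 18 ∷ 18 ∷ []) 7 18 (# 0) ∷
    single′ (23 ∷ 25 ∷ 14 ∷ 18 ∷ 18 ∷ []) 14 23 (# 0) ∷
    single′ (23 ∷ 17 ∷ 17 ∷ 30 ∷ 26 ∷ []) 23 26 (# 0) ∷
    single′ (23 ∷ 25 ∷ 17 ∷ 30 ∷ 18 ∷ []) 18 25 (# 0) ∷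
    single′ (23 ∷ 29 ∷ 17 ∷ 26 ∷ 18 ∷ []) 26 29 (# 0) ∷
    single′ (23 ∷ 29 ∷ 25 ∷ 18 ∷ 18 ∷ []) 18 25 (# 0) ∷
    single′ (31 ∷ 23 ∷ 10 ∷ 18 ∷ 16 ∷ []) 10 23 (# 2) ∷
    single′ (31 ∷ 23 ∷ 18 ∷ 18 ∷ 8 ∷ []) 8 18 (# 1) ∷
    single′ (23 ∷ 19 ∷ 30 ∷ 10 ∷ 16 ∷ []) 10 23 (# 2) ∷
    single′ (23 ∷ 19 ∷ 30 ∷ 18 ∷ 8 ∷ []) 8 18 (# 1) ∷
    single′ (23 ∷ 19 ∷ 10 ∷ 18 ∷ 28 ∷ []) 10 28 (# 1) ∷
    single′ (23 ∷ 11 ∷ 18 ∷ 18 ∷ 28 ∷ []) 11 18 (# 0) ∷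
    single′ (23 ∷ 13 ∷ 26 ∷ 18 ∷ 18 ∷ []) 13 26 (# 0) ∷
    single′ (23 ∷ 17 ∷ 1 ∷ 30 ∷ 26 ∷ []) 23 26 (# 0) ∷
    single′ (23 ∷ 25 ∷ 1 ∷ 30 ∷ 18 ∷ []) 18 25 (# 0) ∷
    single′ (23 ∷ 25 ∷ 17 ∷ 30 ∷ 2 ∷ []) 2 17 (# 0) ∷
    single′ (7 ∷ 25 ∷ 17 ∷ 30 ∷ 18 ∷ []) 7 18 (# 0) ∷
    single′ (23 ∷ 25 ∷ 17 ∷ 14 ∷ 18 ∷ []) 14 23 (# 0) ∷
    single′ (31 ∷ 23 ∷ 17 ∷ 10 ∷ 16 ∷ []) 10 23 (# 2) ∷
    single′ (31 ∷ 23 ∷ 17 ∷ 18 ∷ 8 ∷ []) 8 18 (# 1) ∷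
    single′ (23 ∷ 11 ∷ 17 ∷ 30 ∷ 16 ∷ []) 11 23 (# 2) ∷
    single′ (23 ∷ 19 ∷ 9 ∷ 30 ∷ 16 ∷ []) 9 19 (# 1) ∷
    single′ (23 ∷ 19 ∷ 17 ∷ 30 ∷ 8 ∷ []) 8 17 (# 0) ∷
    single′ (23 ∷ 19 ∷ 17 ∷ 10 ∷ 28 ∷ []) 10 28 (# 1) ∷
    single′ (23 ∷ 11 ∷ 17 ∷ 18 ∷ 28 ∷ []) 11 18 (# 0) ∷
    single′ (23 ∷ 13 ∷ 17 ∷ 26 ∷ 18 ∷ []) 13 26 (# 0) ∷
    single′ (23 ∷ 13 ∷ 25 ∷ 18 ∷ 18 ∷ []) 18 25 (# 0) ∷
    []

  checked : certified (# 0 , # 1) labels (map bits (17 ∷ 18 ∷ 18 ∷ [])) table ≡ true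
  checked = refl

-- Here x and y miss the same colour, namely the single one missing at b: signature 50.
module Kite₁ where
  labels : List (Label {6})
  labels =
    label′ (# 0) (# 2) ([]) (50 ∷ []) ∷
    label′ (# 1) (# 3) (1 ∷ []) ([]) ∷
    label′ (# 2) (# 3) (1 ∷ []) ([]) ∷
    label′ (# 3) (# 4) (1 ∷ []) ([]) ∷
    label′ (# 3) (# 5) (1 ∷ []) ([]) ∷
    []

  table : List (State 6 × Move {6})
  table =
    single′ (31 ∷ 7 ∷ 25 ∷ 41 ∷ 41 ∷ []) 7 41 (# 1) ∷
    -- The only double move in the tables; both of its chains start at b.
    double′ (7 ∷ 59 ∷ 13 ∷ 25 ∷ 41 ∷ []) 7 25 (# 1) 13 59 (# 1) ∷
    single′ (55 ∷ 11 ∷ 13 ∷ 25 ∷ 41 ∷ []) 11 55 (# 2) ∷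
    []

  checked : certified (# 0 , # 1) labels (map bits (50 ∷ [])) table ≡ true
  checked = refl

-- Here x misses the colour missing at b (18) and y misses a colour missing at a (33). Edges may
-- carry these two colours, hence the nonempty lists of old signatures.
module Kite₂ where
  labels : List (Label {6})
  labels =
    label′ (# 0) (# 2) ([]) (18 ∷ []) ∷
    label′ (# 1) (# 3) (1 ∷ []) (33 ∷ []) ∷
    label′ (# 2) (# 3) (1 ∷ []) (33 ∷ []) ∷
    label′ (# 3) (# 4) (1 ∷ []) (33 ∷ []) ∷
    label′ (# 3) (# 5) (1 ∷ []) (18 ∷ []) ∷
    []

  table : List (State 6 × Move {6})
  table =
    single′ (63 ∷ 11 ∷ 13 ∷ 57 ∷ []) 11 63 (# 2) ∷
    single′ (27 ∷ 11 ∷ 45 ∷ 37 ∷ 25 ∷ []) 25 37 (# 2) ∷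
    single′ (23 ∷ 11 ∷ 45 ∷ 25 ∷ 41 ∷ []) 23 41 (# 2) ∷
    single′ (43 ∷ 35 ∷ 29 ∷ 13 ∷ 25 ∷ []) 25 35 (# 1) ∷
    single′ (23 ∷ 43 ∷ 13 ∷ 25 ∷ 41 ∷ []) 23 41 (# 1) ∷
    single′ (63 ∷ 35 ∷ 13 ∷ 25 ∷ 9 ∷ []) 9 63 (# 1) ∷
    single′ (63 ∷ 11 ∷ 13 ∷ 25 ∷ 33 ∷ []) 11 33 (# 1) ∷
    single′ (27 ∷ 19 ∷ 45 ∷ 13 ∷ 41 ∷ []) 19 41 (# 1) ∷
    single′ (7 ∷ 27 ∷ 13 ∷ 57 ∷ 41 ∷ []) 7 57 (# 2) ∷
    single′ (23 ∷ 11 ∷ 13 ∷ 57 ∷ 41 ∷ []) 11 23 (# 2) ∷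
    single′ (27 ∷ 19 ∷ 13 ∷ 37 ∷ 41 ∷ 9 ∷ []) 9 19 (# 1) ∷
    single′ (27 ∷ 19 ∷ 45 ∷ 13 ∷ 41 ∷ 1 ∷ []) 19 41 (# 1) ∷
    single′ (27 ∷ 19 ∷ 13 ∷ 5 ∷ 41 ∷ 41 ∷ []) 19 41 (# 1) ∷
    single′ (27 ∷ 19 ∷ 13 ∷ 13 ∷ 41 ∷ 33 ∷ []) 13 33 (# 2) ∷
    single′ (7 ∷ 27 ∷ 13 ∷ 25 ∷ 41 ∷ 33 ∷ []) 7 25 (# 1) ∷
    single′ (23 ∷ 11 ∷ 13 ∷ 25 ∷ 41 ∷ 33 ∷ []) 11 23 (# 2) ∷
    []

  checked : certified (# 0 , # 1) labels (map bits (18 ∷ 33 ∷ [])) table ≡ true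
  checked = refl

-- Signature 66 is that of the single colour missing at b, also missed by x. Recolouring has
-- arranged that x misses the colours of bu, cu and uy, which gives 65; the colour of uz is left
-- open.
module Far where
  labels : List (Label {7})
  labels =
    label′ (# 0) (# 2) ([]) (66 ∷ []) ∷
    label′ (# 1) (# 3) (65 ∷ []) ([]) ∷
    label′ (# 2) (# 3) (65 ∷ []) ([]) ∷
    label′ (# 3) (# 4) (65 ∷ []) ([]) ∷
    label′ (# 3) (# 5) (1 ∷ 65 ∷ []) ([]) ∷
    label′ (# 4) (# 6) (1 ∷ []) ([]) ∷
    label′ (# 5) (# 6) (1 ∷ []) ([]) ∷
    []

  table : List (State 7 × Move {7})
  table =
    single′ (107 ∷ 83 ∷ 125 ∷ 77 ∷ 73 ∷ 65 ∷ []) 73 83 (# 1) ∷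
    single′ (107 ∷ 83 ∷ 77 ∷ 77 ∷ 121 ∷ 65 ∷ []) 77 121 (# 2) ∷
    single′ (71 ∷ 107 ∷ 77 ∷ 121 ∷ 89 ∷ 65 ∷ []) 71 89 (# 1) ∷
    single′ (103 ∷ 75 ∷ 77 ∷ 121 ∷ 89 ∷ 65 ∷ []) 75 103 (# 2) ∷
    single′ (71 ∷ 75 ∷ 77 ∷ 121 ∷ 89 ∷ 97 ∷ []) 71 97 (# 1) ∷
    single′ (91 ∷ 107 ∷ 77 ∷ 77 ∷ 113 ∷ 65 ∷ 65 ∷ []) 77 113 (# 3) ∷
    single′ (91 ∷ 99 ∷ 125 ∷ 77 ∷ 73 ∷ 65 ∷ 65 ∷ []) 73 99 (# 1) ∷
    single′ (91 ∷ 99 ∷ 77 ∷ 77 ∷ 121 ∷ 65 ∷ 65 ∷ []) 77 121 (# 2) ∷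
    single′ (123 ∷ 91 ∷ 77 ∷ 101 ∷ 73 ∷ 65 ∷ 65 ∷ []) 73 123 (# 1) ∷
    single′ (123 ∷ 91 ∷ 77 ∷ 77 ∷ 97 ∷ 65 ∷ 65 ∷ []) 77 97 (# 2) ∷
    single′ (91 ∷ 115 ∷ 77 ∷ 77 ∷ 105 ∷ 65 ∷ 65 ∷ []) 105 115 (# 1) ∷
    single′ (103 ∷ 91 ∷ 77 ∷ 89 ∷ 105 ∷ 65 ∷ 65 ∷ []) 89 103 (# 2) ∷
    single′ (71 ∷ 91 ∷ 77 ∷ 89 ∷ 105 ∷ 97 ∷ 65 ∷ []) 71 97 (# 1) ∷
    single′ (87 ∷ 75 ∷ 77 ∷ 89 ∷ 105 ∷ 97 ∷ 65 ∷ []) 75 87 (# 2) ∷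
    single′ (71 ∷ 75 ∷ 77 ∷ 89 ∷ 105 ∷ 81 ∷ 97 ∷ []) 71 81 (# 1) ∷
    single′ (15 ∷ 91 ∷ 101 ∷ 121 ∷ 73 ∷ 65 ∷ 65 ∷ []) 73 101 (# 2) ∷
    single′ (79 ∷ 91 ∷ 101 ∷ 121 ∷ 9 ∷ 65 ∷ 65 ∷ []) 9 79 (# 1) ∷
    single′ (71 ∷ 91 ∷ 109 ∷ 121 ∷ 9 ∷ 65 ∷ 65 ∷ []) 9 71 (# 1) ∷
    single′ (111 ∷ 91 ∷ 5 ∷ 121 ∷ 73 ∷ 65 ∷ 65 ∷ []) 73 111 (# 1) ∷
    single′ (111 ∷ 91 ∷ 69 ∷ 121 ∷ 9 ∷ 65 ∷ 65 ∷ []) 9 69 (# 2) ∷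
    single′ (103 ∷ 91 ∷ 77 ∷ 121 ∷ 9 ∷ 65 ∷ 65 ∷ []) 77 103 (# 1) ∷
    single′ (91 ∷ 99 ∷ 125 ∷ 13 ∷ 73 ∷ 65 ∷ 65 ∷ []) 73 99 (# 1) ∷
    single′ (91 ∷ 99 ∷ 77 ∷ 13 ∷ 121 ∷ 65 ∷ 65 ∷ []) 77 121 (# 2) ∷
    single′ (47 ∷ 91 ∷ 77 ∷ 121 ∷ 65 ∷ 65 ∷ 65 ∷ []) 47 77 (# 1) ∷
    single′ (39 ∷ 91 ∷ 77 ∷ 121 ∷ 73 ∷ 65 ∷ 65 ∷ []) 39 73 (# 3) ∷
    single′ (71 ∷ 91 ∷ 77 ∷ 121 ∷ 41 ∷ 65 ∷ 65 ∷ []) 41 71 (# 5) ∷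
    single′ (111 ∷ 91 ∷ 85 ∷ 41 ∷ 73 ∷ 65 ∷ 65 ∷ []) 73 85 (# 2) ∷
    single′ (79 ∷ 91 ∷ 85 ∷ 105 ∷ 41 ∷ 65 ∷ 65 ∷ []) 79 105 (# 1) ∷
    single′ (79 ∷ 91 ∷ 77 ∷ 41 ∷ 113 ∷ 65 ∷ 65 ∷ []) 77 113 (# 3) ∷
    single′ (71 ∷ 91 ∷ 93 ∷ 105 ∷ 41 ∷ 65 ∷ 65 ∷ []) 71 105 (# 1) ∷
    single′ (95 ∷ 91 ∷ 101 ∷ 41 ∷ 73 ∷ 65 ∷ 65 ∷ []) 73 95 (# 1) ∷
    single′ (95 ∷ 91 ∷ 69 ∷ 105 ∷ 41 ∷ 65 ∷ 65 ∷ []) 69 105 (# 2) ∷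
    single′ (87 ∷ 91 ∷ 77 ∷ 105 ∷ 41 ∷ 65 ∷ 65 ∷ []) 77 87 (# 1) ∷
    single′ (103 ∷ 91 ∷ 77 ∷ 89 ∷ 41 ∷ 65 ∷ 65 ∷ []) 89 103 (# 5) ∷
    single′ (71 ∷ 91 ∷ 77 ∷ 89 ∷ 41 ∷ 97 ∷ 65 ∷ []) 71 97 (# 1) ∷
    single′ (87 ∷ 75 ∷ 77 ∷ 89 ∷ 41 ∷ 97 ∷ 65 ∷ []) 75 87 (# 2) ∷
    single′ (71 ∷ 75 ∷ 77 ∷ 89 ∷ 41 ∷ 81 ∷ 97 ∷ []) 71 81 (# 1) ∷
    []

  checked : certified (# 0 , # 1) labels (map bits (66 ∷ [])) table ≡ true
  checked = refl

-- Counting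

ind : Bool → ℕ
ind b = if b then 1 else 0

count-sum : ∀ {k} (f : Fin k → Bool) → count f ≡ sum (ind ∘ f)
count-sum {zero}  f = refl
count-sum {suc k} f = cong (ind (f zero) +_) (count-sum (f ∘ suc))

sum-mono : ∀ {k} {f g : Fin k → ℕ} → (∀ i → f i ≤ g i) → sum f ≤ sum g
sum-mono {zero}  f≤g = z≤n
sum-mono {suc k} f≤g = +-mono-≤ (f≤g zero) (sum-mono (f≤g ∘ suc))

sum-const : ∀ k c → sum {k} (λ _ → c) ≡ k * c
sum-const zero    c = refl
sum-const (suc k) c = cong (c +_) (sum-const k c)

⌊⌋-true : ∀ {P : Set} (d : Dec P) → ⌊ d ⌋ ≡ true → P
⌊⌋-true (yes p) _ = p

⌊⌋-false : ∀ {P : Set} (d : Dec P) → ⌊ d ⌋ ≡ false → ¬ P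
⌊⌋-false (no p) _ = p

⌊⌋-yes : ∀ {P : Set} (d : Dec P) → P → ⌊ d ⌋ ≡ true
⌊⌋-yes (yes _) p = refl
⌊⌋-yes (no q) p = ⊥-elim (q p)

⌊⌋-no : ∀ {P : Set} (d : Dec P) → ¬ P → ⌊ d ⌋ ≡ false
⌊⌋-no (no _) p = refl
⌊⌋-no (yes q) p = ⊥-elim (p q)

count-false : ∀ k → count {k} (λ _ → false) ≡ 0
count-false zero = refl
count-false (suc k) = count-false k

count-single : ∀ {k} (x : Fin k) → count (λ y → ⌊ y ≟ x ⌋) ≡ 1
count-single {suc k} zero = cong suc (count-false k)
count-single {suc k} (suc x) = trans (count-cong _ _ eq) (count-single x)
  where
  eq : ∀ y → ⌊ suc y ≟ suc x ⌋ ≡ ⌊ y ≟ x ⌋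
  eq y with y ≟ x
  ... | yes _ = refl
  ... | no _ = refl

≟-flip : ∀ {k} (x y : Fin k) → ⌊ x ≟ y ⌋ ≡ ⌊ y ≟ x ⌋
≟-flip x y with y ≟ x
... | yes y≡x = ⌊⌋-yes (x ≟ y) (sym y≡x)
... | no y≢x = ⌊⌋-no (x ≟ y) (y≢x ∘ sym)

count-sum-of : ∀ {k} (f g h : Fin k → Bool) → (∀ i → ind (f i) ≡ ind (g i) + ind (h i)) → count f ≡ count g + count h
count-sum-of f g h e = begin
  count f                               ≡⟨ count-sum f ⟩
  sum (ind ∘ f)                         ≡⟨ sum-cong-≗ e ⟩
  sum (λ i → ind (g i) + ind (h i))     ≡⟨ ∑-distrib-+ (ind ∘ g) (ind ∘ h) ⟩
  sum (ind ∘ g) + sum (ind ∘ h)         ≡⟨ sym (cong₂ _+_ (count-sum g) (count-sum h)) ⟩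
  count g + count h                     ∎
  where open ≡-Reasoning

count-remove : ∀ {k} (g : Fin k → Bool) y → g y ≡ true → count g ≡ suc (count (λ z → g z ∧ not ⌊ z ≟ y ⌋))
count-remove g y gy = trans (count-sum-of g (λ z → ⌊ z ≟ y ⌋) (λ z → g z ∧ not ⌊ z ≟ y ⌋) eq) (cong (_+ count (λ z → g z ∧ not ⌊ z ≟ y ⌋)) (count-single y))
  where
  eq : ∀ z → ind (g z) ≡ ind ⌊ z ≟ y ⌋ + ind (g z ∧ not ⌊ z ≟ y ⌋)
  eq z with z ≟ y | g z in gz
  ... | yes refl | true = refl
  ... | yes refl | false with trans (sym gz) gy
  ...   | ()
  eq z | no _ | true = refl
  eq z | no _ | false = refl

count-not : ∀ {k} (f : Fin k → Bool) → count f + count (not ∘ f) ≡ k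
count-not {k} f = trans (sym (count-sum-of (λ _ → true) f (not ∘ f) eq)) (trans (count-sum {k} _) (trans (sum-const k 1) (*-identityʳ k)))
  where
  eq : ∀ i → 1 ≡ ind (f i) + ind (not (f i))
  eq i with f i
  ... | true = refl
  ... | false = refl

count-none : ∀ {k} (f : Fin k → Bool) → count f ≡ 0 → ∀ x → f x ≡ false
count-none {suc k} f e zero with f zero
... | false = refl
count-none {suc k} f e (suc x) with f zero
... | false = count-none (f ∘ suc) e x

count-all : ∀ {k} (f : Fin k → Bool) → k ≤ count f → ∀ x → f x ≡ true
count-all {k} f k≤ x with f x in fx
... | true = refl
... | false with trans (sym (cong not fx)) (count-none (not ∘ f) zero-rest x)
  where
  zero-rest : count (not ∘ f) ≡ 0
  zero-rest = n≤0⇒n≡0 (+-cancelˡ-≤ (count f) _ _ (≤-trans (≤-reflexive (count-not f)) (≤-trans k≤ (≤-reflexive (sym (+-identityʳ _))))))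
...   | ()

count-some : ∀ {k} (f : Fin k → Bool) → 0 < count f → ∃ λ x → f x ≡ true
count-some {k} f 0< with any? (λ x → f x ≟ᵇ true)
... | yes p = p
... | no ¬p = ⊥-elim (<⇒≢ 0< (sym (trans (count-cong f (λ _ → false) none) (count-false k))))
  where
  none : ∀ x → f x ≡ false
  none x with f x in fx
  ... | true = ⊥-elim (¬p (x , fx))
  ... | false = refl

-- A relation in place of an injection spares choosing a neighbour or a colour by a function.
count-inject : ∀ {k l} (f : Fin k → Bool) (g : Fin l → Bool) (R : Fin k → Fin l → Set) →
               (∀ x → f x ≡ true → ∃ λ y → g y ≡ true × R x y) →
               (∀ {x x′ y} → f x ≡ true → f x′ ≡ true → R x y → R x′ y → x ≡ x′) → count f ≤ count g
count-inject {zero} f g R tot inj = z≤n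
count-inject {suc k} f g R tot inj with f zero in f0
... | false = count-inject (f ∘ suc) g (R ∘ suc) (tot ∘ suc) (λ p q r s → suc-injective (inj p q r s))
... | true with tot zero f0
...   | y , gy , r0 = ≤-trans (s≤s (count-inject (f ∘ suc) _ (R ∘ suc)
            (λ x fx → let z , gz , r = tot (suc x) fx in z , other gz (λ { refl → zero≢suc (inj f0 fx r0 r) }) , r)
            (λ p q r s → suc-injective (inj p q r s)))) (≤-reflexive (sym (count-remove g y gy)))
  where
  zero≢suc : ∀ {x : Fin k} → zero ≢ suc x
  zero≢suc ()
  other : ∀ {z} → g z ≡ true → z ≢ y → g z ∧ not ⌊ z ≟ y ⌋ ≡ true
  other {z} gz z≢y rewrite gz | ⌊⌋-no (z ≟ y) z≢y = refl

count-list : ∀ {k} (f : Fin k → Bool) (xs : List (Fin k)) → (∀ x → f x ≡ true → x ∈ xs) → count f ≤ length xs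
count-list {k} f [] cov = ≤-reflexive (trans (count-cong f (λ _ → false) λ x → none x) (count-false k))
  where
  none : ∀ x → f x ≡ false
  none x with f x in fx
  ... | false = refl
  ... | true with cov x fx
  ...   | ()
count-list f (y ∷ xs) cov with f y in fy
... | true = ≤-trans (≤-reflexive (count-remove f y fy)) (s≤s (count-list _ xs λ x e → rest x e))
  where
  rest : ∀ x → f x ∧ not ⌊ x ≟ y ⌋ ≡ true → x ∈ xs
  rest x e with f x in fx | x ≟ y
  ... | true | no x≢y with cov x fx
  ...   | here p = ⊥-elim (x≢y p)
  ...   | there i = i
... | false = m≤n⇒m≤1+n (count-list f xs rest)
  where
  rest : ∀ x → f x ≡ true → x ∈ xs
  rest x fx with cov x fx
  ... | there i = i
  ... | here refl with trans (sym fx) fy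
  ...   | ()

module _ {n} (G : Multigraph n) where

  incident-true : ∀ {v a} → Incident G v a → incB G v a ≡ true
  incident-true {v} {a} (inj₁ e) rewrite ⌊⌋-yes (proj₁ (ends G a) ≟ v) e = refl
  incident-true {v} {a} (inj₂ e) with ⌊ proj₁ (ends G a) ≟ v ⌋
  ... | true = refl
  ... | false = ⌊⌋-yes (proj₂ (ends G a) ≟ v) e

  true-incident : ∀ {v a} → incB G v a ≡ true → Incident G v a
  true-incident {v} {a} e with proj₁ (ends G a) ≟ v
  ... | yes p = inj₁ p
  ... | no _ = inj₂ (⌊⌋-true (proj₂ (ends G a) ≟ v) e)

  handshake : ∀ (P : Fin (m G) → Bool) → sum (λ v → count (λ a → P a ∧ incB G v a)) ≡ 2 * count P
  handshake P = begin
    sum (λ v → count (λ a → P a ∧ incB G v a))          ≡⟨ sum-cong-≗ (λ v → count-sum (λ a → P a ∧ incB G v a)) ⟩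
    sum (λ v → sum (λ a → ind (P a ∧ incB G v a)))      ≡⟨ ∑-comm (λ v a → ind (P a ∧ incB G v a)) ⟩
    sum (λ a → sum (λ v → ind (P a ∧ incB G v a)))      ≡⟨ sum-cong-≗ per-edge ⟩
    sum (λ a → ind (P a) + ind (P a))                   ≡⟨ ∑-distrib-+ (ind ∘ P) (ind ∘ P) ⟩
    sum (ind ∘ P) + sum (ind ∘ P)                       ≡⟨ cong₂ _+_ (sym (count-sum P)) (trans (sym (count-sum P)) (sym (+-identityʳ _))) ⟩
    2 * count P                                         ∎
    where
    open ≡-Reasoning
    two-ends : ∀ a → sum (λ v → ind (incB G v a)) ≡ 2
    two-ends a = begin
      sum (λ v → ind (incB G v a)) ≡⟨ sym (count-sum (λ v → incB G v a)) ⟩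
      count (λ v → incB G v a) ≡⟨ count-sum-of _ (λ v → ⌊ v ≟ proj₁ (ends G a) ⌋) (λ v → ⌊ v ≟ proj₂ (ends G a) ⌋) split ⟩
      _ ≡⟨ cong₂ _+_ (count-single (proj₁ (ends G a))) (count-single (proj₂ (ends G a))) ⟩
      2 ∎
      where
      split : ∀ v → ind (incB G v a) ≡ ind ⌊ v ≟ proj₁ (ends G a) ⌋ + ind ⌊ v ≟ proj₂ (ends G a) ⌋
      split v rewrite ≟-flip v (proj₁ (ends G a)) | ≟-flip v (proj₂ (ends G a))
        with proj₁ (ends G a) ≟ v | proj₂ (ends G a) ≟ v
      ... | yes p | yes q = ⊥-elim (loopless G a (trans p (sym q)))
      ... | yes _ | no _ = refl
      ... | no _ | yes _ = refl
      ... | no _ | no _ = refl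
    per-edge : ∀ a → sum (λ v → ind (P a ∧ incB G v a)) ≡ ind (P a) + ind (P a)
    per-edge a with P a
    ... | true = two-ends a
    ... | false = sum-replicate-zero n

  maxF-≥ : ∀ {k} (f : Fin k → ℕ) x → f x ≤ maxF f
  maxF-≥ f zero = m≤m⊔n _ _
  maxF-≥ f (suc x) = ≤-trans (maxF-≥ (f ∘ suc) x) (m≤n⊔m _ _)

  degOn : (Fin (m G) → Bool) → Fin n → ℕ
  degOn S v = count (λ a → S a ∧ incB G v a)

  module Colours {D} (S : Fin (m G) → Bool) (φ : Fin (m G) → Fin D) (proper : ProperColouringOn G S D φ) where

    seen : Fin n → ℕ
    seen v = count (λ i → ⌊ sees? G S φ v i ⌋)

    seen≤degOn : ∀ v → seen v ≤ degOn S v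
    seen≤degOn v = count-inject _ _ (λ i a → φ a ≡ i)
      (λ i e → let a , Sa , va , φa = ⌊⌋-true (sees? G S φ v i) e in a , cong₂ _∧_ Sa (incident-true va) , φa)
      (λ _ _ p q → trans (sym p) q)

    degOn≤seen : ∀ v → degOn S v ≤ seen v
    degOn≤seen v = count-inject _ _ (λ a i → φ a ≡ i)
      (λ a e → let Sa , va = ∧-true e in φ a , ⌊⌋-yes (sees? G S φ v (φ a)) (a , Sa , true-incident va , refl) , refl)
      (λ {a} {b} e f p q → let Sa , va = ∧-true e ; Sb , vb = ∧-true f in
        Kempe.unique G S φ proper Sa Sb (true-incident va) (true-incident vb) (trans p (sym q)))

    seen≡degOn : ∀ v → seen v ≡ degOn S v
    seen≡degOn v = ≤-antisym (seen≤degOn v) (degOn≤seen v)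

    sees-all : ∀ v → D ≤ degOn S v → ∀ i → Sees G S φ v i
    sees-all v D≤ i = ⌊⌋-true (sees? G S φ v i) (count-all _ (≤-trans D≤ (degOn≤seen v)) i)

    another : ∀ v (K : List (Fin D)) → degOn S v + length K < D → ∃ λ i → ¬ Sees G S φ v i × ¬ i ∈ K
    another v K bound with any? (λ i → ¬? (sees? G S φ v i) ×-dec ¬? (Any.any? (i ≟_) K))
    ... | yes (i , p , q) = i , p , q
    ... | no none = ⊥-elim (<⇒≱ bound (begin
      D ≡⟨ sym (count-not (λ i → ⌊ sees? G S φ v i ⌋)) ⟩
      seen v + count (λ i → not ⌊ sees? G S φ v i ⌋) ≤⟨ +-mono-≤ (seen≤degOn v) (count-list _ K covered) ⟩
      degOn S v + length K ∎))
      where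
      open ≤-Reasoning
      covered : ∀ i → not ⌊ sees? G S φ v i ⌋ ≡ true → i ∈ K
      covered i e with sees? G S φ v i | Any.any? (i ≟_) K
      ... | no p | yes q = q
      ... | no p | no q = ⊥-elim (none (i , p , q))

count-two : ∀ {k} (f : Fin k → Bool) → 1 < count f → ∀ x → ∃ λ y → f y ≡ true × y ≢ x
count-two f 1< x with any? (λ y → (f y ≟ᵇ true) ×-dec ¬? (y ≟ x))
... | yes p = p
... | no none = ⊥-elim (<⇒≱ 1< (count-list f (x ∷ []) only))
  where
  only : ∀ y → f y ≡ true → y ∈ x ∷ []
  only y fy with y ≟ x
  ... | yes p = here p
  ... | no p = ⊥-elim (none (y , fy , p))

count-one : ∀ {k} (f : Fin k → Bool) → count f ≤ 1 → ∀ {x y} → f x ≡ true → f y ≡ true → x ≡ y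
count-one f ≤1 {x} {y} fx fy with x ≟ y
... | yes p = p
... | no p = ⊥-elim (<⇒≱ (≤-reflexive (sym (trans (count-remove f x fx)
               (cong suc (count-remove (λ z → f z ∧ not ⌊ z ≟ x ⌋) y (both y fy (p ∘ sym))))))) ≤1′)
  where
  both : ∀ y → f y ≡ true → y ≢ x → f y ∧ not ⌊ y ≟ x ⌋ ≡ true
  both y fy y≢x rewrite fy | ⌊⌋-no (y ≟ x) y≢x = refl
  ≤1′ : count f ≤ suc (count (λ z → (f z ∧ not ⌊ z ≟ x ⌋) ∧ not ⌊ z ≟ y ⌋))
  ≤1′ = ≤-trans ≤1 (s≤s z≤n)

total : ∀ {k} → List (Fin k → Bool) → Fin k → ℕ
total [] i = 0
total (f ∷ fs) i = ind (f i) + total fs i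

counts : ∀ {k} → List (Fin k → Bool) → ℕ
counts [] = 0
counts (f ∷ fs) = count f + counts fs

counts-sum : ∀ {k} (fs : List (Fin k → Bool)) → counts fs ≡ sum (total fs)
counts-sum {k} [] = sym (sum-replicate-zero k)
counts-sum (f ∷ fs) = trans (cong₂ _+_ (count-sum f) (counts-sum fs)) (sym (∑-distrib-+ (ind ∘ f) (total fs)))

-- The pigeonhole principle behind all degree counts: with `c` = 3 and four neighbourhoods, `g`
-- collects the common neighbours; with `c` = 1 and empty `g` it is disjointness.
counts-≤ : ∀ {k} (fs : List (Fin k → Bool)) c g → (∀ i → total fs i ≤ c + ind (g i)) → counts fs ≤ k * c + count g
counts-≤ {k} fs c g bound = begin
  counts fs                           ≡⟨ counts-sum fs ⟩
  sum (total fs)                      ≤⟨ sum-mono bound ⟩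
  sum (λ i → c + ind (g i))           ≡⟨ ∑-distrib-+ {k} (λ _ → c) (ind ∘ g) ⟩
  sum {k} (λ _ → c) + sum (ind ∘ g)   ≡⟨ cong₂ _+_ (sum-const k c) (sym (count-sum g)) ⟩
  k * c + count g                     ∎
  where open ≤-Reasoning

count-≤ : ∀ {k} (f : Fin k → Bool) → count f ≤ k
count-≤ f = ≤-trans (m≤m+n _ _) (≤-reflexive (count-not f))

count-true : ∀ k → count {k} (λ _ → true) ≡ k
count-true k = trans (count-sum {k} _) (trans (sum-const k 1) (*-identityʳ k))

count-unique : ∀ {k} (f : Fin k → Bool) (d : Dec (∃ λ x → f x ≡ true)) → (∀ {x y} → f x ≡ true → f y ≡ true → x ≡ y) →
               count f ≡ ind ⌊ d ⌋
count-unique f (yes (x , fx)) unique = ≤-antisym (count-list f (x ∷ []) (λ y fy → here (unique fy fx)))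
  (≤-trans (s≤s z≤n) (≤-reflexive (sym (count-remove f x fx))))
count-unique {k} f (no none) unique = trans (count-cong f (λ _ → false) all-false) (count-false k)
  where
  all-false : ∀ x → f x ≡ false
  all-false x with f x in e
  ... | false = refl
  ... | true = ⊥-elim (none (x , e))

module _ {n} (G : Multigraph n) {D} (S : Fin (m G) → Bool) (φ : Fin (m G) → Fin D) (proper : ProperColouringOn G S D φ) where

  class : Fin D → Fin (m G) → Bool
  class i e = S e ∧ ⌊ φ e ≟ i ⌋

  -- A colour class is a matching, so the handshake sum over it counts each covered vertex once.
  -- Both the parity argument and the final edge count use this.
  class-cover : ∀ i → count (λ v → ⌊ sees? G S φ v i ⌋) ≡ 2 * count (class i)
  class-cover i = trans (trans (count-sum (λ v → ⌊ sees? G S φ v i ⌋)) (sum-cong-≗ λ v → sym (per-vertex v))) (handshake G (class i))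
    where
    at : ∀ {v e} → class i e ∧ incB G v e ≡ true → S e ≡ true × Incident G v e × φ e ≡ i
    at {v} {e} p with ∧-true {class i e} p
    ... | q , r with ∧-true {S e} q
    ...   | s , t = s , true-incident G r , ⌊⌋-true (φ e ≟ i) t
    per-vertex : ∀ v → count (λ e → class i e ∧ incB G v e) ≡ ind ⌊ sees? G S φ v i ⌋
    per-vertex v = trans (count-unique _ (any? λ e → (class i e ∧ incB G v e) ≟ᵇ true)
        (λ p q → let Sa , va , fa = at p ; Sb , vb , fb = at q in Kempe.unique G S φ proper Sa Sb va vb (trans fa (sym fb))))
      (cong ind (agree (any? _) (sees? G S φ v i)))
      where
      agree : (d : Dec (∃ λ e → class i e ∧ incB G v e ≡ true)) (d′ : Dec (Sees G S φ v i)) → ⌊ d ⌋ ≡ ⌊ d′ ⌋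
      agree (yes _) (yes _) = refl
      agree (no _) (no _) = refl
      agree (yes (e , p)) (no q) = ⊥-elim (q (e , at p))
      agree (no p) (yes (e , Se , ve , f)) = ⊥-elim (p (e , cong₂ _∧_ (cong₂ _∧_ Se (⌊⌋-yes (φ e ≟ i) f)) (incident-true G ve)))

  class-total : count S ≡ sum (λ i → count (class i))
  class-total = begin
    count S                                        ≡⟨ count-sum S ⟩
    sum (ind ∘ S)                                  ≡⟨ sum-cong-≗ (λ e → sym (per-edge e)) ⟩
    sum (λ e → sum (λ i → ind (class i e)))        ≡⟨ ∑-comm (λ e i → ind (class i e)) ⟩
    sum (λ i → sum (λ e → ind (class i e)))        ≡⟨ sum-cong-≗ (λ i → sym (count-sum (class i))) ⟩
    sum (λ i → count (class i))                    ∎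
    where
    open ≡-Reasoning
    per-edge : ∀ e → sum (λ i → ind (class i e)) ≡ ind (S e)
    per-edge e = trans (sym (count-sum (λ i → class i e)))
      (trans (count-cong (λ i → class i e) (λ i → S e ∧ ⌊ i ≟ φ e ⌋) (λ i → cong (S e ∧_) (≟-flip (φ e) i))) (go (S e)))
      where
      go : ∀ s → count (λ i → s ∧ ⌊ i ≟ φ e ⌋) ≡ ind s
      go true = count-single (φ e)
      go false = count-false D

-- Colourings of G − ab

∉-cons : ∀ {A : Set} {x y : A} {ys} → x ≢ y → ¬ x ∈ ys → ¬ x ∈ y ∷ ys
∉-cons p q (here e) = p e
∉-cons p q (there i) = q i

module _ {n} (G : Multigraph n) where

  Joins : Fin (m G) → Fin n → Fin n → Set
  Joins e u v = SameEnds (ends G e) (u , v)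

  joins-sym : ∀ {e u v} → Joins e u v → Joins e v u
  joins-sym (inj₁ (p , q)) = inj₂ (p , q)
  joins-sym (inj₂ (p , q)) = inj₁ (p , q)

  joins-ˡ : ∀ {e u v} → Joins e u v → Incident G u e
  joins-ˡ (inj₁ (p , q)) = inj₁ p
  joins-ˡ (inj₂ (p , q)) = inj₂ q

  joins-ʳ : ∀ {e u v} → Joins e u v → Incident G v e
  joins-ʳ = joins-ˡ ∘ joins-sym

  joins-only : ∀ {e u v w} → Joins e u v → Incident G w e → w ≡ u ⊎ w ≡ v
  joins-only (inj₁ (p , q)) (inj₁ r) = inj₁ (trans (sym r) p)
  joins-only (inj₁ (p , q)) (inj₂ r) = inj₂ (trans (sym r) q)
  joins-only (inj₂ (p , q)) (inj₁ r) = inj₂ (trans (sym r) p)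
  joins-only (inj₂ (p , q)) (inj₂ r) = inj₁ (trans (sym r) q)

  joins-≢ : ∀ {e u v} → Joins e u v → u ≢ v
  joins-≢ {e} (inj₁ (p , q)) r = loopless G e (trans p (trans r (sym q)))
  joins-≢ {e} (inj₂ (p , q)) r = loopless G e (trans p (trans (sym r) (sym q)))

module Deleted {n} (G : Multigraph n) (D : ℕ) (unc : ¬ ColourableOn G (allEdges G) D)
               (a b : Fin n) (e₀ : Fin (m G)) (ab : Joins G e₀ a b) where

  S₀ : Fin (m G) → Bool
  S₀ e = not ⌊ e ≟ e₀ ⌋

  a≢b : a ≢ b
  a≢b = joins-≢ G ab

  S₀-other : ∀ {e} → e ≢ e₀ → S₀ e ≡ true
  S₀-other {e} p rewrite ⌊⌋-no (e ≟ e₀) p = refl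

  S₀-e₀ : S₀ e₀ ≡ false
  S₀-e₀ rewrite ⌊⌋-yes (e₀ ≟ e₀) refl = refl

  S₀-≢ : ∀ {e} → S₀ e ≡ true → e ≢ e₀
  S₀-≢ p refl with trans (sym p) S₀-e₀
  ... | ()

  joins-S₀ : ∀ {e u v} → Joins G e u v → v ≢ a → v ≢ b → S₀ e ≡ true
  joins-S₀ j p q = S₀-other λ { refl → [ p , q ]′ (joins-only G ab (joins-ʳ G j)) }

  degOn-≤ : ∀ v → degOn G S₀ v ≤ deg G v
  degOn-≤ v = count-mono (λ e → S₀ e ∧ incB G v e) (incB G v) λ e p → proj₂ (∧-true p)

  degOn-end : ∀ {v} → Incident G v e₀ → suc (degOn G S₀ v) ≡ deg G v
  degOn-end {v} ve = sym (trans (count-remove (incB G v) e₀ (incident-true G ve)) (cong suc (count-cong _ (λ e → S₀ e ∧ incB G v e) eq)))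
    where
    eq : ∀ e → incB G v e ∧ not ⌊ e ≟ e₀ ⌋ ≡ S₀ e ∧ incB G v e
    eq e with incB G v e | ⌊ e ≟ e₀ ⌋
    ... | true | true = refl
    ... | true | false = refl
    ... | false | true = refl
    ... | false | false = refl

  degOn-other : ∀ {v} → v ≢ a → v ≢ b → degOn G S₀ v ≡ deg G v
  degOn-other {v} p q = count-cong (λ e → S₀ e ∧ incB G v e) (incB G v) eq
    where
    eq : ∀ e → S₀ e ∧ incB G v e ≡ incB G v e
    eq e with e ≟ e₀
    ... | no _ = refl
    ... | yes refl with incB G v e in i
    ...   | false = refl
    ...   | true = ⊥-elim ([ p , q ]′ (joins-only G ab (true-incident G i)))

  Col : Set
  Col = ColourableOn G S₀ D

  module Colouring (c : Col) where
    φ : Fin (m G) → Fin D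
    φ = proj₁ c
    proper : ProperColouringOn G S₀ D φ
    proper = proj₂ c
    Has : Fin n → Fin D → Set
    Has v i = Sees G S₀ φ v i
    open Colours G S₀ φ proper public

    -- Such a colour could be given to `e₀`.
    not-both : ∀ {i} → ¬ Has a i → ¬ Has b i → ⊥
    not-both {i} p q = unc (φ′ , proper′)
      where
      φ′ : Fin (m G) → Fin D
      φ′ e = if ⌊ e ≟ e₀ ⌋ then i else φ e
      clash : ∀ {e v} → e ≢ e₀ → Incident G v e₀ → Incident G v e → φ e ≢ i
      clash e≢ ve₀ ve f with joins-only G ab ve₀
      ... | inj₁ refl = p (_ , S₀-other e≢ , ve , f)
      ... | inj₂ refl = q (_ , S₀-other e≢ , ve , f)
      proper′ : ProperColouringOn G (allEdges G) D φ′
      proper′ e f e≢f _ _ v ve vf eq with e ≟ e₀ | f ≟ e₀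
      ... | yes refl | yes refl = e≢f refl
      ... | yes refl | no f≢ = clash f≢ ve vf (sym eq)
      ... | no e≢ | yes refl = clash e≢ vf ve eq
      ... | no e≢ | no f≢ = proper e f e≢f (S₀-other e≢) (S₀-other f≢) v ve vf eq

-- Full-deficiency pairs and controlled exchanges

module Pair {n} (G : Multigraph n) (D : ℕ) (unc : ¬ ColourableOn G (allEdges G) D)
            (a b : Fin n) (e₀ : Fin (m G)) (ab : Joins G e₀ a b) (degs : deg G a + deg G b ≡ D + 2) where

  open Deleted G D unc a b e₀ ab public

  degOn-sum : degOn G S₀ a + degOn G S₀ b ≡ D
  degOn-sum = suc-injective² (begin
    2 + (degOn G S₀ a + degOn G S₀ b)     ≡⟨ sym (cong suc (+-suc _ _)) ⟩
    suc (degOn G S₀ a) + suc (degOn G S₀ b) ≡⟨ cong₂ _+_ (degOn-end (joins-ˡ G ab)) (degOn-end (joins-ʳ G ab)) ⟩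
    deg G a + deg G b                     ≡⟨ degs ⟩
    D + 2                                 ≡⟨ +-comm D 2 ⟩
    2 + D                                 ∎)
    where
    open ≡-Reasoning
    suc-injective² : ∀ {x y} → 2 + x ≡ 2 + y → x ≡ y
    suc-injective² refl = refl

  module Of (c : Col) where
    open Colouring c public

    seen-sum : seen a + seen b ≡ D
    seen-sum = trans (cong₂ _+_ (seen≡degOn a) (seen≡degOn b)) degOn-sum

    -- The equation `seen-sum` leaves no slack: by `not-both` the vertex b sees all D - `seen a`
    -- colours missing at a, and these already make up `seen b`.
    not-neither : ∀ {i} → Has a i → Has b i → ⊥
    not-neither {i} p q = <-irrefl refl (begin-strict
      D                                                ≡⟨ sym (count-not (λ j → ⌊ sees? G S₀ φ a j ⌋)) ⟩
      seen a + count (λ j → not ⌊ sees? G S₀ φ a j ⌋)  <⟨ +-monoʳ-< (seen a) (count-strict _ _ sub i (cong not (⌊⌋-yes (sees? G S₀ φ a i) p)) (⌊⌋-yes (sees? G S₀ φ b i) q)) ⟩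
      seen a + seen b                                  ≡⟨ seen-sum ⟩
      D ∎)
      where
      open ≤-Reasoning
      sub : ∀ j → not ⌊ sees? G S₀ φ a j ⌋ ≡ true → ⌊ sees? G S₀ φ b j ⌋ ≡ true
      sub j e with sees? G S₀ φ b j
      ... | yes _ = refl
      ... | no r = ⊥-elim (not-both (⌊⌋-false (sees? G S₀ φ a j) (not-true e)) r)

    split : ∀ i → (¬ Has a i × Has b i) ⊎ (Has a i × ¬ Has b i)
    split i with sees? G S₀ φ a i | sees? G S₀ φ b i
    ... | yes p | yes q = ⊥-elim (not-neither p q)
    ... | yes p | no q = inj₂ (p , q)
    ... | no p | yes q = inj₁ (p , q)
    ... | no p | no q = ⊥-elim (not-both p q)

    has-a : ∀ {i} → ¬ Has b i → Has a i
    has-a {i} p with split i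
    ... | inj₁ (_ , q) = ⊥-elim (p q)
    ... | inj₂ (q , _) = q

    has-b : ∀ {i} → ¬ Has a i → Has b i
    has-b {i} p with split i
    ... | inj₁ (_ , q) = q
    ... | inj₂ (q , _) = ⊥-elim (p q)

    full : ∀ {v} → v ≢ a → v ≢ b → deg G v ≡ D → ∀ i → Has v i
    full {v} p q d = sees-all v (≤-reflexive (sym (trans (degOn-other p q) d)))

    abstract
      -- The colours missing at b are those seen at a, and there are d(a) - 1 of them.
      someB : 2 ≤ deg G a → ∃ λ j → ¬ Has b j
      someB 2≤ with count-some _ (≤-trans (≤-pred (≤-trans 2≤ (≤-reflexive (sym (degOn-end (joins-ˡ G ab)))))) (degOn≤seen a))
      ... | j , e = j , λ q → not-neither (⌊⌋-true (sees? G S₀ φ a j) e) q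

      twoB : 3 ≤ deg G a → ∀ i → ∃ λ j → ¬ Has b j × j ≢ i
      twoB 3≤ i with count-two _ (≤-trans (≤-pred (≤-trans 3≤ (≤-reflexive (sym (degOn-end (joins-ˡ G ab)))))) (degOn≤seen a)) i
      ... | j , e , j≢i = j , (λ q → not-neither (⌊⌋-true (sees? G S₀ φ a j) e) q) , j≢i

  open Of

  -- `K` lists the colours already arranged. A later exchange of two colours outside `K` destroys
  -- neither the edges of these colours nor their absence at `x`.
  record Preserves (c c′ : Col) (x : Fin n) (K : List (Fin D)) : Set where
    field
      fixes  : ∀ e → S₀ e ≡ true → Incident G a e ⊎ Incident G b e → φ c′ e ≡ φ c e
      keeps  : ∀ e → S₀ e ≡ true → φ c e ∈ K → φ c′ e ≡ φ c e
      misses : ∀ k → k ∈ K → ¬ Has c x k → ¬ Has c′ x k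

    fixes-b : ∀ {i} → ¬ Has c b i → ¬ Has c′ b i
    fixes-b p (e , Se , be , f) = p (e , Se , be , trans (sym (fixes e Se (inj₂ be))) f)

  preserves-refl : ∀ {c x K} → Preserves c c x K
  preserves-refl = record { fixes = λ _ _ _ → refl ; keeps = λ _ _ _ → refl ; misses = λ _ _ p → p }

  -- A chain that starts outside a, b and exchanges a colour missing at a with one missing at b avoids both:
  -- otherwise ab could be coloured.
  record Crossed (c c′ : Col) (x : Fin n) (i j : Fin D) : Set where
    field
      at-x  : ∀ {k} → ¬ Has c x (exchange i j k) → ¬ Has c′ x k
      off   : ∀ e → S₀ e ≡ true → φ c e ≢ i → φ c e ≢ j → φ c′ e ≡ φ c e
      fixed : ∀ e → S₀ e ≡ true → Incident G a e ⊎ Incident G b e → φ c′ e ≡ φ c e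
      -- An edge `f` at a with one of the two colours lies off the chain, hence so does its other
      -- end, and all edges there are fixed too.
      near  : ∀ {w} f e → S₀ f ≡ true → S₀ e ≡ true → Incident G a f → φ c f ≡ i ⊎ φ c f ≡ j →
              Incident G w f → Incident G w e → φ c′ e ≡ φ c e

  abstract
    cross : ∀ c {x i j} → x ≢ a → x ≢ b → ¬ Has c a i → ¬ Has c b j → ¬ Has c x i ⊎ ¬ Has c x j →
            ∃ λ c′ → Crossed c c′ x i j
    cross c {x} {i} {j} x≢a x≢b ai bj xm = c′ , record
      { at-x = λ {k} p h → p (subst (Has c x) (at-in {x} {k} start) (sees⁻ h))
      ; off = λ e Se p q → trans (swapped-at Se (inj₁ refl)) (untouched _ p q)
      ; fixed = λ { e Se (inj₁ ae) → trans (swapped-at Se ae) (outside Ta) ; e Se (inj₂ be) → trans (swapped-at Se be) (outside Tb) }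
      ; near = λ f e Sf Se af col wf we → trans (swapped-at Se we) (outside (trans (same-side Sf col wf af) Ta)) }
      where
      i≢j : i ≢ j
      i≢j refl = not-both c ai bj
      open Kempe G S₀ (φ c) (proper c)
      ch : Chain i j x
      ch = chainFrom i j i≢j x xm
      open Chain ch
      open Swap i j verts closed
      c′ : Col
      c′ = swapped , swapped-proper
      a-end : verts a ≡ true → a ≡ end
      a-end t with a ≟ end
      ... | yes p = p
      ... | no p = ⊥-elim (ai (proj₁ (inner a t (x≢a ∘ sym) p)))
      b-end : verts b ≡ true → b ≡ end
      b-end t with b ≟ end
      ... | yes p = p
      ... | no p = ⊥-elim (bj (proj₂ (inner b t (x≢b ∘ sym) p)))
      at-in : ∀ {w k} → verts w ≡ true → at w k ≡ exchange i j k
      at-in t rewrite t = refl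
      outside : ∀ {w k} → verts w ≡ false → at w k ≡ k
      outside t rewrite t = refl
      untouched : ∀ {k} v → k ≢ i → k ≢ j → at v k ≡ k
      untouched {k = k} v p q with verts v
      ... | true = exchange-other i j p q
      ... | false = refl
      same-side : ∀ {f w w′} → S₀ f ≡ true → φ c f ≡ i ⊎ φ c f ≡ j → Incident G w f → Incident G w′ f → verts w ≡ verts w′
      same-side {f} Sf col (inj₁ refl) (inj₁ refl) = refl
      same-side {f} Sf col (inj₁ refl) (inj₂ refl) = closed f Sf col
      same-side {f} Sf col (inj₂ refl) (inj₁ refl) = sym (closed f Sf col)
      same-side {f} Sf col (inj₂ refl) (inj₂ refl) = refl
      -- Since a misses `i` and b misses `j`, each of them could only be the end of the chain, so
      -- not both are on it. If a alone were on it, the exchange would leave `j` missing at both a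
      -- and b. The same argument with `i` then excludes b.
      Ta : verts a ≡ false
      Ta with verts a in t | verts b in t′
      ... | false | _ = refl
      ... | true | true = ⊥-elim (a≢b (trans (a-end t) (sym (b-end t′))))
      ... | true | false = ⊥-elim (not-both c′ {j}
        (λ h → ai (subst (Has c a) (trans (at-in t) (exchange-ʳ i j)) (sees⁻ h)))
        (λ h → bj (subst (Has c b) (outside t′) (sees⁻ h))))
      Tb : verts b ≡ false
      Tb with verts b in t
      ... | false = refl
      ... | true = ⊥-elim (not-both c′ {i}
        (λ h → ai (subst (Has c a) (outside Ta) (sees⁻ h)))
        (λ h → bj (subst (Has c b) (trans (at-in t) (exchange-ˡ i j)) (sees⁻ h))))

  crossed-preserves : ∀ {c c′ x i j K} → Crossed c c′ x i j → ¬ i ∈ K → ¬ j ∈ K → Preserves c c′ x K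
  crossed-preserves {c} {i = i} {j} cr i∉ j∉ = record
    { fixes = fixed
    ; keeps = λ e Se k∈ → off e Se (λ { refl → i∉ k∈ }) (λ { refl → j∉ k∈ })
    ; misses = λ k k∈ p → at-x (subst (λ z → ¬ Has c _ z) (sym (exchange-other i j (λ { refl → i∉ k∈ }) (λ { refl → j∉ k∈ }))) p) }
    where open Crossed cr

  GainedB : Col → Fin n → List (Fin D) → Set
  GainedB c x K = ∃₂ λ c′ j → ¬ Has c′ b j × ¬ j ∈ K × ¬ Has c′ x j × Preserves c c′ x K

  GainedA : Col → Fin n → List (Fin D) → Fin D → Fin D → Set
  GainedA c x K i j = ∃ λ c′ → ¬ Has c′ x i × Preserves c c′ x K ×
    (∀ {w} f e → S₀ f ≡ true → S₀ e ≡ true → Incident G a f → φ c f ≡ j → Incident G w f → Incident G w e → φ c′ e ≡ φ c e)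

  abstract
    -- The degree bound yields a colour outside `K` missing at x. If it is missing at a rather than
    -- b, crossing it with `j` makes x miss `j`.
    gainB : ∀ c {x} → x ≢ a → x ≢ b → ∀ K j → ¬ Has c b j → ¬ j ∈ K → degOn G S₀ x + length K < D →
            GainedB c x K
    gainB c {x} x≢a x≢b K j bj j∉ room with another c x K room
    ... | i , xi , i∉ with split c i
    ...   | inj₂ (_ , bi) = c , i , bi , i∉ , xi , preserves-refl
    ...   | inj₁ (ai , _) with cross c x≢a x≢b ai bj (inj₁ xi)
    ...     | c′ , cr = c′ , j , Preserves.fixes-b (crossed-preserves {K = K} cr i∉ j∉) bj , j∉ ,
      Crossed.at-x cr (subst (λ z → ¬ Has c x z) (sym (exchange-ʳ i j)) xi) , crossed-preserves cr i∉ j∉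

    -- Trades the colour `j` missed by x for a prescribed colour `i` missing at a. Alternating with
    -- `gainB` makes x miss several prescribed colours. The last component protects edges beyond an
    -- edge of colour `j` at a.
    gainA : ∀ c {x} → x ≢ a → x ≢ b → ∀ K {i j} → ¬ Has c a i → ¬ i ∈ K → ¬ Has c b j → ¬ j ∈ K → ¬ Has c x j →
            GainedA c x K i j
    gainA c {x} x≢a x≢b K {i} {j} ai i∉ bj j∉ xj with cross c x≢a x≢b ai bj (inj₂ xj)
    ... | c′ , cr = c′ , Crossed.at-x cr (subst (λ z → ¬ Has c x z) (sym (exchange-ˡ i j)) xj) , crossed-preserves cr i∉ j∉ ,
      λ f e Sf Se af f≡j → Crossed.near cr f e Sf Se af (inj₂ f≡j)

-- The certified configurations inside a colouring of G - ab

module Apply {n} (G : Multigraph n) (D : ℕ) (unc : ¬ ColourableOn G (allEdges G) D)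
             (a b : Fin n) (e₀ : Fin (m G)) (ab : Joins G e₀ a b) (degs : deg G a + deg G b ≡ D + 2)
             (col : Pair.Col G D unc a b e₀ ab degs) where
  open Pair G D unc a b e₀ ab degs
  open Of col

  apart : ∀ {L} {vs : Vec (Fin n) L} → Distinct vs → ∀ i j → i ≢ j → lookup vs i ≢ lookup vs j
  apart dist i j p e = p (lookup-injective dist i j e)

  open Signatures G {D}

  contradiction : ∀ {L} {vs : Vec (Fin n) L} (distinct : Distinct (a ∷ b ∷ vs)) {cols start} ls tab →
                  certified (zero , suc zero) ls start tab ≡ true → Unique cols →
                  map (At.sig (a ∷ b ∷ vs) S₀ φ) cols ≡ start → All (At.Labelled (a ∷ b ∷ vs) S₀ φ cols) ls → ⊥
  contradiction {vs = vs} distinct {cols} ls tab ok =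
    refute S₀ φ cols (zero , suc zero) ls _ tab ok
      (cut e₀ S₀-e₀ refl (λ e p → S₀-other p) ab (none {S = λ _ → true} λ _ → refl)) proper
    where
    open Sound G D unc (a ∷ b ∷ vs) (lookup-injective distinct)

  A-type B-type : Fin D → Set
  A-type i = ¬ Has a i
  B-type i = ¬ Has b i

  Full : Fin n → Set
  Full v = ∀ i → Has v i

  at-b⇒A : ∀ {f u} → Joins G f b u → S₀ f ≡ true → A-type (φ f)
  at-b⇒A j Sf p = not-neither p (_ , Sf , joins-ˡ G j , refl)

  A≢B : ∀ {i j} → A-type i → B-type j → i ≢ j
  A≢B p q refl = not-both p q

  at-ʳ : ∀ {f u v} → Joins G f u v → S₀ f ≡ true → Has v (φ f)
  at-ʳ j Sf = _ , Sf , joins-ʳ G j , refl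

  no-missing-at-neighbour : ∀ {u f j} → Distinct (a ∷ b ∷ u ∷ []) → Joins G f b u → S₀ f ≡ true →
                            B-type j → ¬ Has u j → ⊥
  no-missing-at-neighbour {u} {f} {j} dist bu Sf bj uj =
    contradiction dist Neighbour.labels Neighbour.table Neighbour.checked
      ((A≢B αa bj ∷ []) ∷ [] ∷ []) (cong₂ _∷_ sigα (cong₂ _∷_ sigj refl)) ((f , bu , inj₂ (here refl , here sigα)) ∷ [])
    where
    open At (a ∷ b ∷ u ∷ [])
    αa = at-b⇒A bu Sf
    sigα : sig S₀ φ (φ f) ≡ bits 1
    sigα = Pointwise-≡⇒≡ (misses-yes αa ∷ misses-no (has-b αa) ∷ misses-no (at-ʳ bu Sf) ∷ [])
    sigj : sig S₀ φ j ≡ bits 6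
    sigj = Pointwise-≡⇒≡ (misses-no (has-a bj) ∷ misses-yes bj ∷ misses-yes uj ∷ [])

  no-missing-at-distance-two : ∀ {u x f g β₁ β₂} → Distinct (a ∷ b ∷ u ∷ x ∷ []) →
    Joins G f b u → S₀ f ≡ true → Joins G g u x → S₀ g ≡ true → Full u →
    B-type β₁ → B-type β₂ → β₁ ≢ β₂ → ¬ Has x (φ f) → ⊥
  no-missing-at-distance-two {u} {x} {f} {g} {β₁} {β₂} dist bu Sf ux Sg ufull b₁ b₂ β₁≢β₂ xα =
    by-cases (sees? G S₀ φ x β₁) (sees? G S₀ φ x β₂)
    where
    open At (a ∷ b ∷ u ∷ x ∷ [])
    αa = at-b⇒A bu Sf
    sigα : sig S₀ φ (φ f) ≡ bits 9
    sigα = Pointwise-≡⇒≡ (misses-yes αa ∷ misses-no (has-b αa) ∷ misses-no (ufull _) ∷ misses-yes xα ∷ [])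
    sig-b : ∀ {β} → B-type β → Has x β → sig S₀ φ β ≡ bits 2
    sig-b p q = Pointwise-≡⇒≡ (misses-no (has-a p) ∷ misses-yes p ∷ misses-no (ufull _) ∷ misses-no q ∷ [])
    sig-bx : ∀ {β} → B-type β → ¬ Has x β → sig S₀ φ β ≡ bits 10
    sig-bx p q = Pointwise-≡⇒≡ (misses-no (has-a p) ∷ misses-yes p ∷ misses-no (ufull _) ∷ misses-yes q ∷ [])
    at-ux : sig S₀ φ (φ g) ∈ bits 1 ∷ bits 2 ∷ []
    at-ux with split (φ g)
    ... | inj₁ (p , q) = here (Pointwise-≡⇒≡ (misses-yes p ∷ misses-no q ∷ misses-no (ufull _) ∷ misses-no (at-ʳ ux Sg) ∷ []))
    ... | inj₂ (p , q) = there (here (Pointwise-≡⇒≡ (misses-no p ∷ misses-yes q ∷ misses-no (ufull _) ∷ misses-no (at-ʳ ux Sg) ∷ [])))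
    labelled : ∀ {β₁ β₂} → All (Labelled S₀ φ (φ f ∷ β₁ ∷ β₂ ∷ [])) Distance2.labels
    labelled = (f , bu , inj₂ (here refl , here sigα)) ∷ (g , ux , inj₁ at-ux) ∷ []
    by-cases : Dec (Has x β₁) → Dec (Has x β₂) → ⊥
    by-cases (yes p) (yes q) = contradiction dist Distance2.labels Distance2.table Distance2.checked₀
      ((A≢B αa b₁ ∷ A≢B αa b₂ ∷ []) ∷ (β₁≢β₂ ∷ []) ∷ [] ∷ []) (cong₂ _∷_ sigα (cong₂ _∷_ (sig-b b₁ p) (cong₂ _∷_ (sig-b b₂ q) refl))) labelled
    by-cases (yes p) (no q) = contradiction dist Distance2.labels Distance2.table Distance2.checked₁
      ((A≢B αa b₁ ∷ A≢B αa b₂ ∷ []) ∷ (β₁≢β₂ ∷ []) ∷ [] ∷ []) (cong₂ _∷_ sigα (cong₂ _∷_ (sig-b b₁ p) (cong₂ _∷_ (sig-bx b₂ q) refl))) labelled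
    by-cases (no p) (yes q) = contradiction dist Distance2.labels Distance2.table Distance2.checked₁
      ((A≢B αa b₂ ∷ A≢B αa b₁ ∷ []) ∷ (β₁≢β₂ ∘ sym ∷ []) ∷ [] ∷ []) (cong₂ _∷_ sigα (cong₂ _∷_ (sig-b b₂ q) (cong₂ _∷_ (sig-bx b₁ p) refl))) labelled
    by-cases (no p) (no q) = contradiction dist Distance2.labels Distance2.table Distance2.checked₂
      ((A≢B αa b₁ ∷ A≢B αa b₂ ∷ []) ∷ (β₁≢β₂ ∷ []) ∷ [] ∷ []) (cong₂ _∷_ sigα (cong₂ _∷_ (sig-bx b₁ p) (cong₂ _∷_ (sig-bx b₂ q) refl))) labelled

  no-two-missing-at-distance-two : ∀ {u x f g β} → Distinct (a ∷ b ∷ u ∷ x ∷ []) →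
    Joins G f b u → S₀ f ≡ true → Joins G g u x → S₀ g ≡ true → Full u →
    B-type β → (∀ j → B-type j → j ≡ β) → ¬ Has x (φ f) → ¬ Has x β → ⊥
  no-two-missing-at-distance-two {u} {x} {f} {g} {β} dist bu Sf ux Sg ufull bβ only xα xβ =
    contradiction dist Distance2′.labels Distance2′.table Distance2′.checked
      ((A≢B αa bβ ∷ []) ∷ [] ∷ []) (cong₂ _∷_ sigα (cong₂ _∷_ sigβ refl))
      ((f , bu , inj₂ (here refl , here sigα)) ∷ (g , ux , inj₁ at-ux) ∷ [])
    where
    open At (a ∷ b ∷ u ∷ x ∷ [])
    αa = at-b⇒A bu Sf
    sigα : sig S₀ φ (φ f) ≡ bits 9
    sigα = Pointwise-≡⇒≡ (misses-yes αa ∷ misses-no (has-b αa) ∷ misses-no (ufull _) ∷ misses-yes xα ∷ [])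
    sigβ : sig S₀ φ β ≡ bits 10
    sigβ = Pointwise-≡⇒≡ (misses-no (has-a bβ) ∷ misses-yes bβ ∷ misses-no (ufull _) ∷ misses-yes xβ ∷ [])
    at-ux : sig S₀ φ (φ g) ∈ bits 1 ∷ []
    at-ux with split (φ g)
    ... | inj₁ (p , q) = here (Pointwise-≡⇒≡ (misses-yes p ∷ misses-no q ∷ misses-no (ufull _) ∷ misses-no (at-ʳ ux Sg) ∷ []))
    ... | inj₂ (p , q) = ⊥-elim (xβ (subst (Has x) (only _ q) (at-ʳ ux Sg)))

  no-missing-at-distance-three : ∀ {u y x f g h β₁ β₂} → Distinct (a ∷ b ∷ u ∷ y ∷ x ∷ []) →
    Joins G f b u → S₀ f ≡ true → Joins G g u y → Joins G h y x → S₀ h ≡ true → Full u → Full y →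
    B-type β₁ → B-type β₂ → β₁ ≢ β₂ → ¬ Has x (φ f) → ¬ Has x β₁ → ¬ Has x β₂ → ⊥
  no-missing-at-distance-three {u} {y} {x} {f} {g} {h} {β₁} {β₂} dist bu Sf uy yx Sh ufull yfull b₁ b₂ β₁≢β₂ xα x₁ x₂ =
    contradiction dist Distance3.labels Distance3.table Distance3.checked
      ((A≢B αa b₁ ∷ A≢B αa b₂ ∷ []) ∷ (β₁≢β₂ ∷ []) ∷ [] ∷ [])
      (cong₂ _∷_ sigα (cong₂ _∷_ (type-b b₁ (misses-yes x₁)) (cong₂ _∷_ (type-b b₂ (misses-yes x₂)) refl)))
      ((f , bu , inj₂ (here refl , here sigα)) ∷ (g , uy , inj₁ at-uy) ∷ (h , yx , inj₁ at-yx) ∷ [])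
    where
    open At (a ∷ b ∷ u ∷ y ∷ x ∷ [])
    αa = at-b⇒A bu Sf
    type-a : ∀ {i t} → A-type i → misses S₀ φ x i ≡ t → sig S₀ φ i ≡ true ∷ false ∷ false ∷ false ∷ t ∷ []
    type-a p q = Pointwise-≡⇒≡ (misses-yes p ∷ misses-no (has-b p) ∷ misses-no (ufull _) ∷ misses-no (yfull _) ∷ q ∷ [])
    type-b : ∀ {i t} → B-type i → misses S₀ φ x i ≡ t → sig S₀ φ i ≡ false ∷ true ∷ false ∷ false ∷ t ∷ []
    type-b p q = Pointwise-≡⇒≡ (misses-no (has-a p) ∷ misses-yes p ∷ misses-no (ufull _) ∷ misses-no (yfull _) ∷ q ∷ [])
    sigα : sig S₀ φ (φ f) ≡ bits 17
    sigα = type-a αa (misses-yes xα)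
    at-uy : sig S₀ φ (φ g) ∈ bits 1 ∷ bits 2 ∷ bits 17 ∷ bits 18 ∷ []
    at-uy = by-cases (split (φ g)) (sees? G S₀ φ x (φ g))
      where
      by-cases : _ → Dec (Has x (φ g)) → sig S₀ φ (φ g) ∈ bits 1 ∷ bits 2 ∷ bits 17 ∷ bits 18 ∷ []
      by-cases (inj₁ (p , _)) (yes q) = here (type-a p (misses-no q))
      by-cases (inj₂ (_ , p)) (yes q) = there (here (type-b p (misses-no q)))
      by-cases (inj₁ (p , _)) (no q) = there (there (here (type-a p (misses-yes q))))
      by-cases (inj₂ (_ , p)) (no q) = there (there (there (here (type-b p (misses-yes q)))))
    at-yx : sig S₀ φ (φ h) ∈ bits 1 ∷ bits 2 ∷ []
    at-yx with split (φ h)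
    ... | inj₁ (p , _) = here (type-a p (misses-no (at-ʳ yx Sh)))
    ... | inj₂ (_ , p) = there (here (type-b p (misses-no (at-ʳ yx Sh))))

  -- The situation d(a) = 2: every colour other than β is missing at a, and β is the colour of the
  -- edge from a to c.
  module SingleB {β} (bβ : B-type β) (only : ∀ j → B-type j → j ≡ β) where

    ≢β⇒A : ∀ {i} → i ≢ β → A-type i
    ≢β⇒A {i} p with split i
    ... | inj₁ (q , _) = q
    ... | inj₂ (_ , q) = ⊥-elim (p (only i q))

    at-a : ∀ {f c} → Joins G f a c → S₀ f ≡ true → φ f ≡ β
    at-a j Sf = only _ λ p → not-neither (_ , Sf , joins-ˡ G j , refl) p

    missed : ∀ {v i} → ¬ Has v β → Has v i → i ≢ β
    missed p q refl = p q

    -- An exchange can put β at x, but the single colour μ missed by y stays arbitrary. If μ differs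
    -- from β, the edges bu, cu and ux may carry μ and uy may carry β, so the two cases have
    -- separate certificates.
    no-kite : ∀ {c u x y k f f′ g h μ} → Distinct (a ∷ b ∷ c ∷ u ∷ x ∷ y ∷ []) →
      Joins G k a c → S₀ k ≡ true → Joins G f b u → S₀ f ≡ true → Joins G f′ c u → S₀ f′ ≡ true →
      Joins G g u x → S₀ g ≡ true → Joins G h u y → S₀ h ≡ true → Full c → Full u →
      ¬ Has x β → (∀ i → ¬ Has x i → i ≡ β) → ¬ Has y μ → (∀ i → ¬ Has y i → i ≡ μ) → ⊥
    no-kite {c} {u} {x} {y} {k} {f} {f′} {g} {h} {μ} dist ac Sk bu Sf cu Sf′ ux Sg uy Sh cfull ufull xβ x-only yμ y-only =
      by-cases (μ ≟ β)
      where
      open At (a ∷ b ∷ c ∷ u ∷ x ∷ y ∷ [])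
      kβ = at-a ac Sk
      f≢β = missed bβ (_ , Sf , joins-ˡ G bu , refl)
      g≢β = missed xβ (at-ʳ ux Sg)
      f′≢β : φ f′ ≢ β
      f′≢β p = proper f′ k f′≢k Sf′ Sk c (joins-ˡ G cu) (joins-ʳ G ac) (trans p (sym kβ))
        where
        f′≢k : f′ ≢ k
        f′≢k refl = [ apart dist (# 3) (# 0) (λ ()) , apart dist (# 3) (# 2) (λ ()) ]′ (joins-only G ac (joins-ʳ G cu))
      x-sees : ∀ {i} → i ≢ β → Has x i
      x-sees {i} p with sees? G S₀ φ x i
      ... | yes q = q
      ... | no q = ⊥-elim (p (x-only i q))
      y-sees : ∀ {i} → i ≢ μ → Has y i
      y-sees {i} p with sees? G S₀ φ y i
      ... | yes q = q
      ... | no q = ⊥-elim (p (y-only i q))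
      typeA : ∀ {i t} → i ≢ β → misses S₀ φ y i ≡ t → sig S₀ φ i ≡ true ∷ false ∷ false ∷ false ∷ false ∷ t ∷ []
      typeA p q = Pointwise-≡⇒≡ (misses-yes (≢β⇒A p) ∷ misses-no (has-b (≢β⇒A p)) ∷ misses-no (cfull _) ∷ misses-no (ufull _) ∷ misses-no (x-sees p) ∷ q ∷ [])
      typeB : ∀ {t} → misses S₀ φ y β ≡ t → sig S₀ φ β ≡ false ∷ true ∷ false ∷ false ∷ true ∷ t ∷ []
      typeB q = Pointwise-≡⇒≡ (misses-no (has-a bβ) ∷ misses-yes bβ ∷ misses-no (cfull _) ∷ misses-no (ufull _) ∷ misses-yes xβ ∷ q ∷ [])
      by-cases : Dec (μ ≡ β) → ⊥
      by-cases (yes refl) = contradiction dist Kite₁.labels Kite₁.table Kite₁.checked ([] ∷ []) (cong₂ _∷_ (typeB (misses-yes yμ)) refl)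
        ((k , ac , inj₂ (here kβ , here (trans (cong (sig S₀ φ) kβ) (typeB (misses-yes yμ))))) ∷
         (f , bu , inj₁ (here (plain f≢β))) ∷ (f′ , cu , inj₁ (here (plain f′≢β))) ∷
         (g , ux , inj₁ (here (plain g≢β))) ∷ (h , uy , inj₁ (here (plain (missed yμ (at-ʳ uy Sh))))) ∷ [])
        where
        plain : ∀ {i} → i ≢ μ → sig S₀ φ i ≡ bits 1
        plain p = typeA p (misses-no (y-sees p))
      by-cases (no μ≢β) = contradiction dist Kite₂.labels Kite₂.table Kite₂.checked ((μ≢β ∘ sym ∷ []) ∷ [] ∷ [])
        (cong₂ _∷_ sigβ (cong₂ _∷_ (typeA μ≢β (misses-yes yμ)) refl))
        ((k , ac , inj₂ (here kβ , here (trans (cong (sig S₀ φ) kβ) sigβ))) ∷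
         (f , bu , other f≢β) ∷ (f′ , cu , other f′≢β) ∷ (g , ux , other g≢β) ∷ (h , uy , at-uy) ∷ [])
        where
        sigβ : sig S₀ φ β ≡ bits 18
        sigβ = typeB (misses-no (y-sees (μ≢β ∘ sym)))
        other : ∀ {i} → i ≢ β → sig S₀ φ i ∈ bits 1 ∷ [] ⊎ (i ∈ β ∷ μ ∷ [] × sig S₀ φ i ∈ bits 33 ∷ [])
        other {i} p with i ≟ μ
        ... | yes refl = inj₂ (there (here refl) , here (typeA p (misses-yes yμ)))
        ... | no q = inj₁ (here (typeA p (misses-no (y-sees q))))
        at-uy : sig S₀ φ (φ h) ∈ bits 1 ∷ [] ⊎ (φ h ∈ β ∷ μ ∷ [] × sig S₀ φ (φ h) ∈ bits 18 ∷ [])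
        at-uy with φ h ≟ β
        ... | yes p = inj₂ (here p , here (trans (cong (sig S₀ φ) p) sigβ))
        ... | no p = inj₁ (here (typeA p (misses-no (at-ʳ uy Sh))))

    no-far-vertex : ∀ {c u y z x k f f′ g g′ h h′} → Distinct (a ∷ b ∷ c ∷ u ∷ y ∷ z ∷ x ∷ []) →
      Joins G k a c → S₀ k ≡ true → Joins G f b u → S₀ f ≡ true → Joins G f′ c u → S₀ f′ ≡ true →
      Joins G g u y → S₀ g ≡ true → Joins G g′ u z → S₀ g′ ≡ true → Joins G h y x → S₀ h ≡ true → Joins G h′ z x → S₀ h′ ≡ true →
      Full c → Full u → Full y → Full z →
      ¬ Has x β → ¬ Has x (φ f) → ¬ Has x (φ f′) → ¬ Has x (φ g) → φ g ≢ β → φ g′ ≢ β → ⊥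
    no-far-vertex {c} {u} {y} {z} {x} {k} {f} {f′} {g} {g′} {h} {h′} dist ac Sk bu Sf cu Sf′ uy Sg uz Sg′ yx Sh zx Sh′
                  cfull ufull yfull zfull xβ xf xf′ xg g≢β g′≢β =
      contradiction dist Far.labels Far.table Far.checked ([] ∷ []) (cong₂ _∷_ sigβ refl)
        ((k , ac , inj₂ (here kβ , here (trans (cong (sig S₀ φ) kβ) sigβ))) ∷
         (f , bu , inj₁ (here (typeA (missed bβ (_ , Sf , joins-ˡ G bu , refl)) (misses-yes xf)))) ∷
         (f′ , cu , inj₁ (here (typeA f′≢β (misses-yes xf′)))) ∷
         (g , uy , inj₁ (here (typeA g≢β (misses-yes xg)))) ∷ (g′ , uz , inj₁ at-uz) ∷
         (h , yx , inj₁ (here (typeA (missed xβ (at-ʳ yx Sh)) (misses-no (at-ʳ yx Sh))))) ∷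
         (h′ , zx , inj₁ (here (typeA (missed xβ (at-ʳ zx Sh′)) (misses-no (at-ʳ zx Sh′))))) ∷ [])
      where
      open At (a ∷ b ∷ c ∷ u ∷ y ∷ z ∷ x ∷ [])
      kβ = at-a ac Sk
      f′≢β : φ f′ ≢ β
      f′≢β p = proper f′ k f′≢k Sf′ Sk c (joins-ˡ G cu) (joins-ʳ G ac) (trans p (sym kβ))
        where
        f′≢k : f′ ≢ k
        f′≢k refl = [ apart dist (# 3) (# 0) (λ ()) , apart dist (# 3) (# 2) (λ ()) ]′ (joins-only G ac (joins-ʳ G cu))
      typeA : ∀ {i t} → i ≢ β → misses S₀ φ x i ≡ t → sig S₀ φ i ≡ true ∷ false ∷ false ∷ false ∷ false ∷ false ∷ t ∷ []
      typeA p q = Pointwise-≡⇒≡ (misses-yes (≢β⇒A p) ∷ misses-no (has-b (≢β⇒A p)) ∷ misses-no (cfull _) ∷ misses-no (ufull _) ∷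
                                  misses-no (yfull _) ∷ misses-no (zfull _) ∷ q ∷ [])
      sigβ : sig S₀ φ β ≡ bits 66
      sigβ = Pointwise-≡⇒≡ (misses-no (has-a bβ) ∷ misses-yes bβ ∷ misses-no (cfull _) ∷ misses-no (ufull _) ∷
                            misses-no (yfull _) ∷ misses-no (zfull _) ∷ misses-yes xβ ∷ [])
      at-uz : sig S₀ φ (φ g′) ∈ bits 1 ∷ bits 65 ∷ []
      at-uz = by-cases (sees? G S₀ φ x (φ g′))
        where
        by-cases : Dec (Has x (φ g′)) → sig S₀ φ (φ g′) ∈ bits 1 ∷ bits 65 ∷ []
        by-cases (yes p) = here (typeA g′≢β (misses-no p))
        by-cases (no p) = there (here (typeA g′≢β (misses-yes p)))

-- Critical graphs

-- If D ≤ d + 2, then weights 6, 6, 3 and 2 on this inequality, `hd`, `hb` and `hn` eliminate all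
-- other terms and leave D ≤ 0. The bound `hb` on b comes from d(a) ≤ d(b).
far-room : ∀ {n D d b} → 3 * n ≤ 4 * D + 3 → 1 ≤ D → D + 2 ≤ b + b → d + b + 2 ≤ n → d + 3 ≤ D
far-room {n} {D} {d} {b} hn hD hb hd with ≤-<-connex (d + 3) D
... | inj₁ p = p
... | inj₂ p = ⊥-elim (<⇒≱ hD (+-cancelˡ-≤ (8 * D + 6 * d + 6 * b + 18) D 0 (begin
  (8 * D + 6 * d + 6 * b + 18) + D                        ≡⟨ lhs D d b ⟩
  6 * D + 6 * (d + b + 2) + 3 * (D + 2)                   ≤⟨ +-mono-≤ (+-mono-≤ (*-monoʳ-≤ 6 D≤) (*-monoʳ-≤ 6 hd)) (*-monoʳ-≤ 3 hb) ⟩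
  6 * (d + 2) + 6 * n + 3 * (b + b)                       ≡⟨ cong (λ t → 6 * (d + 2) + t + 3 * (b + b)) (six n) ⟩
  6 * (d + 2) + 2 * (3 * n) + 3 * (b + b)                 ≤⟨ +-monoˡ-≤ (3 * (b + b)) (+-monoʳ-≤ (6 * (d + 2)) (*-monoʳ-≤ 2 hn)) ⟩
  6 * (d + 2) + 2 * (4 * D + 3) + 3 * (b + b)             ≡⟨ rhs D d b ⟩
  (8 * D + 6 * d + 6 * b + 18) + 0                        ∎)))
  where
  open ≤-Reasoning
  open +-*-Solver
  D≤ : D ≤ d + 2
  D≤ = ≤-pred (≤-trans p (≤-reflexive (+-suc d 2)))
  lhs : ∀ D d b → (8 * D + 6 * d + 6 * b + 18) + D ≡ 6 * D + 6 * (d + b + 2) + 3 * (D + 2)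
  lhs = solve 3 (λ D d b → (con 8 :* D :+ con 6 :* d :+ con 6 :* b :+ con 18) :+ D :=
    con 6 :* D :+ con 6 :* (d :+ b :+ con 2) :+ con 3 :* (D :+ con 2)) refl
  six : ∀ n → 6 * n ≡ 2 * (3 * n)
  six = solve 1 (λ n → con 6 :* n := con 2 :* (con 3 :* n)) refl
  rhs : ∀ D d b → 6 * (d + 2) + 2 * (4 * D + 3) + 3 * (b + b) ≡ (8 * D + 6 * d + 6 * b + 18) + 0
  rhs = solve 3 (λ D d b → con 6 :* (d :+ con 2) :+ con 2 :* (con 4 :* D :+ con 3) :+ con 3 :* (b :+ b) :=
    (con 8 :* D :+ con 6 :* d :+ con 6 :* b :+ con 18) :+ con 0) refl

count-drop : ∀ {k} (f g : Fin k → Bool) → (∀ {x y} → f x ≡ true → f y ≡ true → g x ≡ false → g y ≡ false → x ≡ y) →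
             count f ≤ suc (count (λ x → f x ∧ g x))
count-drop f g unique = begin
  count f                                                   ≡⟨ count-sum-of f (λ x → f x ∧ not (g x)) (λ x → f x ∧ g x) split ⟩
  count (λ x → f x ∧ not (g x)) + count (λ x → f x ∧ g x)   ≤⟨ +-monoˡ-≤ _ (count-inject (λ x → f x ∧ not (g x)) (λ (_ : Fin 1) → true) (λ _ _ → Fin 1)
                                                                 (λ _ _ → zero , refl , zero) (λ p q _ _ → let fx , gx = ∧-true p ; fy , gy = ∧-true q in unique fx fy (not-true gx) (not-true gy))) ⟩
  suc (count (λ x → f x ∧ g x))                             ∎
  where
  open ≤-Reasoning
  split : ∀ x → ind (f x) ≡ ind (f x ∧ not (g x)) + ind (f x ∧ g x)
  split x with f x | g x
  ... | false | _ = refl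
  ... | true | true = refl
  ... | true | false = refl

-- The counterpart of `far-room` for b of degree D, where a far vertex has degree below a third of
-- D.
far-room′ : ∀ {n D d} → 3 * n ≤ 4 * D + 3 → d + D + 2 ≤ n → 3 * d + 3 ≤ D
far-room′ {n} {D} {d} hn hd = +-cancelˡ-≤ (3 * D + 3) _ D (begin
  (3 * D + 3) + (3 * d + 3)     ≡⟨ lhs D d ⟩
  3 * (d + D + 2)               ≤⟨ *-monoʳ-≤ 3 hd ⟩
  3 * n                         ≤⟨ hn ⟩
  4 * D + 3                     ≡⟨ rhs D ⟩
  (3 * D + 3) + D               ∎)
  where
  open ≤-Reasoning
  open +-*-Solver
  lhs : ∀ D d → (3 * D + 3) + (3 * d + 3) ≡ 3 * (d + D + 2)
  lhs = solve 2 (λ D d → (con 3 :* D :+ con 3) :+ (con 3 :* d :+ con 3) := con 3 :* (d :+ D :+ con 2)) refl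
  rhs : ∀ D → 4 * D + 3 ≡ (3 * D + 3) + D
  rhs = solve 1 (λ D → con 4 :* D :+ con 3 := (con 3 :* D :+ con 3) :+ D) refl

module Simple {n} (G : Multigraph n) (simple : IsSimple G) where

  incident-joins : ∀ {v e} → Incident G v e → ∃ λ w → Joins G e v w
  incident-joins (inj₁ refl) = _ , inj₁ (refl , refl)
  incident-joins (inj₂ refl) = _ , inj₂ (refl , refl)

  joins-unique : ∀ {e f u v} → Joins G e u v → Joins G f u v → e ≡ f
  joins-unique {e} {f} p q with e ≟ f
  ... | yes r = r
  ... | no r = ⊥-elim (simple e f r (same p q))
    where
    same : ∀ {u v} → Joins G e u v → Joins G f u v → SameEnds (ends G e) (ends G f)
    same (inj₁ (p , q)) (inj₁ (r , s)) = inj₁ (trans p (sym r) , trans q (sym s))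
    same (inj₁ (p , q)) (inj₂ (r , s)) = inj₂ (trans p (sym s) , trans q (sym r))
    same (inj₂ (p , q)) (inj₁ (r , s)) = inj₂ (trans p (sym s) , trans q (sym r))
    same (inj₂ (p , q)) (inj₂ (r , s)) = inj₁ (trans p (sym r) , trans q (sym s))

  joins-determined : ∀ {e u v w} → Joins G e u v → Joins G e u w → v ≡ w
  joins-determined p q with joins-only G q (joins-ʳ G p)
  ... | inj₂ r = r
  ... | inj₁ r = ⊥-elim (joins-≢ G p (sym r))

two≤ : ∀ {x y D} → x + y ≡ D + 2 → y ≤ D → 2 ≤ x
two≤ {x} {y} {D} e y≤D = +-cancelʳ-≤ D 2 x (≤-trans (≤-reflexive (trans (+-comm 2 D) (sym e))) (+-monoʳ-≤ x y≤D))

module Critical {n} (G : Multigraph n) (simple : IsSimple G) (D : ℕ) (deg≤ : ∀ v → deg G v ≤ D)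
                (unc : ¬ ColourableOn G (allEdges G) D) (del : ∀ e → ColourableOn G (λ f → not ⌊ f ≟ e ⌋) D)
                (edgeAt : ∀ v → ∃ (Incident G v)) where

  open Simple G simple public

  joins? : ∀ e u v → Dec (Joins G e u v)
  joins? e u v = ((proj₁ (ends G e) ≟ u) ×-dec (proj₂ (ends G e) ≟ v)) ⊎-dec ((proj₁ (ends G e) ≟ v) ×-dec (proj₂ (ends G e) ≟ u))

  adj? : ∀ u v → Dec (Adjacent G u v)
  adj? u v = any? λ e → joins? e u v

  adj : Fin n → Fin n → Bool
  adj u v = ⌊ adj? u v ⌋

  adj-sym : ∀ {u v} → Adjacent G u v → Adjacent G v u
  adj-sym (e , j) = e , joins-sym G j

  adj-≢ : ∀ {u v} → Adjacent G u v → u ≢ v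
  adj-≢ (e , j) = joins-≢ G j

  deg≤adj : ∀ u → deg G u ≤ count (adj u)
  deg≤adj u = count-inject (incB G u) (adj u) (λ e w → Joins G e u w)
    (λ e p → let w , j = incident-joins (true-incident G p) in w , ⌊⌋-yes (adj? u w) (e , j) , j)
    (λ _ _ → joins-unique)

  full-or-not : ∀ v → deg G v ≡ D ⊎ deg G v < D
  full-or-not v with m≤n⇒m<n∨m≡n (deg≤ v)
  ... | inj₁ p = inj₂ p
  ... | inj₂ p = inj₁ p

  -- In a colouring of G - e no colour is missing at both ends of e, so their remaining degrees add
  -- up to at least D. A full-deficiency pair attains this bound.
  edge-sum : ∀ {e x y} → Joins G e x y → D + 2 ≤ deg G x + deg G y
  edge-sum {e} {x} {y} j with any? (λ i → ¬? (sees? G S₀ φ x i) ×-dec ¬? (sees? G S₀ φ y i))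
    where
    open Deleted G D unc x y e j
    open Colouring (del e)
  ... | yes (i , p , q) = ⊥-elim (Deleted.Colouring.not-both G D unc x y e j (del e) p q)
  ... | no none = begin
    D + 2                                          ≡⟨ +-comm D 2 ⟩
    2 + D                                          ≡⟨ cong (2 +_) (sym (count-not (λ i → ⌊ sees? G S₀ φ x i ⌋))) ⟩
    2 + (seen x + count (λ i → not ⌊ sees? G S₀ φ x i ⌋)) ≤⟨ +-monoʳ-≤ 2 (+-monoʳ-≤ (seen x) (count-mono (λ i → not ⌊ sees? G S₀ φ x i ⌋) (λ i → ⌊ sees? G S₀ φ y i ⌋) cover)) ⟩
    2 + (seen x + seen y)                          ≤⟨ +-monoʳ-≤ 2 (+-mono-≤ (seen≤degOn x) (seen≤degOn y)) ⟩
    2 + (degOn G S₀ x + degOn G S₀ y)              ≡⟨ cong suc (sym (+-suc _ _)) ⟩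
    suc (degOn G S₀ x) + suc (degOn G S₀ y)        ≡⟨ cong₂ _+_ (degOn-end (joins-ˡ G j)) (degOn-end (joins-ʳ G j)) ⟩
    deg G x + deg G y                              ∎
    where
    open ≤-Reasoning
    open Deleted G D unc x y e j
    open Colouring (del e)
    cover : ∀ i → not ⌊ sees? G S₀ φ x i ⌋ ≡ true → ⌊ sees? G S₀ φ y i ⌋ ≡ true
    cover i p with sees? G S₀ φ y i
    ... | yes _ = refl
    ... | no q = ⊥-elim (none (i , ⌊⌋-false (sees? G S₀ φ x i) (not-true p) , q))

  -- Otherwise colourings of the two sides could be combined.
  connected : ∀ (P : Fin n → Bool) {u v} → P u ≡ true → P v ≡ false → ∃₂ λ x y → P x ≡ true × P y ≡ false × Adjacent G x y
  connected P {u} {v} Pu Pv with any? (λ e → ¬? (P (proj₁ (ends G e)) ≟ᵇ P (proj₂ (ends G e))))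
  ... | yes (e , p) with P (proj₁ (ends G e)) in p₁ | P (proj₂ (ends G e)) in p₂
  ...   | true | true = ⊥-elim (p refl)
  ...   | false | false = ⊥-elim (p refl)
  ...   | true | false = _ , _ , p₁ , p₂ , e , inj₁ (refl , refl)
  ...   | false | true = _ , _ , p₂ , p₁ , e , inj₂ (refl , refl)
  connected P {u} {v} Pu Pv | no none = ⊥-elim (unc (χ , proper))
    where
    side : ∀ {e x} → Incident G x e → P x ≡ P (proj₁ (ends G e))
    side {e} (inj₁ refl) = refl
    side {e} (inj₂ refl) with P (proj₁ (ends G e)) ≟ᵇ P (proj₂ (ends G e))
    ... | yes p = sym p
    ... | no p = ⊥-elim (none (e , p))
    eᵤ = proj₁ (edgeAt u)
    eᵥ = proj₁ (edgeAt v)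
    χ : Fin (m G) → Fin D
    -- The deleted edge at `v` lies on the other side, so its colouring is complete on the side of
    -- `u`, and conversely.
    χ e = if P (proj₁ (ends G e)) then proj₁ (del eᵥ) e else proj₁ (del eᵤ) e
    kept : ∀ {e f} → e ≢ f → not ⌊ e ≟ f ⌋ ≡ true
    kept {e} {f} p rewrite ⌊⌋-no (e ≟ f) p = refl
    ≢v : ∀ {e} → P (proj₁ (ends G e)) ≡ true → e ≢ eᵥ
    ≢v p refl with trans (sym p) (trans (sym (side (proj₂ (edgeAt v)))) Pv)
    ... | ()
    ≢u : ∀ {e} → P (proj₁ (ends G e)) ≡ false → e ≢ eᵤ
    ≢u p refl with trans (sym p) (trans (sym (side (proj₂ (edgeAt u)))) Pu)
    ... | ()
    proper : ProperColouringOn G (allEdges G) D χ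
    proper e f e≢f _ _ x xe xf eq with P (proj₁ (ends G e)) in p | P (proj₁ (ends G f)) in q
    ... | true | true = proj₂ (del eᵥ) e f e≢f (kept (≢v p)) (kept (≢v q)) x xe xf eq
    ... | false | false = proj₂ (del eᵤ) e f e≢f (kept (≢u p)) (kept (≢u q)) x xe xf eq
    ... | true | false with trans (sym p) (trans (sym (side xe)) (trans (side xf) q))
    ...   | ()
    proper e f e≢f _ _ x xe xf eq | false | true with trans (sym p) (trans (sym (side xe)) (trans (side xf) q))
    ...   | ()

  -- Degrees near the pair, without density

  module AtPair (a b : Fin n) (e₀ : Fin (m G)) (ab : Joins G e₀ a b) (degs : deg G a + deg G b ≡ D + 2) where
    open Pair G D unc a b e₀ ab degs
    open Of

    c₀ : Col
    c₀ = del e₀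

    2≤a : 2 ≤ deg G a
    2≤a = two≤ degs (deg≤ b)

    room : ∀ {x} k → deg G x + k < D → degOn G S₀ x + k < D
    room {x} k = ≤-trans (s≤s (+-monoˡ-≤ k (degOn-≤ x)))

    room₀ : ∀ {x} → deg G x < D → degOn G S₀ x + 0 < D
    room₀ {x} x<D = room {x} 0 (≤-trans (≤-reflexive (cong suc (+-identityʳ _))) x<D)

    module _ {f u} (bu : Joins G f b u) (Sf : S₀ f ≡ true) where

      be : Incident G b f
      be = joins-ˡ G bu

      A-type : ∀ c → ¬ Has c a (φ c f)
      A-type c p = not-neither c p (f , Sf , be , refl)

      A≢ : ∀ c {j} → ¬ Has c b j → ¬ j ∈ φ c f ∷ []
      A≢ c bj (here refl) = bj (f , Sf , be , refl)

      -- First x is made to miss some colour missing at b, then that one is traded for the colour of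
      -- `f`. Exchanges fix the edges at b, so this colour itself stays the same.
      gain-α : ∀ c {x} → x ≢ a → x ≢ b → deg G x < D → ∃ λ c′ → ¬ Has c′ x (φ c′ f)
      gain-α c {x} x≢a x≢b x<D = first (someB c 2≤a)
        where
        last : ∀ {c₁ j} → ¬ Has c₁ b j → ¬ Has c₁ x j → ∃ λ c′ → ¬ Has c′ x (φ c′ f)
        last {c₁} bj xj with gainA c₁ x≢a x≢b [] {φ c₁ f} (A-type c₁) (λ ()) bj (λ ()) xj
        ... | c₂ , xα , pr , _ = c₂ , subst (λ i → ¬ Has c₂ x i) (sym (Preserves.fixes pr f Sf (inj₂ be))) xα
        first : ∃ (λ j → ¬ Has c b j) → ∃ λ c′ → ¬ Has c′ x (φ c′ f)
        first (j , bj) with gainB c x≢a x≢b [] j bj (λ ()) (room₀ x<D)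
        ... | c₁ , _ , bk , _ , xk , _ = last {c₁} bk xk

      keep-α : ∀ {c c′ x K} → Preserves c c′ x K → φ c f ∈ K → ¬ Has c x (φ c f) → ¬ Has c′ x (φ c′ f)
      keep-α {c} {c′} {x} pr i∈ xα =
        subst (λ i → ¬ Has c′ x i) (sym (Preserves.fixes pr f Sf (inj₂ be))) (Preserves.misses pr _ i∈ xα)

      gain-β : ∀ c {x} → x ≢ a → x ≢ b → deg G x + 1 < D → ¬ Has c x (φ c f) →
               ∃₂ λ c′ j → ¬ Has c′ x (φ c′ f) × ¬ Has c′ b j × ¬ Has c′ x j
      gain-β c {x} x≢a x≢b x<D xα =
        let j , bj = someB c 2≤a
            c′ , k , bk , _ , xk , pr = gainB c x≢a x≢b (φ c f ∷ []) j bj (A≢ c bj) (room {x} 1 x<D)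
        in c′ , k , keep-α pr (here refl) xα , bk , xk

      gain-β₂ : ∀ c {x j} → x ≢ a → x ≢ b → 3 ≤ deg G a → deg G x + 2 < D → ¬ Has c x (φ c f) →
                ¬ Has c b j → ¬ Has c x j →
                ∃₂ λ c′ j′ → ¬ Has c′ x (φ c′ f) × ¬ Has c′ b j × ¬ Has c′ x j × ¬ Has c′ b j′ × ¬ Has c′ x j′ × j ≢ j′
      gain-β₂ c {x} {j} x≢a x≢b 3≤a x<D xα bj xj =
        let k , bk , k≢j = twoB c 3≤a j
            c′ , l , bl , l∉ , xl , pr = gainB c x≢a x≢b (j ∷ φ c f ∷ []) k bk (∉-cons k≢j (A≢ c bk)) (room {x} 2 x<D)
        in c′ , l , keep-α pr (there (here refl)) xα , Preserves.fixes-b pr bj ,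
           Preserves.misses pr j (here refl) xj , bl , xl , λ j≡l → l∉ (here (sym j≡l))

    neighbour-full : ∀ {f u} → Joins G f b u → u ≢ a → deg G u ≡ D
    neighbour-full {f} {u} bu u≢a with full-or-not u
    ... | inj₁ p = p
    ... | inj₂ u<D =
      let j , bj = someB c₀ 2≤a
          c , k , bk , _ , uk , _ = gainB c₀ u≢a u≢b [] j bj (λ ()) (room₀ u<D)
      in ⊥-elim (Apply.no-missing-at-neighbour G D unc a b e₀ ab degs c ((a≢b ∷ u≢a ∘ sym ∷ []) ∷ (u≢b ∘ sym ∷ []) ∷ [] ∷ []) bu (joins-S₀ bu u≢a u≢b) bk uk)
      where
      u≢b = joins-≢ G bu ∘ sym

    onlyB : deg G a ≡ 2 → ∀ c {i j} → ¬ Has c b i → ¬ Has c b j → i ≡ j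
    onlyB a≡2 c {i} {j} bi bj = count-one _ (≤-trans (seen≤degOn c a) (≤-pred (≤-reflexive (trans (degOn-end (joins-ˡ G ab)) a≡2))))
      (⌊⌋-yes (sees? G S₀ (φ c) a i) (has-a c bi)) (⌊⌋-yes (sees? G S₀ (φ c) a j) (has-a c bj))

    module _ {f g u x} (bu : Joins G f b u) (ux : Joins G g u x) (u≢a : u ≢ a) (x≢a : x ≢ a) (x≢b : x ≢ b) where

      private
        u≢b : u ≢ b
        u≢b = joins-≢ G bu ∘ sym
        Sf : S₀ f ≡ true
        Sf = joins-S₀ bu u≢a u≢b
        Sg : S₀ g ≡ true
        Sg = joins-S₀ ux x≢a x≢b
        dist : Distinct (a ∷ b ∷ u ∷ x ∷ [])
        dist = (a≢b ∷ u≢a ∘ sym ∷ x≢a ∘ sym ∷ []) ∷ (u≢b ∘ sym ∷ x≢b ∘ sym ∷ []) ∷ (joins-≢ G ux ∷ []) ∷ [] ∷ []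
        ufull : ∀ c i → Has c u i
        ufull c = full c u≢a u≢b (neighbour-full bu u≢a)

      second-neighbour-full : 3 ≤ deg G a → deg G x ≡ D
      second-neighbour-full 3≤a with full-or-not x
      ... | inj₁ p = p
      ... | inj₂ x<D = ⊥-elim (contra (gain-α bu Sf c₀ x≢a x≢b x<D))
        where
        contra : ∃ (λ c → ¬ Has c x (φ c f)) → ⊥
        contra (c , xα) with someB c 2≤a
        ... | j , bj with twoB c 3≤a j
        ...   | k , bk , k≢j = Apply.no-missing-at-distance-two G D unc a b e₀ ab degs c dist bu Sf ux Sg (ufull c) bj bk (k≢j ∘ sym) xα

      -- The reduction consumes two colours missed by x, the colour of bu and the single β, so a
      -- vertex of degree D - 1 escapes it.
      second-neighbour-almost-full : deg G a ≡ 2 → D ≤ deg G x + 1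
      second-neighbour-almost-full a≡2 with ≤-<-connex D (deg G x + 1)
      ... | inj₁ p = p
      ... | inj₂ x<D = ⊥-elim (contra (gain-α bu Sf c₀ x≢a x≢b (≤-trans (s≤s (m≤m+n _ 1)) x<D)))
        where
        contra : ∃ (λ c → ¬ Has c x (φ c f)) → ⊥
        contra (c , xα) with gain-β bu Sf c x≢a x≢b x<D xα
        ... | c′ , j , xα′ , bj , xj = Apply.no-two-missing-at-distance-two G D unc a b e₀ ab degs c′ dist bu Sf ux Sg (ufull c′)
                                         bj (λ k bk → onlyB a≡2 c′ bk bj) xα′ xj

    -- A deficit of three lets x miss the colour of bu and two colours missing at b, gained one
    -- after the other while the earlier ones are protected.
    third-neighbour : ∀ {f g h u y x} → Joins G f b u → Joins G g u y → Joins G h y x →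
      u ≢ a → y ≢ a → y ≢ b → x ≢ a → x ≢ b → x ≢ u → 3 ≤ deg G a → D < deg G x + 3
    third-neighbour {f} {g} {h} {u} {y} {x} bu uy yx u≢a y≢a y≢b x≢a x≢b x≢u 3≤a with ≤-<-connex (deg G x + 3) D
    ... | inj₂ p = p
    ... | inj₁ x≤D = ⊥-elim (with-α (gain-α bu Sf c₀ x≢a x≢b x<D))
      where
      u≢b = joins-≢ G bu ∘ sym
      Sf = joins-S₀ bu u≢a u≢b
      x+2 : deg G x + 2 < D
      x+2 = ≤-trans (≤-reflexive (sym (+-suc _ 2))) x≤D
      x+1 : deg G x + 1 < D
      x+1 = ≤-trans (s≤s (+-monoʳ-≤ (deg G x) (s≤s z≤n))) x+2
      x<D : deg G x < D
      x<D = ≤-trans (s≤s (m≤m+n _ 1)) x+1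
      dist : Distinct (a ∷ b ∷ u ∷ y ∷ x ∷ [])
      dist = (a≢b ∷ u≢a ∘ sym ∷ y≢a ∘ sym ∷ x≢a ∘ sym ∷ []) ∷ (u≢b ∘ sym ∷ y≢b ∘ sym ∷ x≢b ∘ sym ∷ []) ∷
             (joins-≢ G uy ∷ x≢u ∘ sym ∷ []) ∷ (joins-≢ G yx ∷ []) ∷ [] ∷ []
      with-β₂ : ∀ c {j k} → ¬ Has c x (φ c f) → ¬ Has c b j → ¬ Has c x j → ¬ Has c b k → ¬ Has c x k → j ≢ k → ⊥
      with-β₂ c xα bj xj bk xk j≢k = Apply.no-missing-at-distance-three G D unc a b e₀ ab degs c dist bu Sf uy yx
        (joins-S₀ yx x≢a x≢b) (full c u≢a u≢b (neighbour-full bu u≢a))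
        (full c y≢a y≢b (second-neighbour-full bu uy u≢a y≢a y≢b 3≤a)) bj bk j≢k xα xj xk
      with-β : ∀ c {j} → ¬ Has c x (φ c f) → ¬ Has c b j → ¬ Has c x j → ⊥
      with-β c xα bj xj with gain-β₂ bu Sf c x≢a x≢b 3≤a x+2 xα bj xj
      ... | c₂ , k , xα₂ , bj₂ , xj₂ , bk , xk , j≢k = with-β₂ c₂ xα₂ bj₂ xj₂ bk xk j≢k
      with-α : ∃ (λ c → ¬ Has c x (φ c f)) → ⊥
      with-α (c , xα) with gain-β bu Sf c x≢a x≢b x+1 xα
      ... | c₁ , j , xα₁ , bj , xj = with-β c₁ xα₁ bj xj

  -- Consequences of density

  module Dense (1≤D : 1 ≤ D) (dense : 3 * n ≤ 4 * D + 3) where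

    Near : Fin n → Fin n → Set
    Near b w = w ≡ b ⊎ Adjacent G b w ⊎ ∃ λ u → Adjacent G b u × Adjacent G u w

    near? : ∀ b w → Dec (Near b w)
    near? b w = (w ≟ b) ⊎-dec (adj? b w ⊎-dec any? λ u → adj? b u ×-dec adj? u w)

    is : Fin n → Fin n → Bool
    is x w = ⌊ w ≟ x ⌋

    count-is : ∀ x → count (is x) ≡ 1
    count-is x = count-single x

    non-adj : ∀ {u w} → ¬ Adjacent G u w → adj u w ≡ false
    non-adj {u} {w} = ⌊⌋-no (adj? u w)

    non-is : ∀ {x w} → w ≢ x → is x w ≡ false
    non-is {x} {w} = ⌊⌋-no (w ≟ x)

    irrefl : ∀ {u} → ¬ Adjacent G u u
    irrefl p = adj-≢ p refl

    -- At distance at least three, x, b and their two neighbourhoods are pairwise disjoint.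
    far-degree : ∀ {b x} → ¬ Near b x → deg G x + deg G b + 2 ≤ n
    far-degree {b} {x} far = begin
      deg G x + deg G b + 2                                     ≤⟨ +-monoˡ-≤ 2 (+-mono-≤ (deg≤adj x) (deg≤adj b)) ⟩
      count (adj x) + count (adj b) + 2                         ≡⟨ +-assoc (count (adj x)) _ 2 ⟩
      count (adj x) + (count (adj b) + 2)                       ≡⟨ cong (λ t → count (adj x) + (count (adj b) + t)) (cong₂ _+_ (sym (count-is x)) (cong (_+ 0) (sym (count-is b)))) ⟩
      counts (adj x ∷ adj b ∷ is x ∷ is b ∷ [])                 ≤⟨ counts-≤ (adj x ∷ adj b ∷ is x ∷ is b ∷ []) 1 (λ _ → false) bound ⟩
      n * 1 + count {n} (λ _ → false)                           ≡⟨ trans (cong₂ _+_ (*-identityʳ n) (count-false n)) (+-identityʳ n) ⟩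
      n                                                         ∎
      where
      open ≤-Reasoning
      bound : ∀ w → total (adj x ∷ adj b ∷ is x ∷ is b ∷ []) w ≤ 1 + 0
      bound w with adj? x w | adj? b w | w ≟ x | w ≟ b
      ... | yes p | yes q | _ | _ = ⊥-elim (far (inj₂ (inj₂ (w , q , adj-sym p))))
      ... | yes p | _ | yes refl | _ = ⊥-elim (irrefl p)
      ... | yes p | _ | _ | yes refl = ⊥-elim (far (inj₂ (inj₁ (adj-sym p))))
      ... | _ | yes q | yes refl | _ = ⊥-elim (far (inj₂ (inj₁ q)))
      ... | _ | yes q | _ | yes refl = ⊥-elim (irrefl q)
      ... | _ | _ | yes p | yes q = ⊥-elim (far (inj₁ (trans (sym p) q)))
      ... | yes _ | no _ | no _ | no _ = ≤-refl
      ... | no _ | yes _ | no _ | no _ = ≤-refl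
      ... | no _ | no _ | yes _ | no _ = ≤-refl
      ... | no _ | no _ | no _ | yes _ = ≤-refl
      ... | no _ | no _ | no _ | no _ = z≤n

    -- Both ends of degree at least three

    module LargeEnds (a b : Fin n) (e₀ : Fin (m G)) (ab : Joins G e₀ a b) (degs : deg G a + deg G b ≡ D + 2)
                     (3≤a : 3 ≤ deg G a) (a≤b : deg G a ≤ deg G b) where
      private
        module P = AtPair a b e₀ ab degs
        module Q = AtPair b a e₀ (joins-sym G ab) (trans (+-comm (deg G b) (deg G a)) degs)

        a≢b : a ≢ b
        a≢b = joins-≢ G ab

        near-full : ∀ {x} → Near b x → x ≢ a → x ≢ b → deg G x ≡ D
        near-full (inj₁ p) x≢a x≢b = ⊥-elim (x≢b p)
        near-full (inj₂ (inj₁ (f , bx))) x≢a x≢b = P.neighbour-full bx x≢a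
        near-full (inj₂ (inj₂ (u , (f , bu) , (g , ux)))) x≢a x≢b with u ≟ a
        ... | yes refl = Q.neighbour-full ux x≢b
        ... | no u≢a = P.second-neighbour-full bu ux u≢a x≢a x≢b 3≤a

        no-step : ∀ {x y} → Near b y → ¬ Near b x → ¬ Adjacent G y x
        no-step (inj₁ refl) far yx = far (inj₂ (inj₁ yx))
        no-step {y = y} (inj₂ (inj₁ by)) far yx = far (inj₂ (inj₂ (y , by , yx)))
        no-step {x} {y} (inj₂ (inj₂ (u , (f , bu) , (g , uy)))) far (h , yx) with u ≟ a
        -- The path from b to x passes through a, so x is a second neighbour of a. With the roles of
        -- a and b exchanged it has degree D, against `far-room`.
        ... | yes refl = <-irrefl (sym-full) x<D
          where
          room : deg G x + 3 ≤ D
          room = far-room {n} {D} {deg G x} {deg G b} dense 1≤D (≤-trans (≤-reflexive (sym degs)) (+-monoˡ-≤ (deg G b) a≤b)) (far-degree far)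
          x<D : deg G x < D
          x<D = ≤-trans (≤-trans (≤-reflexive (+-comm 1 _)) (+-monoʳ-≤ (deg G x) (s≤s z≤n))) room
          sym-full : deg G x ≡ D
          sym-full = Q.second-neighbour-full uy yx
            (λ { refl → far (inj₂ (inj₁ (h , yx))) }) (λ { refl → far (inj₁ refl) })
            (λ { refl → far (inj₂ (inj₁ (e₀ , joins-sym G ab))) }) (≤-trans 3≤a a≤b)
        ... | no u≢a = <⇒≱ (P.third-neighbour bu uy yx u≢a
            (λ { refl → far (inj₂ (inj₂ (a , (e₀ , joins-sym G ab) , (h , yx)))) })
            (λ { refl → far (inj₂ (inj₁ (h , yx))) })
            (λ { refl → far (inj₂ (inj₁ (e₀ , joins-sym G ab))) }) (λ { refl → far (inj₁ refl) })
            (λ { refl → far (inj₂ (inj₁ (f , bu))) }) 3≤a)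
            (far-room {n} {D} {deg G x} {deg G b} dense 1≤D (≤-trans (≤-reflexive (sym degs)) (+-monoˡ-≤ (deg G b) a≤b)) (far-degree far))

      others-full : ∀ x → x ≢ a → x ≢ b → deg G x ≡ D
      others-full x x≢a x≢b with near? b x
      ... | yes near = near-full near x≢a x≢b
      ... | no far with connected (λ w → ⌊ near? b w ⌋) (⌊⌋-yes (near? b b) (inj₁ refl)) (⌊⌋-no (near? b x) far)
      ...   | y , x′ , p , q , yx = ⊥-elim (no-step (⌊⌋-true (near? b y) p) (⌊⌋-false (near? b x′) q) yx)

    -- An end of degree two

    module SmallEnd (a b : Fin n) (e₀ : Fin (m G)) (ab : Joins G e₀ a b) (degs : deg G a + deg G b ≡ D + 2)
                    (a≡2 : deg G a ≡ 2) where
      module P = AtPair a b e₀ ab degs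
      module Q = AtPair b a e₀ (joins-sym G ab) (trans (+-comm (deg G b) (deg G a)) degs)
      open Pair G D unc a b e₀ ab degs using (Col; S₀; joins-S₀; a≢b; gainA; gainB; GainedA; GainedB; Preserves; module Of; degOn-≤; degOn-end; degOn-other)
      open P using (c₀)
      open Of

      b-full : deg G b ≡ D
      b-full = +-cancelˡ-≡ 2 (deg G b) D (trans (cong (_+ deg G b) (sym a≡2)) (trans degs (+-comm D 2)))

      private
        other-neighbour : ∃ λ c → adj a c ≡ true × c ≢ b
        other-neighbour = count-two (adj a) (≤-trans (≤-reflexive (sym a≡2)) (deg≤adj a)) b

      c : Fin n
      c = proj₁ other-neighbour

      c≢b : c ≢ b
      c≢b = proj₂ (proj₂ other-neighbour)

      private
        ac-edge : Adjacent G a c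
        ac-edge = ⌊⌋-true (adj? a c) (proj₁ (proj₂ other-neighbour))

      k : Fin (m G)
      k = proj₁ ac-edge

      ac : Joins G k a c
      ac = proj₂ ac-edge

      a≢c : a ≢ c
      a≢c = joins-≢ G ac

      c-full : deg G c ≡ D
      c-full = Q.neighbour-full ac c≢b

      Sk : S₀ k ≡ true
      Sk = joins-S₀ ac (a≢c ∘ sym) c≢b

      -- As a neighbour of a, c has degree D, so ac is a full-deficiency pair too and all facts
      -- about neighbours of b hold for c.
      module R = AtPair a c k ac (trans (cong (deg G a +_) (trans c-full (sym b-full))) degs)

      neighbours-a : ∀ {w} → Adjacent G a w → w ≡ b ⊎ w ≡ c
      neighbours-a {w} (e , aw) with w ≟ b
      ... | yes p = inj₁ p
      ... | no w≢b = inj₂ (sym (joins-determined ac (subst (λ e → Joins G e a w) e≡k aw)))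
        where
        at-a : ∀ {e} → S₀ e ≡ true → Incident G a e → S₀ e ∧ incB G a e ≡ true
        at-a p q rewrite p = incident-true G q
        e≡k : e ≡ k
        e≡k = count-one (λ e → S₀ e ∧ incB G a e) (≤-pred (≤-reflexive (trans (degOn-end (joins-ˡ G ab)) a≡2)))
                (at-a (joins-S₀ aw (joins-≢ G aw ∘ sym) w≢b) (joins-ˡ G aw)) (at-a Sk (joins-ˡ G ac))

      only-b : ∀ col {i j} → ¬ Has col b i → ¬ Has col b j → i ≡ j
      only-b = P.onlyB a≡2

      k-colour : ∀ col {β} → ¬ Has col b β → φ col k ≡ β
      k-colour col bβ = only-b col (λ p → not-neither col (k , Sk , joins-ˡ G ac , refl) p) bβ

      near-almost-full : ∀ {x} → Near b x → x ≢ a → x ≢ b → deg G x < D → deg G x + 1 ≡ D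
      near-almost-full {x} near x≢a x≢b x<D = ≤-antisym (≤-trans (≤-reflexive (+-comm _ 1)) x<D) (D≤ near)
        where
        D≤ : Near b x → D ≤ deg G x + 1
        D≤ (inj₁ p) = ⊥-elim (x≢b p)
        D≤ (inj₂ (inj₁ (f , bx))) = ⊥-elim (<-irrefl (P.neighbour-full bx x≢a) x<D)
        D≤ (inj₂ (inj₂ (u , (f , bu) , (g , ux)))) with u ≟ a
        ... | yes refl = ⊥-elim (<-irrefl (Q.neighbour-full ux x≢b) x<D)
        ... | no u≢a = P.second-neighbour-almost-full bu ux u≢a x≢a x≢b a≡2

      misses-one : ∀ col {x} → x ≢ a → x ≢ b → deg G x + 1 ≡ D → ∀ {i j} → ¬ Has col x i → ¬ Has col x j → i ≡ j
      misses-one col {x} x≢a x≢b x+1 {i} {j} p q = count-one (λ i → not ⌊ sees? G S₀ (φ col) x i ⌋) (+-cancelˡ-≤ (seen col x) _ 1 (≤-reflexive (begin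
        seen col x + count (λ i → not ⌊ sees? G S₀ (φ col) x i ⌋) ≡⟨ count-not (λ i → ⌊ sees? G S₀ (φ col) x i ⌋) ⟩
        D                    ≡⟨ sym x+1 ⟩
        deg G x + 1          ≡⟨ cong (_+ 1) (sym (trans (seen≡degOn col x) (degOn-other x≢a x≢b))) ⟩
        seen col x + 1       ∎))) (cong not (⌊⌋-no (sees? G S₀ (φ col) x i) p)) (cong not (⌊⌋-no (sees? G S₀ (φ col) x j) q))
        where open ≡-Reasoning

      four : (f₁ f₂ f₃ f₄ : Fin n → Bool) → Fin n → Bool
      four f₁ f₂ f₃ f₄ w = f₁ w ∧ f₂ w ∧ f₃ w ∧ f₄ w

      four-true : ∀ {f₁ f₂ f₃ f₄ w} → four f₁ f₂ f₃ f₄ w ≡ true → f₁ w ≡ true × f₂ w ≡ true × f₃ w ≡ true × f₄ w ≡ true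
      four-true {f₁} {f₂} {f₃} {f₄} {w} p with f₁ w | f₂ w | f₃ w | f₄ w
      ... | true | true | true | true = refl , refl , refl , refl

      ind-≤1 : ∀ p → ind p ≤ 1
      ind-≤1 true = ≤-refl
      ind-≤1 false = z≤n

      four-bound : ∀ p q r s → ind p + (ind q + (ind r + (ind s + 0))) ≤ 3 + ind (p ∧ q ∧ r ∧ s)
      four-bound false q r s = +-mono-≤ (ind-≤1 q) (+-mono-≤ (ind-≤1 r) (+-monoˡ-≤ 0 (ind-≤1 s)))
      four-bound true false r s = s≤s (≤-trans (+-mono-≤ (ind-≤1 r) (+-monoˡ-≤ 0 (ind-≤1 s))) (m≤m+n 2 0))
      four-bound true true false s = s≤s (s≤s (+-monoˡ-≤ 0 (ind-≤1 s)))
      four-bound true true true s = ≤-reflexive (cong (3 +_) (+-identityʳ (ind s)))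

      module TwoAlmostFull {x y} (x≢y : x ≢ y) (x+1 : deg G x + 1 ≡ D) (y+1 : deg G y + 1 ≡ D)
                           (x≢a : x ≢ a) (x≢b : x ≢ b) (y≢a : y ≢ a) (y≢b : y ≢ b) where

        not-full : ∀ {v} → deg G v + 1 ≡ D → deg G v ≢ D
        not-full {v} p q = <-irrefl (trans q (sym p)) (≤-reflexive (+-comm 1 _))

        x≢c : x ≢ c
        x≢c refl = not-full x+1 c-full

        y≢c : y ≢ c
        y≢c refl = not-full y+1 c-full

        apart-b : ∀ {v} → deg G v + 1 ≡ D → v ≢ a → ¬ Adjacent G b v
        apart-b p v≢a (_ , bv) = not-full p (P.neighbour-full bv v≢a)

        apart-c : ∀ {v} → deg G v + 1 ≡ D → v ≢ a → ¬ Adjacent G c v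
        apart-c p v≢a (_ , cv) = not-full p (R.neighbour-full cv v≢a)

        common : Fin n → Bool
        common = four (adj b) (adj c) (adj x) (adj y)

        -- A vertex outside the common neighbourhood lies in at most three of the four neighbourhoods; the further
        -- indicators account for b, c and x lying in at most one.
        corrected : List (Fin n → Bool)
        corrected = is b ∷ is b ∷ is c ∷ is c ∷ is x ∷ is x ∷ adj b ∷ adj c ∷ adj x ∷ adj y ∷ []

        bound : ∀ w → total corrected w ≤ 3 + ind (common w)
        bound w = pure (is b w) (is c w) (is x w) (adj b w) (adj c w) (adj x w) (adj y w) at-b at-c at-x
          where
          pure : ∀ eb ec ex p q r s →
                 (eb ≡ true → ec ≡ false × ex ≡ false × p ≡ false × r ≡ false × s ≡ false) →
                 (ec ≡ true → ex ≡ false × q ≡ false × r ≡ false × s ≡ false) →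
                 (ex ≡ true → p ≡ false × q ≡ false × r ≡ false) →
                 ind eb + (ind eb + (ind ec + (ind ec + (ind ex + (ind ex + (ind p + (ind q + (ind r + (ind s + 0))))))))) ≤ 3 + ind (p ∧ q ∧ r ∧ s)
          pure true ec ex p q r s hb hc hx with hb refl
          ... | refl , refl , refl , refl , refl = s≤s (s≤s (≤-trans (≤-reflexive (+-identityʳ _)) (ind-≤1 q)))
          pure false true ex p q r s hb hc hx with hc refl
          ... | refl , refl , refl , refl = s≤s (s≤s (≤-trans (≤-trans (≤-reflexive (+-identityʳ _)) (ind-≤1 p)) (m≤m+n 1 _)))
          pure false false true p q r s hb hc hx with hx refl
          ... | refl , refl , refl = s≤s (s≤s (≤-trans (≤-reflexive (+-identityʳ _)) (ind-≤1 s)))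
          pure false false false p q r s hb hc hx = four-bound p q r s
          at-b : is b w ≡ true → is c w ≡ false × is x w ≡ false × adj b w ≡ false × adj x w ≡ false × adj y w ≡ false
          at-b e with ⌊⌋-true (w ≟ b) e
          ... | refl = non-is (c≢b ∘ sym) , non-is (x≢b ∘ sym) , non-adj irrefl , non-adj (apart-b x+1 x≢a ∘ adj-sym) , non-adj (apart-b y+1 y≢a ∘ adj-sym)
          at-c : is c w ≡ true → is x w ≡ false × adj c w ≡ false × adj x w ≡ false × adj y w ≡ false
          at-c e with ⌊⌋-true (w ≟ c) e
          ... | refl = non-is (x≢c ∘ sym) , non-adj irrefl , non-adj (apart-c x+1 x≢a ∘ adj-sym) , non-adj (apart-c y+1 y≢a ∘ adj-sym)
          at-x : is x w ≡ true → adj b w ≡ false × adj c w ≡ false × adj x w ≡ false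
          at-x e with ⌊⌋-true (w ≟ x) e
          ... | refl = non-adj (apart-b x+1 x≢a) , non-adj (apart-c x+1 x≢a) , non-adj irrefl

        some-common : 0 < count common
        -- The degrees sum to 4D - 2 and the six indicators raise this to 4D + 4, one more than the
        -- bound 4D + 3 on 3n.
        some-common = +-cancelˡ-≤ (4 * D + 3) 1 (count common) (begin
          4 * D + 3 + 1                                       ≡⟨ lhs D ⟩
          D + D + D + D + 4                                   ≡⟨ cong₂ (λ s t → D + D + s + t + 4) (sym x+1) (sym y+1) ⟩
          D + D + (deg G x + 1) + (deg G y + 1) + 4           ≡⟨ rearrange D (deg G x) (deg G y) ⟩
          6 + (D + (D + (deg G x + (deg G y + 0))))           ≡⟨ cong (6 +_) (cong₂ (λ s t → s + (t + _)) (sym b-full) (sym c-full)) ⟩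
          6 + (deg G b + (deg G c + (deg G x + (deg G y + 0)))) ≤⟨ +-monoʳ-≤ 6 (+-mono-≤ (deg≤adj b) (+-mono-≤ (deg≤adj c) (+-mono-≤ (deg≤adj x) (+-monoˡ-≤ 0 (deg≤adj y))))) ⟩
          6 + adjs                                            ≡⟨ cong₂ (λ s t → s + (s + t)) (sym (count-is b)) (cong₂ (λ s t → s + (s + t)) (sym (count-is c)) (cong (λ s → s + (s + adjs)) (sym (count-is x)))) ⟩
          counts corrected                                    ≤⟨ counts-≤ corrected 3 common bound ⟩
          n * 3 + count common                                ≡⟨ cong (_+ count common) (*-comm n 3) ⟩
          3 * n + count common                                ≤⟨ +-monoˡ-≤ (count common) dense ⟩
          4 * D + 3 + count common                            ∎)
          where
          open ≤-Reasoning
          open +-*-Solver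
          adjs = counts (adj b ∷ adj c ∷ adj x ∷ adj y ∷ [])
          lhs : ∀ D → 4 * D + 3 + 1 ≡ D + D + D + D + 4
          lhs = solve 1 (λ D → con 4 :* D :+ con 3 :+ con 1 := D :+ D :+ D :+ D :+ con 4) refl
          rearrange : ∀ D x y → D + D + (x + 1) + (y + 1) + 4 ≡ 6 + (D + (D + (x + (y + 0))))
          rearrange = solve 3 (λ D x y → D :+ D :+ (x :+ con 1) :+ (y :+ con 1) :+ con 4 := con 6 :+ (D :+ (D :+ (x :+ (y :+ con 0))))) refl

        room : ∀ {v} → deg G v + 1 ≡ D → deg G v + 0 < D
        room {v} p = ≤-reflexive (trans (sym (+-suc (deg G v) 0)) p)

        coloured : ∀ {u f f′ g h} → Joins G f b u → Joins G f′ c u → Joins G g u x → Joins G h u y → u ≢ a →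
                   ∀ col {β μ} → ¬ Has col b β → ¬ Has col x β → ¬ Has col y μ → ⊥
        coloured bu cu ux uy u≢a col bβ xβ yμ = Apply.SingleB.no-kite G D unc a b e₀ ab degs col bβ (λ j bj → only-b col bj bβ)
          ((a≢b ∷ a≢c ∷ u≢a ∘ sym ∷ x≢a ∘ sym ∷ y≢a ∘ sym ∷ []) ∷ (c≢b ∘ sym ∷ u≢b ∘ sym ∷ x≢b ∘ sym ∷ y≢b ∘ sym ∷ []) ∷
           (joins-≢ G cu ∷ x≢c ∘ sym ∷ y≢c ∘ sym ∷ []) ∷ (joins-≢ G ux ∷ joins-≢ G uy ∷ []) ∷ (x≢y ∷ []) ∷ [] ∷ [])
          ac Sk bu (joins-S₀ bu u≢a u≢b) cu (joins-S₀ cu u≢a u≢b) ux (joins-S₀ ux x≢a x≢b) uy (joins-S₀ uy y≢a y≢b)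
          (full col (a≢c ∘ sym) c≢b c-full) (full col u≢a u≢b (P.neighbour-full bu u≢a))
          xβ (λ i p → misses-one col x≢a x≢b x+1 p xβ) yμ (λ i p → misses-one col y≢a y≢b y+1 p yμ)
          where u≢b = joins-≢ G bu ∘ sym

        at : ∀ {u} → Adjacent G b u → Adjacent G c u → Adjacent G x u → Adjacent G y u → ⊥
        at {u} (f , bu) (f′ , cu) (g , xu) (h , yu) = choose (gainB c₀ x≢a x≢b [] _ (proj₂ (someB c₀ P.2≤a)) (λ ()) (P.room {x} 0 (room x+1)))
          where
          u≢a : u ≢ a
          u≢a refl = [ x≢b , x≢c ]′ (neighbours-a (g , joins-sym G xu))
          choose : GainedB c₀ x [] → ⊥
          choose (col , β , bβ , _ , xβ , _) = coloured bu cu (joins-sym G xu) (joins-sym G yu) u≢a col bβ xβ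
            (proj₁ (proj₂ (another col y [] (P.room {y} 0 (room y+1)))))

        contradiction : ⊥
        contradiction = found (count-some common some-common)
          where
          found : ∃ (λ u → common u ≡ true) → ⊥
          found (u , p) with four-true {adj b} {adj c} {adj x} {adj y} {u} p
          ... | q , r , s , t = at (⌊⌋-true (adj? b u) q) (⌊⌋-true (adj? c u) r) (⌊⌋-true (adj? x u) s) (⌊⌋-true (adj? y u) t)

      -- The colours α, γ, τ, σ are those of bu, cu, uy, uz, and β is the colour of ac.
      record FarConfiguration : Set where
        field
          {u y z x} : Fin n
          {f f′ g g′ h h′} : Fin (m G)
          bu : Joins G f b u
          cu : Joins G f′ c u
          uy : Joins G g u y
          uz : Joins G g′ u z
          yx : Joins G h y x
          zx : Joins G h′ z x
          dist : Distinct (a ∷ b ∷ c ∷ u ∷ y ∷ z ∷ x ∷ [])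
          u-full : deg G u ≡ D
          y-full : deg G y ≡ D
          z-full : deg G z ≡ D
          room : deg G x + 4 < D
          {α γ τ σ β} : Fin D
          α≢γ : α ≢ γ
          α≢τ : α ≢ τ
          α≢σ : α ≢ σ
          γ≢τ : γ ≢ τ
          γ≢σ : γ ≢ σ
          α≢β : α ≢ β
          γ≢β : γ ≢ β
          τ≢β : τ ≢ β
          σ≢β : σ ≢ β

      module Recolour (configuration : FarConfiguration) where
        open FarConfiguration configuration

        private
          apart : ∀ i j → i ≢ j → lookup (a ∷ b ∷ c ∷ u ∷ y ∷ z ∷ x ∷ []) i ≢ lookup (a ∷ b ∷ c ∷ u ∷ y ∷ z ∷ x ∷ []) j
          apart = Apply.apart G D unc a b e₀ ab degs c₀ dist

        u≢a : u ≢ a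
        u≢a = apart (# 3) (# 0) (λ ())
        u≢b : u ≢ b
        u≢b = apart (# 3) (# 1) (λ ())
        y≢a : y ≢ a
        y≢a = apart (# 4) (# 0) (λ ())
        y≢b : y ≢ b
        y≢b = apart (# 4) (# 1) (λ ())
        z≢a : z ≢ a
        z≢a = apart (# 5) (# 0) (λ ())
        z≢b : z ≢ b
        z≢b = apart (# 5) (# 1) (λ ())
        x≢a : x ≢ a
        x≢a = apart (# 6) (# 0) (λ ())
        x≢b : x ≢ b
        x≢b = apart (# 6) (# 1) (λ ())
        Sf = joins-S₀ bu u≢a u≢b
        Sf′ = joins-S₀ cu u≢a u≢b
        Sg = joins-S₀ uy y≢a y≢b
        Sg′ = joins-S₀ uz z≢a z≢b

        -- The invariant of the recolouring. At x only τ is already missing; σ is held fixed so that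
        -- uz does not receive β.
        record Coloured (col : Col) : Set where
          field
            at-f  : φ col f ≡ α
            at-f′ : φ col f′ ≡ γ
            at-g  : φ col g ≡ τ
            at-g′ : φ col g′ ≡ σ
            bβ    : ¬ Has col b β
            xτ    : ¬ Has col x τ

        open Coloured

        A-type : ∀ {col i} → Coloured col → i ≢ β → ¬ Has col a i
        A-type {col} {i} cd i≢β p with split col i
        ... | inj₁ (q , _) = q p
        ... | inj₂ (_ , q) = i≢β (only-b col q (bβ cd))

        final : ∀ {col} → Coloured col → ¬ Has col x α → ¬ Has col x γ → ¬ Has col x β → ⊥
        final {col} cd xα xγ xβ = Apply.SingleB.no-far-vertex G D unc a b e₀ ab degs col (bβ cd) (λ j bj → only-b col bj (bβ cd)) dist
          ac Sk bu Sf cu Sf′ uy Sg uz Sg′ yx (joins-S₀ yx x≢a x≢b) zx (joins-S₀ zx x≢a x≢b)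
          (full col (a≢c ∘ sym) c≢b c-full) (full col u≢a u≢b u-full) (full col y≢a y≢b y-full) (full col z≢a z≢b z-full)
          xβ (xα ∘ subst (Has col x) (at-f cd)) (xγ ∘ subst (Has col x) (at-f′ cd)) (xτ cd ∘ subst (Has col x) (at-g cd))
          (τ≢β ∘ trans (sym (at-g cd))) (σ≢β ∘ trans (sym (at-g′ cd)))

        preserve : ∀ {col col′ K} → Coloured col → Preserves col col′ x K → τ ∈ K → σ ∈ K → φ col′ f′ ≡ φ col f′ → Coloured col′
        preserve {col} {col′} cd pr τ∈ σ∈ f′-same = record
          { at-f = trans (Preserves.fixes pr f Sf (inj₂ (joins-ˡ G bu))) (at-f cd)
          ; at-f′ = trans f′-same (at-f′ cd)
          ; at-g = trans (Preserves.keeps pr g Sg (subst (_∈ _) (sym (at-g cd)) τ∈)) (at-g cd)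
          ; at-g′ = trans (Preserves.keeps pr g′ Sg′ (subst (_∈ _) (sym (at-g′ cd)) σ∈)) (at-g′ cd)
          ; bβ = Preserves.fixes-b pr (bβ cd)
          ; xτ = Preserves.misses pr τ τ∈ (xτ cd) }

        all-four : List (Fin D)
        all-four = α ∷ γ ∷ τ ∷ σ ∷ []

        β∉ : ¬ β ∈ all-four
        β∉ (here p) = α≢β (sym p)
        β∉ (there (here p)) = γ≢β (sym p)
        β∉ (there (there (here p))) = τ≢β (sym p)
        β∉ (there (there (there (here p)))) = σ≢β (sym p)

        -- The colour gained is missing at b, as is β, and only one colour is. Hence β itself is
        -- gained.
        with-β : ∀ {col} → Coloured col → ∃ λ col′ → Coloured col′ × ¬ Has col′ x β × Preserves col col′ x all-four
        with-β {col} cd = rename (gainB col x≢a x≢b all-four β (bβ cd) β∉ (P.room {x} 4 room))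
          where
          rename : GainedB col x all-four → _
          rename (col′ , β′ , bβ′ , _ , xβ′ , pr) = col′ , cd′ , xβ′ ∘ subst (Has col′ x) (only-b col′ (bβ cd′) bβ′) , pr
            where
            cd′ : Coloured col′
            cd′ = preserve cd pr (there (there (here refl))) (there (there (there (here refl))))
                    (Preserves.keeps pr f′ Sf′ (subst (_∈ all-four) (sym (at-f′ cd)) (there (here refl))))

        with-γ : ∀ {col} → Coloured col → ¬ Has col x α → ¬ Has col x β → ⊥
        with-γ {col} cd xα xβ = step (gainA col x≢a x≢b (α ∷ τ ∷ σ ∷ []) (A-type cd γ≢β) γ∉ (bβ cd) β∉′ xβ)
          where
          γ∉ : ¬ γ ∈ α ∷ τ ∷ σ ∷ []
          γ∉ (here p) = α≢γ (sym p)
          γ∉ (there (here p)) = γ≢τ p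
          γ∉ (there (there (here p))) = γ≢σ p
          β∉′ : ¬ β ∈ α ∷ τ ∷ σ ∷ []
          β∉′ (here p) = β∉ (here p)
          β∉′ (there p) = β∉ (there (there p))
          step : GainedA col x (α ∷ τ ∷ σ ∷ []) γ β → ⊥
          step (col′ , xγ , pr , near) = last (with-β cd′)
            where
            cd′ : Coloured col′
            cd′ = preserve cd pr (there (here refl)) (there (there (here refl)))
                    -- The colour γ is being exchanged and cannot be protected through `K`. But ac
                    -- has colour β and a is off the chain, so c is off it and cu keeps γ.
                    (near k f′ Sk Sf′ (joins-ˡ G ac) (k-colour col (bβ cd)) (joins-ʳ G ac) (joins-ˡ G cu))
            last : ∃ (λ col″ → Coloured col″ × ¬ Has col″ x β × Preserves col′ col″ x all-four) → ⊥
            last (col″ , cd″ , xβ , pr′) = final cd″ (Preserves.misses pr′ α (here refl) (Preserves.misses pr α (here refl) xα))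
              (Preserves.misses pr′ γ (there (here refl)) xγ) xβ

        -- Each of α and γ is obtained at x by spending β, which `with-β` regains afterwards without
        -- losing the colours obtained before.
        impossible : ∀ {col} → Coloured col → ¬ Has col x β → ⊥
        impossible {col} cd xβ = step (gainA col x≢a x≢b (γ ∷ τ ∷ σ ∷ []) (A-type cd α≢β) α∉ (bβ cd) (β∉ ∘ there) xβ)
          where
          α∉ : ¬ α ∈ γ ∷ τ ∷ σ ∷ []
          α∉ (here p) = α≢γ p
          α∉ (there (here p)) = α≢τ p
          α∉ (there (there (here p))) = α≢σ p
          step : GainedA col x (γ ∷ τ ∷ σ ∷ []) α β → ⊥
          step (col′ , xα , pr , _) = next (with-β cd′)
            where
            cd′ : Coloured col′
            cd′ = preserve cd pr (there (here refl)) (there (there (here refl)))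
                    (Preserves.keeps pr f′ Sf′ (subst (_∈ _) (sym (at-f′ cd)) (here refl)))
            next : ∃ (λ col″ → Coloured col″ × ¬ Has col″ x β × Preserves col′ col″ x all-four) → ⊥
            next (col″ , cd″ , xβ , pr′) = with-γ cd″ (Preserves.misses pr′ α (here refl) xα) xβ

      far-small : ∀ {x} → ¬ Near b x → 3 * deg G x + 3 ≤ D
      far-small far = far-room′ dense (subst (λ t → _ + t + 2 ≤ n) b-full (far-degree far))

      -- A far vertex when d(a) = 2

      module FarVertex {x} (far : ¬ Near b x) where

        d : ℕ
        d = deg G x

        d≤D/3 : 3 * d + 3 ≤ D
        d≤D/3 = far-small far

        d+3≤D : d + 3 ≤ D
        d+3≤D = ≤-trans (+-monoˡ-≤ 3 (m≤m+n d (d + (d + 0)))) d≤D/3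

        x<D : d < D
        x<D = ≤-trans (≤-trans (≤-reflexive (+-comm 1 d)) (+-monoʳ-≤ d (s≤s z≤n))) d+3≤D

        a-b : Adjacent G a b
        a-b = e₀ , ab

        x≢a : x ≢ a
        x≢a refl = far (inj₂ (inj₁ (adj-sym a-b)))

        x≢b : x ≢ b
        x≢b refl = far (inj₁ refl)

        x≢c : x ≢ c
        x≢c refl = far (inj₂ (inj₂ (a , adj-sym a-b , k , ac)))

        b≁x : ¬ Adjacent G b x
        b≁x p = far (inj₂ (inj₁ p))

        c≁x : ¬ Adjacent G c x
        c≁x (_ , cx) = <-irrefl (R.neighbour-full cx x≢a) x<D

        a≁x : ¬ Adjacent G a x
        a≁x p = [ x≢b , x≢c ]′ (neighbours-a p)

        module NeighbourOf {y} (xy : Adjacent G x y) where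

          b≁y : ¬ Adjacent G b y
          b≁y p = far (inj₂ (inj₂ (y , p , adj-sym xy)))

          y≢a : y ≢ a
          y≢a refl = a≁x (adj-sym xy)

          y≢b : y ≢ b
          y≢b refl = b≁x (adj-sym xy)

          y≢c : y ≢ c
          y≢c refl = c≁x (adj-sym xy)

          c≁y : ¬ Adjacent G c y
          -- Otherwise x would be a second neighbour of c, and the pair ac forces degree at least D
          -- - 1 on those.
          c≁y (f , cy) = <⇒≱ (≤-trans (≤-reflexive (sym (+-suc d 1))) (≤-trans (+-monoʳ-≤ d (s≤s (s≤s z≤n))) d+3≤D))
            (R.second-neighbour-almost-full cy (joins-sym G (proj₂ xy)) y≢a x≢a x≢c a≡2)

          a≁y : ¬ Adjacent G a y
          a≁y p = [ y≢b , y≢c ]′ (neighbours-a p)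

          near : Near b y
          near with near? b y
          ... | yes p = p
          -- Two adjacent far vertices would have a degree sum of at most 2D/3 - 2, against
          -- `edge-sum`.
          ... | no far′ = ⊥-elim (<⇒≱ (≤-trans (s≤s (z≤n {D})) (≤-reflexive (+-comm 1 D)))
                    (+-cancelʳ-≤ (2 * D + 5) (D + 1) 0 (begin
            D + 1 + (2 * D + 5)                       ≡⟨ lhs D ⟩
            3 * (D + 2)                               ≤⟨ *-monoʳ-≤ 3 (edge-sum (proj₂ xy)) ⟩
            3 * (d + deg G y)                         ≤⟨ m≤m+n _ 6 ⟩
            3 * (d + deg G y) + 6                     ≡⟨ mid d (deg G y) ⟩
            (3 * d + 3) + (3 * deg G y + 3)           ≤⟨ +-mono-≤ d≤D/3 (far-small far′) ⟩
            D + D                                     ≡⟨ cong (D +_) (sym (+-identityʳ D)) ⟩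
            2 * D                                     ≤⟨ m≤m+n _ 5 ⟩
            2 * D + 5                                 ∎)))
            where
            open ≤-Reasoning
            open +-*-Solver
            lhs : ∀ D → D + 1 + (2 * D + 5) ≡ 3 * (D + 2)
            lhs = solve 1 (λ D → D :+ con 1 :+ (con 2 :* D :+ con 5) := con 3 :* (D :+ con 2)) refl
            mid : ∀ d y → 3 * (d + y) + 6 ≡ (3 * d + 3) + (3 * y + 3)
            mid = solve 2 (λ d y → con 3 :* (d :+ y) :+ con 6 := (con 3 :* d :+ con 3) :+ (con 3 :* y :+ con 3)) refl

          almost : deg G y < D → deg G y + 1 ≡ D
          almost = near-almost-full near y≢a y≢b

        adj-of : ∀ {w} → adj x w ≡ true → Adjacent G x w
        adj-of {w} = ⌊⌋-true (adj? x w)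

        -- By `TwoAlmostFull` at most one neighbour of x is not full. It has degree D - 1, and then
        -- `edge-sum` gives x at least three neighbours.
        two-full : ∃₂ λ y z → y ≢ z × (Adjacent G x y × deg G y ≡ D) × (Adjacent G x z × deg G z ≡ D)
        two-full with any? (λ w → adj? x w ×-dec (deg G w <? D))
        ... | no none = pick (count-some (adj x) (≤-trans (s≤s z≤n) many))
          where
          many : 2 ≤ count (adj x)
          many = ≤-trans (two (incident-joins (proj₂ (edgeAt x)))) (deg≤adj x)
            where
            two : (∃ λ w → Joins G (proj₁ (edgeAt x)) x w) → 2 ≤ deg G x
            two (w , j) = +-cancelˡ-≤ D 2 (deg G x) (≤-trans (edge-sum j) (≤-trans (+-monoʳ-≤ (deg G x) (deg≤ w)) (≤-reflexive (+-comm (deg G x) D))))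
          is-full : ∀ {w} → Adjacent G x w → deg G w ≡ D
          is-full {w} p with full-or-not w
          ... | inj₁ q = q
          ... | inj₂ q = ⊥-elim (none (w , p , q))
          pick : ∃ (λ y → adj x y ≡ true) → _
          pick (y , p) with count-two (adj x) many y
          ... | z , q , z≢y = y , z , z≢y ∘ sym , (adj-of p , is-full (adj-of p)) , (adj-of q , is-full (adj-of q))
        ... | yes (w , xw , w<D) = pick (count-some others (≤-trans (s≤s z≤n) many))
          where
          w+1 : deg G w + 1 ≡ D
          w+1 = NeighbourOf.almost xw w<D
          others : Fin n → Bool
          others v = adj x v ∧ not ⌊ v ≟ w ⌋
          three : 3 ≤ deg G x
          three = +-cancelʳ-≤ (deg G w) 3 (deg G x) (≤-trans (≤-reflexive (trans (+-comm 3 _) (trans (sym (+-assoc (deg G w) 1 2)) (cong (_+ 2) w+1)))) (edge-sum (proj₂ xw)))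
          many : 2 ≤ count others
          many = ≤-pred (≤-trans three (≤-trans (deg≤adj x) (≤-reflexive (count-remove (adj x) w (⌊⌋-yes (adj? x w) xw)))))
          unpack : ∀ {v} → others v ≡ true → Adjacent G x v × v ≢ w
          unpack {v} p = let q , r = ∧-true p in adj-of q , ⌊⌋-false (v ≟ w) (not-true r)
          is-full : ∀ {v} → Adjacent G x v → v ≢ w → deg G v ≡ D
          is-full {v} p v≢w with full-or-not v
          ... | inj₁ q = q
          ... | inj₂ q = ⊥-elim (TwoAlmostFull.contradiction (v≢w ∘ sym) w+1 (NeighbourOf.almost p q)
                  (NeighbourOf.y≢a xw) (NeighbourOf.y≢b xw) (NeighbourOf.y≢a p) (NeighbourOf.y≢b p))
          pick : ∃ (λ y → others y ≡ true) → _
          pick (y , p) with count-two others many y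
          ... | z , q , z≢y with unpack p | unpack q
          ...   | xy , y≢w | xz , z≢w = y , z , z≢y ∘ sym , (xy , is-full xy y≢w) , (xz , is-full xz z≢w)

        module WithNeighbours {y z} (y≢z : y ≢ z) (xy : Adjacent G x y) (xz : Adjacent G x z)
                              (y-full : deg G y ≡ D) (z-full : deg G z ≡ D) where
          module Y = NeighbourOf xy
          module Z = NeighbourOf xz

          common : Fin n → Bool
          common = four (adj b) (adj c) (adj y) (adj z)

          -- Of the four neighbourhoods, b can lie only in that of c and c only in that of b; x and
          -- its neighbours avoid those of b and c; a avoids those of y and z. Including `adj x`
          -- yields d + 3 common neighbours, enough to outnumber the colours seen at x.
          corrected : List (Fin n → Bool)
          corrected = is b ∷ is b ∷ is c ∷ is c ∷ is x ∷ is a ∷ adj x ∷ adj b ∷ adj c ∷ adj y ∷ adj z ∷ []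

          bound : ∀ w → total corrected w ≤ 3 + ind (common w)
          bound w = pure (is b w) (is c w) (is x w) (is a w) (adj x w) (adj b w) (adj c w) (adj y w) (adj z w) at-b at-c at-x at-a at-nbr
            where
            pure : ∀ eb ec ex ea t p q r s →
                   (eb ≡ true → ec ≡ false × ex ≡ false × ea ≡ false × t ≡ false × p ≡ false × r ≡ false × s ≡ false) →
                   (ec ≡ true → ex ≡ false × ea ≡ false × t ≡ false × q ≡ false × r ≡ false × s ≡ false) →
                   (ex ≡ true → ea ≡ false × t ≡ false × p ≡ false × q ≡ false) →
                   (ea ≡ true → t ≡ false × r ≡ false × s ≡ false) →
                   (t ≡ true → p ≡ false × q ≡ false) →
                   ind eb + (ind eb + (ind ec + (ind ec + (ind ex + (ind ea + (ind t + (ind p + (ind q + (ind r + (ind s + 0)))))))))) ≤ 3 + ind (p ∧ q ∧ r ∧ s)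
            pure true ec ex ea t p q r s hb hc hx ha ht with hb refl
            ... | refl , refl , refl , refl , refl , refl , refl = s≤s (s≤s (≤-trans (≤-reflexive (+-identityʳ _)) (ind-≤1 q)))
            pure false true ex ea t p q r s hb hc hx ha ht with hc refl
            ... | refl , refl , refl , refl , refl , refl = s≤s (s≤s (≤-trans (≤-trans (≤-reflexive (+-identityʳ _)) (ind-≤1 p)) (m≤m+n 1 _)))
            pure false false true ea t p q r s hb hc hx ha ht with hx refl
            ... | refl , refl , refl , refl = s≤s (≤-trans (+-mono-≤ (ind-≤1 r) (+-monoˡ-≤ 0 (ind-≤1 s))) (m≤m+n 2 _))
            pure false false false true t p q r s hb hc hx ha ht with ha refl
            ... | refl , refl , refl = s≤s (≤-trans (+-mono-≤ (ind-≤1 p) (+-monoˡ-≤ 0 (ind-≤1 q))) (m≤m+n 2 _))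
            pure false false false false true p q r s hb hc hx ha ht with ht refl
            ... | refl , refl = s≤s (≤-trans (+-mono-≤ (ind-≤1 r) (+-monoˡ-≤ 0 (ind-≤1 s))) (m≤m+n 2 _))
            pure false false false false false p q r s hb hc hx ha ht = four-bound p q r s
            at-b : is b w ≡ true → is c w ≡ false × is x w ≡ false × is a w ≡ false × adj x w ≡ false × adj b w ≡ false × adj y w ≡ false × adj z w ≡ false
            at-b e with ⌊⌋-true (w ≟ b) e
            ... | refl = non-is (c≢b ∘ sym) , non-is (x≢b ∘ sym) , non-is (a≢b ∘ sym) , non-adj (b≁x ∘ adj-sym) , non-adj irrefl , non-adj (Y.b≁y ∘ adj-sym) , non-adj (Z.b≁y ∘ adj-sym)
            at-c : is c w ≡ true → is x w ≡ false × is a w ≡ false × adj x w ≡ false × adj c w ≡ false × adj y w ≡ false × adj z w ≡ false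
            at-c e with ⌊⌋-true (w ≟ c) e
            ... | refl = non-is (x≢c ∘ sym) , non-is (a≢c ∘ sym) , non-adj (c≁x ∘ adj-sym) , non-adj irrefl , non-adj (Y.c≁y ∘ adj-sym) , non-adj (Z.c≁y ∘ adj-sym)
            at-x : is x w ≡ true → is a w ≡ false × adj x w ≡ false × adj b w ≡ false × adj c w ≡ false
            at-x e with ⌊⌋-true (w ≟ x) e
            ... | refl = non-is x≢a , non-adj irrefl , non-adj b≁x , non-adj c≁x
            at-a : is a w ≡ true → adj x w ≡ false × adj y w ≡ false × adj z w ≡ false
            at-a e with ⌊⌋-true (w ≟ a) e
            ... | refl = non-adj (a≁x ∘ adj-sym) , non-adj (Y.a≁y ∘ adj-sym) , non-adj (Z.a≁y ∘ adj-sym)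
            at-nbr : adj x w ≡ true → adj b w ≡ false × adj c w ≡ false
            at-nbr e = non-adj (NeighbourOf.b≁y (adj-of e)) , non-adj (NeighbourOf.c≁y (adj-of e))

          many-common : d + 3 ≤ count common
          many-common = +-cancelˡ-≤ (4 * D + 3) (d + 3) (count common) (begin
            4 * D + 3 + (d + 3)                                 ≡⟨ lhs D d ⟩
            6 + (d + (D + (D + (D + (D + 0)))))                 ≡⟨ cong (λ t → 6 + (d + t)) (cong₂ _+_ (sym b-full) (cong₂ _+_ (sym c-full) (cong₂ _+_ (sym y-full) (cong (_+ 0) (sym z-full))))) ⟩
            6 + (d + (deg G b + (deg G c + (deg G y + (deg G z + 0))))) ≤⟨ +-monoʳ-≤ 6 (+-mono-≤ (deg≤adj x) (+-mono-≤ (deg≤adj b) (+-mono-≤ (deg≤adj c) (+-mono-≤ (deg≤adj y) (+-monoˡ-≤ 0 (deg≤adj z)))))) ⟩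
            6 + adjs                                            ≡⟨ cong₂ (λ s t → s + (s + t)) (sym (count-is b)) (cong₂ (λ s t → s + (s + t)) (sym (count-is c)) (cong₂ (λ s t → s + (t + adjs)) (sym (count-is x)) (sym (count-is a)))) ⟩
            counts corrected                                    ≤⟨ counts-≤ corrected 3 common bound ⟩
            n * 3 + count common                                ≡⟨ cong (_+ count common) (*-comm n 3) ⟩
            3 * n + count common                                ≤⟨ +-monoˡ-≤ (count common) dense ⟩
            4 * D + 3 + count common                            ∎)
            where
            open ≤-Reasoning
            open +-*-Solver
            adjs = counts (adj x ∷ adj b ∷ adj c ∷ adj y ∷ adj z ∷ [])
            lhs : ∀ D d → 4 * D + 3 + (d + 3) ≡ 6 + (d + (D + (D + (D + (D + 0)))))
            lhs = solve 2 (λ D d → con 4 :* D :+ con 3 :+ (d :+ con 3) := con 6 :+ (d :+ (D :+ (D :+ (D :+ (D :+ con 0)))))) refl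

          common-adj : ∀ {u} → common u ≡ true → Adjacent G b u × Adjacent G c u × Adjacent G y u × Adjacent G z u
          common-adj {u} p with four-true {adj b} {adj c} {adj y} {adj z} {u} p
          ... | q , r , s , t = ⌊⌋-true (adj? b u) q , ⌊⌋-true (adj? c u) r , ⌊⌋-true (adj? y u) s , ⌊⌋-true (adj? z u) t

          module WithColouring (col : Col) {β} (bβ : ¬ Has col b β) (xβ : ¬ Has col x β) where

            at-colour : ∀ {v u w f g} → v ≢ a → v ≢ b → Joins G f v u → Joins G g v w → φ col f ≡ φ col g → u ≡ w
            at-colour v≢a v≢b vu vw e = joins-determined vu (subst (λ f → Joins G f _ _)
              (sym (Kempe.unique G S₀ (φ col) (proper col) (joins-S₀ (joins-sym G vu) v≢a v≢b) (joins-S₀ (joins-sym G vw) v≢a v≢b)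
                (joins-ˡ G vu) (joins-ˡ G vw) e)) vw)

            zβ? : ∀ u → Dec (∃ λ e → Joins G e z u × φ col e ≡ β)
            zβ? u = any? λ e → joins? e z u ×-dec (φ col e ≟ β)

            avoiding : Fin n → Bool
            avoiding u = common u ∧ not ⌊ zβ? u ⌋

            many-avoiding : d + 2 ≤ count avoiding
            many-avoiding = ≤-pred (≤-trans (≤-reflexive (sym (+-suc d 2))) (≤-trans many-common
              (count-drop common (λ u → not ⌊ zβ? u ⌋) λ {u} {w} _ _ p q → same (⌊⌋-true (zβ? u) (not-false p)) (⌊⌋-true (zβ? w) (not-false q)))))
              where
              not-false : ∀ {b} → not b ≡ false → b ≡ true
              not-false {true} _ = refl
              same : ∀ {u w} → (∃ λ e → Joins G e z u × φ col e ≡ β) → (∃ λ e → Joins G e z w × φ col e ≡ β) → u ≡ w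
              same (_ , p , q) (_ , r , s) = at-colour Z.y≢a Z.y≢b p r (trans q (sym s))

            used : Fin D → Bool
            used i = ⌊ sees? G S₀ (φ col) x i ⌋ ∨ ⌊ i ≟ β ⌋

            count-used : count used ≤ d + 1
            count-used = ≤-trans (≤-reflexive (count-sum-of used (λ i → ⌊ sees? G S₀ (φ col) x i ⌋) (λ i → ⌊ i ≟ β ⌋) split-used))
              (+-mono-≤ (≤-trans (seen≤degOn col x) (degOn-≤ x)) (≤-reflexive (count-single β)))
              where
              split-used : ∀ i → ind (used i) ≡ ind ⌊ sees? G S₀ (φ col) x i ⌋ + ind ⌊ i ≟ β ⌋
              split-used i with sees? G S₀ (φ col) x i | i ≟ β
              ... | yes p | yes refl = ⊥-elim (xβ p)
              ... | yes _ | no _ = refl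
              ... | no _ | yes _ = refl
              ... | no _ | no _ = refl

            free? : ∀ u → Dec (∃ λ e → Joins G e y u × used (φ col e) ≡ false)
            free? u = any? λ e → joins? e y u ×-dec (used (φ col e) ≟ᵇ false)

            -- At most one common neighbour is joined to z in colour β, so d + 2 remain. Their edges
            -- to y have distinct colours, while at most d + 1 colours are β or seen at x. Some edge
            -- yu thus has a colour other than β that x misses.
            good-neighbour : ∃ λ u → avoiding u ≡ true × (∃ λ e → Joins G e y u × used (φ col e) ≡ false)
            good-neighbour with any? (λ u → (avoiding u ≟ᵇ true) ×-dec free? u)
            ... | yes p = p
            ... | no none = ⊥-elim (<⇒≱ (≤-reflexive (sym (+-suc d 1))) (≤-trans many-avoiding (≤-trans
              (count-inject avoiding used (λ u i → ∃ λ e → Joins G e y u × φ col e ≡ i) (λ u p → colour p (proj₁ (proj₂ (proj₂ (common-adj (proj₁ (∧-true p)))))))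
                (λ { _ _ (_ , p , q) (_ , r , s) → at-colour Y.y≢a Y.y≢b p r (trans q (sym s)) })) count-used)))
              where
              colour : ∀ {u} → avoiding u ≡ true → Adjacent G y u → ∃ λ i → used i ≡ true × (∃ λ e → Joins G e y u × φ col e ≡ i)
              colour {u} p (e , j) with used (φ col e) in q
              ... | true = φ col e , q , e , j , refl
              ... | false = ⊥-elim (none (u , p , e , j , q))

            impossible : ⊥
            impossible = go good-neighbour
              where
              go : (∃ λ u → avoiding u ≡ true × (∃ λ e → Joins G e y u × used (φ col e) ≡ false)) → ⊥
              go (u , p , g , yu , free) = at (common-adj (proj₁ (∧-true p)))
                where
                x-free : ¬ Has col x (φ col g)
                x-free q with trans (sym free) (cong (_∨ ⌊ φ col g ≟ β ⌋) (⌊⌋-yes (sees? G S₀ (φ col) x (φ col g)) q))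
                ... | ()
                g≢β : φ col g ≢ β
                g≢β q with trans (sym free) (trans (cong (⌊ sees? G S₀ (φ col) x (φ col g) ⌋ ∨_) (⌊⌋-yes (φ col g ≟ β) q)) (∨-zeroʳ _))
                ... | ()
                at : Adjacent G b u × Adjacent G c u × Adjacent G y u × Adjacent G z u → ⊥
                at ((f , bu) , (f′ , cu) , _ , (g′ , zu)) = Recolour.impossible (record
                  { bu = bu ; cu = cu ; uy = joins-sym G yu ; uz = joins-sym G zu
                  ; yx = joins-sym G (proj₂ xy) ; zx = joins-sym G (proj₂ xz)
                  ; dist =
                      (a≢b ∷ a≢c ∷ u≢a ∘ sym ∷ Y.y≢a ∘ sym ∷ Z.y≢a ∘ sym ∷ x≢a ∘ sym ∷ []) ∷
                      (c≢b ∘ sym ∷ u≢b ∘ sym ∷ Y.y≢b ∘ sym ∷ Z.y≢b ∘ sym ∷ x≢b ∘ sym ∷ []) ∷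
                      (joins-≢ G cu ∷ Y.y≢c ∘ sym ∷ Z.y≢c ∘ sym ∷ x≢c ∘ sym ∷ []) ∷
                      (joins-≢ G yu ∘ sym ∷ joins-≢ G zu ∘ sym ∷ (λ { refl → b≁x (f , bu) }) ∷ []) ∷
                      (y≢z ∷ adj-≢ xy ∘ sym ∷ []) ∷ (adj-≢ xz ∘ sym ∷ []) ∷ [] ∷ []
                  ; u-full = P.neighbour-full bu u≢a ; y-full = y-full ; z-full = z-full ; room = room
                  ; α≢γ = differ bu cu (c≢b ∘ sym) ; α≢τ = differ bu yu (Y.y≢b ∘ sym) ; α≢σ = differ bu zu (Z.y≢b ∘ sym)
                  ; γ≢τ = differ cu yu (Y.y≢c ∘ sym) ; γ≢σ = differ cu zu (Z.y≢c ∘ sym)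
                  ; α≢β = λ q → bβ (f , joins-S₀ bu u≢a u≢b , joins-ˡ G bu , q) ; γ≢β = f′≢β ; τ≢β = g≢β ; σ≢β = g′≢β
                  }) {col} (record { at-f = refl ; at-f′ = refl ; at-g = refl ; at-g′ = refl ; bβ = bβ ; xτ = x-free }) xβ
                  where
                  u≢b : u ≢ b
                  u≢b = joins-≢ G bu ∘ sym
                  u≢a : u ≢ a
                  u≢a refl = Y.a≁y (g , joins-sym G yu)
                  differ : ∀ {v w f g} → Joins G f v u → Joins G g w u → v ≢ w → φ col f ≢ φ col g
                  differ vu wu v≢w e = v≢w (at-colour u≢a u≢b (joins-sym G vu) (joins-sym G wu) e)
                  f′≢β : φ col f′ ≢ β
                  f′≢β q = u≢a (at-colour (a≢c ∘ sym) c≢b cu (joins-sym G ac) (trans q (sym (k-colour col bβ))))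
                  g′≢β : φ col g′ ≢ β
                  g′≢β q = ⌊⌋-false (zβ? u) (not-true (proj₂ (∧-true {common u} p))) (g′ , zu , q)
                  -- Room for regaining β at x while α, γ, τ and σ are protected; it follows from 3d
                  -- + 3 ≤ D once d ≥ 2.
                  room : deg G x + 4 < D
                  room = ≤-trans (≤-trans (≤-reflexive (sym (+-suc d 4))) (≤-trans (five d (≤-trans 2≤common (deg≥2))) ≤-refl)) d≤D/3
                    where
                    deg≥2 : 2 ≤ d
                    deg≥2 = +-cancelʳ-≤ (deg G y) 2 d (≤-trans (≤-reflexive (trans (+-comm 2 _) (cong (_+ 2) y-full))) (edge-sum (proj₂ xy)))
                    2≤common : 2 ≤ 2
                    2≤common = ≤-refl
                    five : ∀ d → 2 ≤ d → d + 5 ≤ 3 * d + 3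
                    five d 2≤d = begin
                      d + 5             ≡⟨ sym (+-assoc d 2 3) ⟩
                      d + 2 + 3         ≤⟨ +-monoˡ-≤ 3 (+-monoʳ-≤ d (≤-trans 2≤d (m≤m+n d (d + 0)))) ⟩
                      3 * d + 3         ∎
                      where open ≤-Reasoning

        contradiction : ⊥
        contradiction = go two-full
          where
          go : (∃₂ λ y z → y ≢ z × (Adjacent G x y × deg G y ≡ D) × (Adjacent G x z × deg G z ≡ D)) → ⊥
          go (y , z , y≢z , (xy , yf) , (xz , zf)) = choose (gainB c₀ x≢a x≢b [] _ (proj₂ (someB c₀ P.2≤a)) (λ ()) (P.room₀ x<D))
            where
            choose : GainedB c₀ x [] → ⊥
            choose (col , β , bβ , _ , xβ , _) = WithNeighbours.WithColouring.impossible y≢z xy xz yf zf col bβ xβ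

      near-all : ∀ x → Near b x
      near-all x with near? b x
      ... | yes p = p
      ... | no far = ⊥-elim (FarVertex.contradiction far)

      others-full : ∀ x → x ≢ a → x ≢ b → deg G x ≡ D
      others-full x x≢a x≢b with full-or-not x
      ... | inj₁ p = p
      ... | inj₂ x<D = ⊥-elim (choose (gainB c₀ x≢a x≢b [] _ (proj₂ (someB c₀ P.2≤a)) (λ ()) (P.room₀ x<D)))
        where
        x+1 : deg G x + 1 ≡ D
        x+1 = near-almost-full (near-all x) x≢a x≢b x<D
        rest-full : ∀ v → v ≢ a → v ≢ b → v ≢ x → deg G v ≡ D
        rest-full v v≢a v≢b v≢x with full-or-not v
        ... | inj₁ p = p
        ... | inj₂ v<D = ⊥-elim (TwoAlmostFull.contradiction (v≢x ∘ sym) x+1 (near-almost-full (near-all v) v≢a v≢b v<D) x≢a x≢b v≢a v≢b)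
        -- The class of β misses b and x, every other class misses one vertex only.
        choose : GainedB c₀ x [] → ⊥
        choose (col , β , bβ , _ , xβ , _) = clash (Pair.Of.someB G D unc b a e₀ (joins-sym G ab) (trans (+-comm (deg G b) (deg G a)) degs) col Q.2≤a)
          where
          sees : Fin D → Fin n → Bool
          sees i v = ⌊ sees? G S₀ (φ col) v i ⌋
          missing : ∀ i → 2 * count (class G S₀ (φ col) (proper col) i) + count (not ∘ sees i) ≡ n
          missing i = trans (cong (_+ count (not ∘ sees i)) (sym (class-cover G S₀ (φ col) (proper col) i))) (count-not (sees i))
          has : ∀ {i v} → Has col v i → not (sees i v) ≡ false
          has {i} {v} p = cong not (⌊⌋-yes (sees? G S₀ (φ col) v i) p)
          hasn't : ∀ {i v} → ¬ Has col v i → not (sees i v) ≡ true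
          hasn't {i} {v} p = cong not (⌊⌋-no (sees? G S₀ (φ col) v i) p)
          two : count (not ∘ sees β) ≡ 2
          two = trans (count-sum-of (not ∘ sees β) (is b) (is x) each) (cong₂ _+_ (count-is b) (count-is x))
            where
            each : ∀ v → ind (not (sees β v)) ≡ ind (is b v) + ind (is x v)
            each v with v ≟ b | v ≟ x
            ... | yes refl | yes p = ⊥-elim (x≢b (sym p))
            ... | yes refl | no _ = cong ind (hasn't bβ)
            ... | no _ | yes refl = cong ind (hasn't xβ)
            ... | no v≢b | no v≢x with v ≟ a
            ...   | yes refl = cong ind (has (has-a col bβ))
            ...   | no v≢a = cong ind (has (full col v≢a v≢b (rest-full v v≢a v≢b v≢x) β))
          one : ∀ {i} → ¬ Has col a i → count (not ∘ sees i) ≡ 1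
          one {i} ai = trans (count-cong (not ∘ sees i) (is a) each) (count-is a)
            where
            each : ∀ v → not (sees i v) ≡ is a v
            each v with v ≟ a
            ... | yes refl = hasn't ai
            ... | no v≢a with v ≟ b | v ≟ x
            ...   | yes refl | _ = has (has-b col ai)
            ...   | no v≢b | no v≢x = has (full col v≢a v≢b (rest-full v v≢a v≢b v≢x) i)
            ...   | no v≢b | yes refl with sees? G S₀ (φ col) x i
            ...     | yes p = refl
            ...     | no p with misses-one col x≢a x≢b x+1 p xβ
            ...       | refl = ⊥-elim (not-both col ai bβ)
          -- A class covers evenly many vertices, so n is even by the class of β and odd by that of
          -- `i`. A colour `i` missing at a exists because b has degree at least two.
          clash : ∃ (λ i → ¬ Has col a i) → ⊥
          clash (i , ai) = even≢odd (suc (count (class G S₀ (φ col) (proper col) β))) (count (class G S₀ (φ col) (proper col) i)) (begin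
            2 * suc (count (class G S₀ (φ col) (proper col) β))   ≡⟨ trans (*-suc 2 _) (+-comm 2 _) ⟩
            2 * count (class G S₀ (φ col) (proper col) β) + 2     ≡⟨ cong (2 * count (class G S₀ (φ col) (proper col) β) +_) (sym two) ⟩
            _                                                     ≡⟨ trans (missing β) (sym (missing i)) ⟩
            _                                                     ≡⟨ cong (2 * count (class G S₀ (φ col) (proper col) i) +_) (one ai) ⟩
            2 * count (class G S₀ (φ col) (proper col) i) + 1     ≡⟨ +-comm _ 1 ⟩
            suc (2 * count (class G S₀ (φ col) (proper col) i))   ∎)
            where open ≡-Reasoning

-- Contracting ab

maxF-≤ : ∀ {k} (f : Fin k → ℕ) {c} → (∀ x → f x ≤ c) → maxF f ≤ c
maxF-≤ {zero} f h = z≤n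
maxF-≤ {suc k} f h = ⊔-lub (h zero) (maxF-≤ (f ∘ suc) (h ∘ suc))

-- `splitEnds` places the second half of the split vertex and the new edge at index zero; this
-- bijection moves b and `e₀` there.
toFront : ∀ {k} → Fin (suc k) → Fin (suc k) ↔ Fin (suc k)
toFront {k} i = mk↔ₛ′ to from to-from from-to
  where
  to : Fin (suc k) → Fin (suc k)
  to j with i ≟ j
  ... | yes _ = zero
  ... | no i≢j = suc (punchOut i≢j)
  from : Fin (suc k) → Fin (suc k)
  from zero = i
  from (suc j) = punchIn i j
  to-from : ∀ j → to (from j) ≡ j
  to-from zero with i ≟ i
  ... | yes _ = refl
  ... | no p = ⊥-elim (p refl)
  to-from (suc j) with i ≟ punchIn i j
  ... | yes p = ⊥-elim (punchInᵢ≢i i j (sym p))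
  ... | no p = cong suc (trans (punchOut-cong i refl) (punchOut-punchIn i))
  from-to : ∀ j → from (to j) ≡ j
  from-to j with i ≟ j
  ... | yes p = p
  ... | no p = punchIn-punchOut p

-- Both sizes are taken as successors so that `punchIn` and `punchOut` can delete b and `e₀`.
module Contract {n m′} (ends′ : Fin (suc m′) → Fin (suc n) × Fin (suc n)) (loopless′ : ∀ e → proj₁ (ends′ e) ≢ proj₂ (ends′ e)) where

  G : Multigraph (suc n)
  G = record { m = suc m′ ; ends = ends′ ; loopless = loopless′ }

  module Result (simple : IsSimple G) (D : ℕ) (deg≤ : ∀ v → deg G v ≤ D) (unc : ¬ ColourableOn G (allEdges G) D)
           (del : ∀ e → ColourableOn G (λ f → not ⌊ f ≟ e ⌋) D)
           (a b : Fin (suc n)) (e₀ : Fin (suc m′)) (ab : Joins G e₀ a b) (degs : deg G a + deg G b ≡ D + 2)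
           (others-full : ∀ v → v ≢ a → v ≢ b → deg G v ≡ D) where
    open Simple G simple
    open Pair G D unc a b e₀ ab degs using (S₀; a≢b; module Of; S₀-≢; S₀-other)
    open Of (del e₀)

    classes : Fin D → ℕ
    classes i = count (class G S₀ φ proper i)

    class-size : ∀ i → suc (2 * classes i) ≡ suc n
    class-size i = trans (+-comm 1 _) (trans (cong₂ _+_ (sym (class-cover G S₀ φ proper i)) (sym one))
                                             (count-not (λ v → ⌊ sees? G S₀ φ v i ⌋)))
      where
      the-one : ∃ λ w → ∀ v → not ⌊ sees? G S₀ φ v i ⌋ ≡ ⌊ v ≟ w ⌋
      the-one with split i
      ... | inj₁ (ai , bi) = a , each
        where
        each : ∀ v → not ⌊ sees? G S₀ φ v i ⌋ ≡ ⌊ v ≟ a ⌋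
        each v with v ≟ a
        ... | yes refl = cong not (⌊⌋-no (sees? G S₀ φ a i) ai)
        ... | no v≢a with v ≟ b
        ...   | yes refl = cong not (⌊⌋-yes (sees? G S₀ φ b i) bi)
        ...   | no v≢b = cong not (⌊⌋-yes (sees? G S₀ φ v i) (full v≢a v≢b (others-full v v≢a v≢b) i))
      ... | inj₂ (ai , bi) = b , each
        where
        each : ∀ v → not ⌊ sees? G S₀ φ v i ⌋ ≡ ⌊ v ≟ b ⌋
        each v with v ≟ b
        ... | yes refl = cong not (⌊⌋-no (sees? G S₀ φ b i) bi)
        ... | no v≢b with v ≟ a
        ...   | yes refl = cong not (⌊⌋-yes (sees? G S₀ φ a i) ai)
        ...   | no v≢a = cong not (⌊⌋-yes (sees? G S₀ φ v i) (full v≢a v≢b (others-full v v≢a v≢b) i))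
      one : count (λ v → not ⌊ sees? G S₀ φ v i ⌋) ≡ 1
      one = trans (count-cong (λ v → not ⌊ sees? G S₀ φ v i ⌋) (λ v → ⌊ v ≟ proj₁ the-one ⌋) (proj₂ the-one)) (count-single (proj₁ the-one))

    overfull : D * (suc n / 2) < suc m′
    overfull = ≤-reflexive (begin
      suc (D * (suc n / 2))           ≡⟨ cong suc (sym (trans (class-total G S₀ φ proper) (trans (sum-cong-≗ size) (sum-const D _)))) ⟩
      suc (count S₀)                  ≡⟨ sym (count-remove (λ _ → true) e₀ refl) ⟩
      count {suc m′} (λ _ → true)     ≡⟨ count-true (suc m′) ⟩
      suc m′                          ∎)
      where
      open ≡-Reasoning
      size : ∀ i → classes i ≡ suc n / 2
      size i = trans (sym (half (classes i))) (cong (_/ 2) (class-size i))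
        where
        half : ∀ k → suc (2 * k) / 2 ≡ k
        half k = trans (cong (λ t → suc t / 2) (*-comm 2 k)) (go k)
          where
          go : ∀ k → suc (k * 2) / 2 ≡ k
          go zero = refl
          go (suc k) = trans (+-distrib-/-∣ˡ {2} (suc (k * 2)) {2} (divides 1 refl)) (cong suc (go k))

    -- Contraction of ab: index b is deleted and b is sent to the image of a.
    π : Fin (suc n) → Fin n
    π v with b ≟ v
    ... | yes _ = punchOut (a≢b ∘ sym)
    ... | no b≢v = punchOut b≢v

    w₀ : Fin n
    w₀ = punchOut (a≢b ∘ sym)

    π-b : π b ≡ w₀
    π-b with b ≟ b
    ... | yes _ = refl
    ... | no p = ⊥-elim (p refl)

    π-other : ∀ {v} (b≢v : b ≢ v) → π v ≡ punchOut b≢v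
    π-other {v} b≢v with b ≟ v
    ... | yes p = ⊥-elim (b≢v p)
    ... | no p = punchOut-cong b refl

    π-a : π a ≡ w₀
    π-a = π-other (a≢b ∘ sym)

    π-punchIn : ∀ w → π (punchIn b w) ≡ w
    π-punchIn w = trans (π-other (punchInᵢ≢i b w ∘ sym)) (punchOut-punchIn b)

    π-cases : ∀ {u v} → π u ≡ π v → u ≡ v ⊎ ((u ≡ a × v ≡ b) ⊎ (u ≡ b × v ≡ a))
    π-cases {u} {v} e with b ≟ u | b ≟ v
    ... | yes p | yes q = inj₁ (trans (sym p) q)
    ... | yes p | no q = inj₂ (inj₂ (sym p , sym (punchOut-injective (a≢b ∘ sym) q e)))
    ... | no p | yes q = inj₂ (inj₁ (punchOut-injective p (a≢b ∘ sym) e , sym q))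
    ... | no p | no q = inj₁ (punchOut-injective p q e)

    lift : Fin m′ → Fin (suc m′)
    lift = punchIn e₀

    lift-≢ : ∀ e → lift e ≢ e₀
    lift-≢ = punchInᵢ≢i e₀

    lift-S₀ : ∀ e → S₀ (lift e) ≡ true
    lift-S₀ e = S₀-other (lift-≢ e)

    -- A loop could only come from a second edge ab, which simplicity forbids. Common neighbours of
    -- a and b give rise to parallel edges.
    M : Multigraph n
    M = record
      { m = m′
      ; ends = λ e → π (proj₁ (ends′ (lift e))) , π (proj₂ (ends′ (lift e)))
      ; loopless = λ e p → no-loop e (π-cases p) }
      where
      no-loop : ∀ e → _ → ⊥
      no-loop e (inj₁ p) = loopless′ (lift e) p
      no-loop e (inj₂ c) = lift-≢ e (joins-unique c ab)

    lift-incident : ∀ {w e} → Incident M w e → ∃ λ v → Incident G v (lift e) × π v ≡ w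
    lift-incident (inj₁ p) = _ , inj₁ refl , p
    lift-incident (inj₂ p) = _ , inj₂ refl , p

    incident-π : ∀ {v e} → Incident G v (lift e) → Incident M (π v) e
    incident-π (inj₁ refl) = inj₁ refl
    incident-π (inj₂ refl) = inj₂ refl

    χ : Fin m′ → Fin D
    χ e = φ (lift e)

    -- At the merged vertex the edges of a and those of b use disjoint sets of colours, by
    -- `not-neither`.
    χ-proper : ProperColouringOn M (allEdges M) D χ
    χ-proper e f e≢f _ _ w we wf eq with lift-incident {w} {e} we | lift-incident {w} {f} wf
    ... | u , ue , pu | v , vf , pv with π-cases {u} {v} (trans pu (sym pv))
    ...   | inj₁ refl = proper (lift e) (lift f) (e≢f ∘ punchIn-injective e₀ e f) (lift-S₀ e) (lift-S₀ f) u ue vf eq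
    ...   | inj₂ (inj₁ (refl , refl)) = not-neither (lift e , lift-S₀ e , ue , refl) (lift f , lift-S₀ f , vf , sym eq)
    ...   | inj₂ (inj₂ (refl , refl)) = not-neither (lift f , lift-S₀ f , vf , refl) (lift e , lift-S₀ e , ue , eq)

    M-sees : ∀ w i → Sees M (allEdges M) χ w i
    M-sees w i with punchIn b w ≟ a
    ... | no v≢a = project (full v≢a (punchInᵢ≢i b w) (others-full _ v≢a (punchInᵢ≢i b w)) i) (π-punchIn w)
      where
      project : ∀ {v} → Has v i → π v ≡ w → Sees M (allEdges M) χ w i
      project {v} (e , Se , ve , c) refl = e′ , refl , incident-π (subst (Incident G v) (sym e≡) ve) , trans (cong φ e≡) c
        where
        e′ = punchOut (S₀-≢ Se ∘ sym)
        e≡ : lift e′ ≡ e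
        e≡ = punchIn-punchOut (S₀-≢ Se ∘ sym)
    ... | yes v≡a = either (split i)
      where
      w≡ : w ≡ w₀
      w≡ = trans (sym (π-punchIn w)) (trans (cong π v≡a) π-a)
      project : ∀ {v} → Has v i → π v ≡ w → Sees M (allEdges M) χ w i
      project {v} (e , Se , ve , c) refl = e′ , refl , incident-π (subst (Incident G v) (sym e≡) ve) , trans (cong φ e≡) c
        where
        e′ = punchOut (S₀-≢ Se ∘ sym)
        e≡ : lift e′ ≡ e
        e≡ = punchIn-punchOut (S₀-≢ Se ∘ sym)
      either : (¬ Has a i × Has b i) ⊎ (Has a i × ¬ Has b i) → Sees M (allEdges M) χ w i
      either (inj₁ (_ , h)) = project h (trans π-b (sym w≡))
      either (inj₂ (h , _)) = project h (trans π-a (sym w≡))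

    regular : Regular M D
    regular w = trans (sym (Colours.seen≡degOn M (allEdges M) χ χ-proper w))
      (trans (count-cong _ (λ _ → true) (λ i → ⌊⌋-yes (sees? M (allEdges M) χ w i) (M-sees w i))) (count-true D))

    maxDeg-M : maxDeg M ≡ D
    maxDeg-M = ≤-antisym (maxF-≤ (deg M) (≤-reflexive ∘ regular)) (≤-trans (≤-reflexive (sym (regular w₀))) (maxF-≥ M (deg M) w₀))

    class1 : Class1 M
    class1 = subst (IsChromaticIndex M) (sym maxDeg-M) ((χ , χ-proper) , λ j j<D (c , p) → <⇒≱ j<D (begin
      D              ≡⟨ sym (regular w₀) ⟩
      deg M w₀       ≤⟨ Colours.degOn≤seen M (allEdges M) c p w₀ ⟩
      _              ≤⟨ count-≤ _ ⟩
      j              ∎))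
      where open ≤-Reasoning

    -- The second half of the split vertex is b; the first, which keeps the edges not at b, is a.
    side : Fin m′ → Bool
    side e = incB G b (lift e)

    edge-beside : ∀ {v w} → Joins G e₀ v w → 2 ≤ deg G v → ∃ λ e → Incident G v (lift e)
    edge-beside {v} j 2≤ with count-two (incB G v) 2≤ e₀
    ... | e , p , e≢ = punchOut (e≢ ∘ sym) , subst (Incident G v) (sym (punchIn-punchOut (e≢ ∘ sym))) (true-incident G p)

    splitting : ObtainedBySplitting G M
    splitting = w₀ , side , at-b (edge-beside (joins-sym G ab) (two≤ (trans (+-comm (deg G b) (deg G a)) degs) (deg≤ a))) , at-a (edge-beside ab (two≤ degs (deg≤ b))) , toFront b , toFront e₀ , iso
      where
      at-b : (∃ λ e → Incident G b (lift e)) → ∃ λ e → Incident M w₀ e × side e ≡ true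
      at-b (e , p) = e , subst (λ w → Incident M w e) π-b (incident-π {b} {e} p) , incident-true G p
      not-both-ends : ∀ {e} → Incident G a (lift e) → ¬ Incident G b (lift e)
      not-both-ends {e} p q with incident-joins p
      ... | w , j with joins-only G j q
      ...   | inj₁ b≡a = a≢b (sym b≡a)
      ...   | inj₂ refl = lift-≢ e (joins-unique j ab)
      side-a : ∀ {e} → Incident G a (lift e) → side e ≡ false
      side-a {e} p with side e in s
      ... | false = refl
      ... | true = ⊥-elim (not-both-ends {e} p (true-incident G s))
      at-a : (∃ λ e → Incident G a (lift e)) → ∃ λ e → Incident M w₀ e × side e ≡ false
      at-a (e , p) = e , subst (λ w → Incident M w e) π-a (incident-π {a} {e} p) , side-a {e} p
      σ = Inverse.to (toFront b)
      σ-b : σ b ≡ zero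
      σ-b with b ≟ b
      ... | yes _ = refl
      ... | no p = ⊥-elim (p refl)
      σ-other : ∀ {v} (p : b ≢ v) → σ v ≡ suc (punchOut p)
      σ-other {v} p with b ≟ v
      ... | yes q = ⊥-elim (p q)
      ... | no q = cong suc (punchOut-cong b refl)
      placed : ∀ e v → Incident G v (lift e) → σ v ≡ (if ⌊ π v ≟ w₀ ⌋ then (if side e then zero else suc w₀) else suc (π v))
      placed e v p with v ≟ b | v ≟ a
      ... | yes refl | _ rewrite ⌊⌋-yes (π b ≟ w₀) π-b | incident-true G p = σ-b
      ... | no _ | yes refl rewrite ⌊⌋-yes (π a ≟ w₀) π-a | side-a {e} p = σ-other (a≢b ∘ sym)
      ... | no v≢b | no v≢a = trans (σ-other (v≢b ∘ sym)) (trans (cong suc (sym (π-other (v≢b ∘ sym))))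
          (cong (λ t → if t then (if side e then zero else suc w₀) else suc (π v)) (sym (⌊⌋-no (π v ≟ w₀) π≢))))
        where
        π≢ : π v ≢ w₀
        π≢ q = v≢a (punchOut-injective (v≢b ∘ sym) (a≢b ∘ sym) (trans (sym (π-other (v≢b ∘ sym))) q))
      iso : ∀ e → SameEnds (σ (proj₁ (ends′ e)) , σ (proj₂ (ends′ e))) (splitEnds M w₀ side (Inverse.to (toFront e₀) e))
      iso e with e₀ ≟ e
      ... | yes refl = new ab
        where
        new : Joins G e₀ a b → SameEnds (σ (proj₁ (ends′ e₀)) , σ (proj₂ (ends′ e₀))) (suc w₀ , zero)
        new (inj₁ (p , q)) = inj₁ (trans (cong σ p) (σ-other (a≢b ∘ sym)) , trans (cong σ q) σ-b)
        new (inj₂ (p , q)) = inj₂ (trans (cong σ p) σ-b , trans (cong σ q) (σ-other (a≢b ∘ sym)))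
      ... | no e₀≢e = inj₁ (old (proj₁ (ends′ (lift e′))) (inj₁ refl) (cong (σ ∘ proj₁ ∘ ends′) e≡) ,
                            old (proj₂ (ends′ (lift e′))) (inj₂ refl) (cong (σ ∘ proj₂ ∘ ends′) e≡))
        where
        e′ = punchOut e₀≢e
        e≡ : e ≡ lift e′
        e≡ = sym (punchIn-punchOut e₀≢e)
        old : ∀ v {s} → Incident G v (lift e′) → s ≡ σ v → s ≡ (if ⌊ π v ≟ w₀ ⌋ then (if side e′ then zero else suc w₀) else suc (π v))
        old v p q = trans q (placed e′ v p)

-- From criticality to the theorem

module Conclude {n} (G : Multigraph n) (simple : IsSimple G) (D : ℕ) (1≤D : 1 ≤ D) (dense : 3 * (n ∸ 1) ≤ 4 * D)
                (max : maxDeg G ≡ D) (critical : IsCritical G) where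

  deg≤ : ∀ v → deg G v ≤ D
  deg≤ v = ≤-trans (maxF-≥ G (deg G) v) (≤-reflexive max)

  unc : ¬ ColourableOn G (allEdges G) D
  unc c = proj₂ (proj₁ critical) D (s≤s (≤-reflexive (sym max))) c

  widen : ∀ {S k} → ColourableOn G S k → k < suc (maxDeg G) → ColourableOn G S D
  widen (c , p) k< = (λ e → inject≤ (c e) k≤) , λ e f e≢f Se Sf v ve vf q → p e f e≢f Se Sf v ve vf (inject≤-injective k≤ k≤ _ _ q)
    where k≤ = ≤-trans (≤-pred k<) (≤-reflexive max)

  del : ∀ e → ColourableOn G (λ f → not ⌊ f ≟ e ⌋) D
  del e with proj₂ critical (record { vertsH = λ _ → true ; edgesH = λ f → not ⌊ f ≟ e ⌋ ; closed = λ _ _ → refl , refl })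
                            (inj₁ (e , cong not (⌊≟⌋-refl e)))
  ... | k , (c , _) , k< = widen c k<

  -- Deleting an isolated vertex would give a proper subgraph with all edges, hence a D-colouring of
  -- G.
  edgeAt : ∀ v → ∃ (Incident G v)
  edgeAt v with any? (incident? G v)
  ... | yes p = p
  ... | no none with proj₂ critical (record { vertsH = λ w → not ⌊ w ≟ v ⌋ ; edgesH = λ _ → true
                                            ; closed = λ e _ → cong not (⌊⌋-no (_ ≟ v) (λ p → none (e , inj₁ p))) ,
                                                               cong not (⌊⌋-no (_ ≟ v) (λ p → none (e , inj₂ p))) })
                                    (inj₂ (v , cong not (⌊≟⌋-refl v)))
  ...   | k , (c , _) , k< = ⊥-elim (unc (widen c k<))

  dense′ : 3 * n ≤ 4 * D + 3
  dense′ = ≤-trans (≤-trans (*-monoʳ-≤ 3 (m≤n+m∸n n 1)) (≤-reflexive (trans (*-distribˡ-+ 3 1 (n ∸ 1)) (+-comm 3 _)))) (+-monoˡ-≤ 3 dense)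

  ordered-full : ∀ {a b e₀} → Joins G e₀ a b → deg G a + deg G b ≡ D + 2 → deg G a ≤ deg G b →
                 ∀ x → x ≢ a → x ≢ b → deg G x ≡ D
  ordered-full {a} {b} {e₀} ab degs a≤b with deg G a ℕ.≟ 2
  ... | yes a≡2 = Critical.Dense.SmallEnd.others-full G simple D deg≤ unc del edgeAt 1≤D dense′ a b e₀ ab degs a≡2
  ... | no a≢2 = Critical.Dense.LargeEnds.others-full G simple D deg≤ unc del edgeAt 1≤D dense′ a b e₀ ab degs
          (≤∧≢⇒< (two≤ degs (deg≤ b)) (a≢2 ∘ sym)) a≤b

  others-full : ∀ {a b e₀} → Joins G e₀ a b → deg G a + deg G b ≡ D + 2 → ∀ x → x ≢ a → x ≢ b → deg G x ≡ D
  others-full {a} {b} ab degs x x≢a x≢b with ≤-total (deg G a) (deg G b)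
  ... | inj₁ a≤b = ordered-full ab degs a≤b x x≢a x≢b
  ... | inj₂ b≤a = ordered-full (joins-sym G ab) (trans (+-comm (deg G b) (deg G a)) degs) b≤a x x≢b x≢a

theorem1p2 : (n Δ : ℕ) → 1 ≤ n → 1 ≤ Δ → 3 * (n ∸ 1) ≤ 4 * Δ →
    (G : Multigraph n) → IsSimple G → maxDeg G ≡ Δ → IsCritical G →
    HasFullDeficiencyPair G →
    Overfull G ×
    Σ (Multigraph (n ∸ 1)) (λ M → Regular M Δ × Class1 M × ObtainedBySplitting G M)
theorem1p2 (suc n) Δ _ 1≤Δ dense record { m = zero } simple max critical (_ , _ , (() , _) , _)
theorem1p2 (suc n) Δ _ 1≤Δ dense G@(record { m = suc m′ ; ends = ends′ ; loopless = loopless′ }) simple max critical (a , b , (e₀ , ab) , degs) =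
  subst (λ d → d * (suc n / 2) < suc m′) (sym max) C.overfull , C.M , C.regular , C.class1 , C.splitting
  where
  open Conclude G simple Δ 1≤Δ dense max critical
  degs′ : deg G a + deg G b ≡ Δ + 2
  degs′ = trans degs (cong (_+ 2) max)
  module C = Contract.Result ends′ loopless′ simple Δ deg≤ unc del a b e₀ ab degs′ (others-full ab degs′)
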